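{- Let $r$ be a positive integer, let $n\ge 1$ be a real number, and let $G$ be a graph with $iso(G\setminus S)\le \frac{|S|}{r+1/n}$ for all $S\subseteq V(G)$. If for all $S\subseteq V(G)$ $$\omega(G\setminus S)<\frac{1}{n}|S|+2,$$ then $G$ has a near $r$-factor. In particular, every $1$-tough graph $G$ with $iso(G\setminus S)\le \frac{|S|}{r+1}$ for all $S\subseteq V(G)$ has a near $r$-factor.
   Context: Graphs are finite, have no loops, but may have multiple edges; degrees count multiplicities. For $S\subseteq V(G)$, $G\setminus S$ is the graph obtained by deleting $S$; $\omega(\cdot)$ is the number of connected components and $iso(\cdot)$ the number of isolated vertices. A graph is $t$-tough ($t>0$ real) if $\omega(G\setminus S)\le\max\{1,|S|/t\}$ for all $S\subseteq V(G)$. A near $r$-factor is a spanning subgraph in which every vertex has degree $r$, except for at most one vertex of degree $r+1$. -}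

module Defs where

open import Data.Bool.Base using (if_then_else_; _∨_; true; false)
open import Data.Bool.Properties using (∨-comm)
open import Data.Fin.Base using (Fin; zero; suc; toℕ)
open import Data.Fin.Properties using (any?; toℕ-injective; toℕ<n)
  renaming (_≟_ to _≟ᶠ_)
open import Data.Fin.Subset using (Subset; ∣_∣; _∈_; _⊆_; _─_)
open import Data.Fin.Subset.Properties using (_∈?_; x∈p∧x∉q⇒x∈p─q)
open import Data.Integer.Base as ℤ using ()
open import Data.List.Base using (List; allFin; deduplicate; filter; length)
open import Data.Nat.Base as ℕ using (ℕ; zero; suc)
import Data.Nat.Properties as ℕ
open import Data.Product.Base using (Σ; ∃-syntax; _×_; _,_; proj₁; proj₂)
open import Data.Rational.Base as ℚ using (ℚ; 0ℚ; 1ℚ; ½)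
import Data.Rational.Properties as ℚ
open import Data.Rational.Solver using (module +-*-Solver)
open import Data.Sum.Base using (_⊎_; inj₁; inj₂; [_,_])
open import Relation.Binary.Construct.Closure.ReflexiveTransitive
  using (Star; ε; _◅_; _◅◅_)
open import Relation.Binary.PropositionalEquality
  using (_≡_; refl; sym; trans; cong; cong₂; subst; subst₂; _≢_)
open import Relation.Nullary using (¬_; Dec; yes; no; does; contradiction)
open import Relation.Nullary.Decidable
  using (_×-dec_; _⊎-dec_; map′; from-yes)
open import Algebra.Properties.CommutativeMonoid.Sum ℕ.+-0-commutativeMonoid
  using (sum)

------------------------------------------------------------------------
-- Real numbers: Cauchy sequences of rationals

-- Two sequences represent the same real number when each is ≤ the other;
-- all predicates below are invariant under this equivalence.
record ℝ : Set where
  no-eta-equality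
  field
    seq    : ℕ → ℚ
    cauchy : ∀ e → 0ℚ ℚ.< e →
             ∃[ N ] (∀ i j → N ℕ.≤ i → N ℕ.≤ j →
                     ℚ.∣ seq i ℚ.- seq j ∣ ℚ.< e)

open ℝ public

infix 4 _<_ _≤_

_<_ : ℝ → ℝ → Set
x < y = ∃[ e ] (0ℚ ℚ.< e ×
          (∃[ N ] (∀ i → N ℕ.≤ i → seq x i ℚ.+ e ℚ.≤ seq y i)))

-- Constructively, _≤_ is the negation of the converse of _<_, and not
-- the disjunction of _<_ and equality.
_≤_ : ℝ → ℝ → Set
x ≤ y = ¬ (y < x)

private
  0<½ : 0ℚ ℚ.< ½
  0<½ = from-yes (0ℚ ℚ.<? ½)

  0<1 : 0ℚ ℚ.< 1ℚ
  0<1 = from-yes (0ℚ ℚ.<? 1ℚ)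

  0<* : ∀ {p q} → 0ℚ ℚ.< p → 0ℚ ℚ.< q → 0ℚ ℚ.< p ℚ.* q
  0<* {p} {q} 0<p 0<q = ℚ.positive⁻¹ (p ℚ.* q)
    {{ℚ.pos*pos⇒pos p {{ℚ.positive 0<p}} q {{ℚ.positive 0<q}}}}

  0<+ : ∀ {p q} → 0ℚ ℚ.< p → 0ℚ ℚ.< q → 0ℚ ℚ.< p ℚ.+ q
  0<+ = ℚ.+-mono-<

  halves : ∀ e → e ℚ.* ½ ℚ.+ e ℚ.* ½ ≡ e
  halves e = trans (sym (ℚ.*-distribˡ-+ e ½ ½)) (ℚ.*-identityʳ e)

  0≤∣∣ : ∀ p → 0ℚ ℚ.≤ ℚ.∣ p ∣
  0≤∣∣ p = ℚ.nonNegative⁻¹ ℚ.∣ p ∣ {{ℚ.∣-∣-nonNeg p}}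

  p≤∣p∣ : ∀ p → p ℚ.≤ ℚ.∣ p ∣
  p≤∣p∣ p with ℚ.∣p∣≡p∨∣p∣≡-p p | ℚ.≤-total 0ℚ p
  ... | inj₁ eq | _        = ℚ.≤-reflexive (sym eq)
  ... | inj₂ _  | inj₁ 0≤p = ℚ.≤-reflexive (sym (ℚ.0≤p⇒∣p∣≡p 0≤p))
  ... | inj₂ _  | inj₂ p≤0 = ℚ.≤-trans p≤0 (0≤∣∣ p)

  p≡q+[p-q] : ∀ p q → p ≡ q ℚ.+ (p ℚ.- q)
  p≡q+[p-q] = solve 2 (λ p q → p := q :+ (p :- q)) refl
    where open +-*-Solver

  -[p-q]≡q-p : ∀ p q → ℚ.- (p ℚ.- q) ≡ q ℚ.- p
  -[p-q]≡q-p = solve 2 (λ p q → :- (p :- q) := q :- p) refl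
    where open +-*-Solver

  dist-sym : ∀ p q → ℚ.∣ p ℚ.- q ∣ ≡ ℚ.∣ q ℚ.- p ∣
  dist-sym p q = trans (sym (ℚ.∣-p∣≡∣p∣ (p ℚ.- q))) (cong ℚ.∣_∣ (-[p-q]≡q-p p q))

  dist⇒< : ∀ p q {e} → ℚ.∣ p ℚ.- q ∣ ℚ.< e → p ℚ.< q ℚ.+ e
  dist⇒< p q d = subst (ℚ._< _) (sym (p≡q+[p-q] p q))
    (ℚ.+-monoʳ-< q (ℚ.≤-<-trans (p≤∣p∣ (p ℚ.- q)) d))

  dist⇒<′ : ∀ p q {e} → ℚ.∣ p ℚ.- q ∣ ℚ.< e → q ℚ.< p ℚ.+ e
  dist⇒<′ p q d = dist⇒< q p (subst (ℚ._< _) (dist-sym p q) d)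

  <⇒- : ∀ p q {e} → p ℚ.< q ℚ.+ e → p ℚ.- q ℚ.< e
  <⇒- p q {e} h = subst (p ℚ.- q ℚ.<_) (lemma q e) (ℚ.+-monoˡ-< (ℚ.- q) h)
    where
    open +-*-Solver
    lemma : ∀ q e → (q ℚ.+ e) ℚ.- q ≡ e
    lemma = solve 2 (λ q e → (q :+ e) :- q := e) refl

  <⇒dist : ∀ p q {e} → p ℚ.< q ℚ.+ e → q ℚ.< p ℚ.+ e → ℚ.∣ p ℚ.- q ∣ ℚ.< e
  <⇒dist p q h k with ℚ.∣p∣≡p∨∣p∣≡-p (p ℚ.- q)
  ... | inj₁ eq = subst (ℚ._< _) (sym eq) (<⇒- p q h)
  ... | inj₂ eq = subst (ℚ._< _) (sym (trans eq (-[p-q]≡q-p p q))) (<⇒- q p k)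

  ⊔-< : ∀ a b c d {e} → a ℚ.< c ℚ.+ e → b ℚ.< d ℚ.+ e → a ℚ.⊔ b ℚ.< (c ℚ.⊔ d) ℚ.+ e
  ⊔-< a b c d {e} h k with ℚ.⊔-sel a b
  ... | inj₁ eq = subst (ℚ._< _) (sym eq) (ℚ.<-≤-trans h (ℚ.+-monoˡ-≤ e (ℚ.p≤p⊔q c d)))
  ... | inj₂ eq = subst (ℚ._< _) (sym eq) (ℚ.<-≤-trans k (ℚ.+-monoˡ-≤ e (ℚ.p≤q⊔p c d)))

  bounded : ∀ x → ∃[ b ] (0ℚ ℚ.< b × (∃[ N ] (∀ i → N ℕ.≤ i → ℚ.∣ seq x i ∣ ℚ.≤ b)))
  bounded x with cauchy x 1ℚ 0<1
  ... | N , c = ℚ.∣ a ∣ ℚ.+ 1ℚ , ℚ.+-mono-≤-< (0≤∣∣ a) 0<1 , N , λ i N≤i →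
    ℚ.≤-trans (ℚ.≤-reflexive (cong ℚ.∣_∣ (p≡q+[p-q] (seq x i) a)))
    (ℚ.≤-trans (ℚ.∣p+q∣≤∣p∣+∣q∣ a (seq x i ℚ.- a))
      (ℚ.+-monoʳ-≤ ℚ.∣ a ∣ (ℚ.<⇒≤ (c i N N≤i ℕ.≤-refl))))
    where a = seq x N

  -- e / c, for c > 0
  quot : ∀ e c → 0ℚ ℚ.< e → 0ℚ ℚ.< c → ∃[ d ] (0ℚ ℚ.< d × c ℚ.* d ≡ e)
  quot e c 0<e 0<c = e ℚ.* ℚ.1/ c , 0<* 0<e 0<1/c ,
    trans (cong (c ℚ.*_) (ℚ.*-comm e (ℚ.1/ c)))
    (trans (sym (ℚ.*-assoc c (ℚ.1/ c) e))
    (trans (cong (ℚ._* e) (ℚ.*-inverseʳ c)) (ℚ.*-identityˡ e)))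
    where
    instance
      c-pos : ℚ.Positive c
      c-pos = ℚ.positive 0<c
      c≢0 : ℚ.NonZero c
      c≢0 = ℚ.pos⇒nonZero c
    0<1/c : 0ℚ ℚ.< ℚ.1/ c
    0<1/c = ℚ.positive⁻¹ (ℚ.1/ c) {{ℚ.1/pos⇒pos c}}

fromℕ : ℕ → ℝ
fromℕ n .seq _        = ℤ.+ n ℚ./ 1
fromℕ n .cauchy e 0<e = 0 , λ _ _ _ _ →
  subst (ℚ._< e) (sym (cong ℚ.∣_∣ (ℚ.+-inverseʳ (ℤ.+ n ℚ./ 1)))) 0<e

0ℝ 1ℝ : ℝ
0ℝ = fromℕ 0
1ℝ = fromℕ 1

infixl 6 _+_ _⊔_
infixl 7 _*_ _/_
infix 8 _⁻¹

_+_ : ℝ → ℝ → ℝ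
(x + y) .seq i = seq x i ℚ.+ seq y i
(x + y) .cauchy e 0<e
  with cauchy x (e ℚ.* ½) (0<* 0<e 0<½) | cauchy y (e ℚ.* ½) (0<* 0<e 0<½)
... | M , c | N , d = M ℕ.⊔ N , λ i j p q →
  ℚ.≤-<-trans
    (ℚ.≤-trans
      (ℚ.≤-reflexive (cong ℚ.∣_∣ (lemma (seq x i) (seq x j) (seq y i) (seq y j))))
      (ℚ.∣p+q∣≤∣p∣+∣q∣ (seq x i ℚ.- seq x j) (seq y i ℚ.- seq y j)))
    (subst (_ ℚ.<_) (halves e)
      (ℚ.+-mono-<
        (c i j (ℕ.m⊔n≤o⇒m≤o M N p) (ℕ.m⊔n≤o⇒m≤o M N q))
        (d i j (ℕ.m⊔n≤o⇒n≤o M N p) (ℕ.m⊔n≤o⇒n≤o M N q))))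
  where
  open +-*-Solver
  lemma : ∀ a a′ b b′ → (a ℚ.+ b) ℚ.- (a′ ℚ.+ b′) ≡ (a ℚ.- a′) ℚ.+ (b ℚ.- b′)
  lemma = solve 4 (λ a a′ b b′ → (a :+ b) :- (a′ :+ b′) := (a :- a′) :+ (b :- b′)) refl

private
  *-dist : ∀ u u′ v v′ a b δ → 0ℚ ℚ.< a → 0ℚ ℚ.< b →
           ℚ.∣ u ∣ ℚ.≤ a → ℚ.∣ v′ ∣ ℚ.≤ b →
           ℚ.∣ u ℚ.- u′ ∣ ℚ.< δ → ℚ.∣ v ℚ.- v′ ∣ ℚ.< δ →
           ℚ.∣ u ℚ.* v ℚ.- u′ ℚ.* v′ ∣ ℚ.< (a ℚ.+ b) ℚ.* δ
  *-dist u u′ v v′ a b δ 0<a 0<b u≤a v′≤b du dv = ℚ.≤-<-trans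
    (ℚ.≤-trans (ℚ.≤-reflexive (cong ℚ.∣_∣ (lemma u u′ v v′)))
               (ℚ.∣p+q∣≤∣p∣+∣q∣ (u ℚ.* (v ℚ.- v′)) (v′ ℚ.* (u ℚ.- u′))))
    (subst (_ ℚ.<_) (sym (ℚ.*-distribʳ-+ δ a b))
      (ℚ.+-mono-< (bound u (v ℚ.- v′) a 0<a u≤a dv)
                  (bound v′ (u ℚ.- u′) b 0<b v′≤b du)))
    where
    open +-*-Solver
    lemma : ∀ u u′ v v′ →
      u ℚ.* v ℚ.- u′ ℚ.* v′ ≡ u ℚ.* (v ℚ.- v′) ℚ.+ v′ ℚ.* (u ℚ.- u′)
    lemma = solve 4 (λ u u′ v v′ →
      u :* v :- u′ :* v′ := u :* (v :- v′) :+ v′ :* (u :- u′)) refl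
    bound : ∀ s t a → 0ℚ ℚ.< a → ℚ.∣ s ∣ ℚ.≤ a → ℚ.∣ t ∣ ℚ.< δ →
            ℚ.∣ s ℚ.* t ∣ ℚ.< a ℚ.* δ
    bound s t a 0<a s≤a t<δ = ℚ.≤-<-trans
      (ℚ.≤-trans (ℚ.≤-reflexive (ℚ.∣p*q∣≡∣p∣*∣q∣ s t))
                 (ℚ.*-monoʳ-≤-nonNeg ℚ.∣ t ∣ {{ℚ.∣-∣-nonNeg t}} s≤a))
      (ℚ.*-monoʳ-<-pos a {{ℚ.positive 0<a}} t<δ)

_*_ : ℝ → ℝ → ℝ
(x * y) .seq i = seq x i ℚ.* seq y i
(x * y) .cauchy e 0<e =
  let (a , 0<a , K , ba) = bounded x
      (b , 0<b , L , bb) = bounded y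
      (δ , 0<δ , [a+b]δ≡e) = quot e (a ℚ.+ b) 0<e (0<+ 0<a 0<b)
      (M , c) = cauchy x δ 0<δ
      (N , d) = cauchy y δ 0<δ
  in (K ℕ.⊔ L) ℕ.⊔ (M ℕ.⊔ N) , λ i j p q →
    let p₁ = ℕ.m⊔n≤o⇒m≤o (K ℕ.⊔ L) (M ℕ.⊔ N) p
        p₂ = ℕ.m⊔n≤o⇒n≤o (K ℕ.⊔ L) (M ℕ.⊔ N) p
        q₁ = ℕ.m⊔n≤o⇒m≤o (K ℕ.⊔ L) (M ℕ.⊔ N) q
        q₂ = ℕ.m⊔n≤o⇒n≤o (K ℕ.⊔ L) (M ℕ.⊔ N) q
    in subst (_ ℚ.<_) [a+b]δ≡e
      (*-dist (seq x i) (seq x j) (seq y i) (seq y j) a b δ 0<a 0<b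
        (ba i (ℕ.m⊔n≤o⇒m≤o K L p₁)) (bb j (ℕ.m⊔n≤o⇒n≤o K L q₁))
        (c i j (ℕ.m⊔n≤o⇒m≤o M N p₂) (ℕ.m⊔n≤o⇒m≤o M N q₂))
        (d i j (ℕ.m⊔n≤o⇒n≤o M N p₂) (ℕ.m⊔n≤o⇒n≤o M N q₂)))

_⊔_ : ℝ → ℝ → ℝ
(x ⊔ y) .seq i = seq x i ℚ.⊔ seq y i
(x ⊔ y) .cauchy e 0<e =
  let (M , c) = cauchy x e 0<e
      (N , d) = cauchy y e 0<e
  in M ℕ.⊔ N , λ i j p q →
    ⊔-dist (seq x i) (seq x j) (seq y i) (seq y j)
      (c i j (ℕ.m⊔n≤o⇒m≤o M N p) (ℕ.m⊔n≤o⇒m≤o M N q))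
      (d i j (ℕ.m⊔n≤o⇒n≤o M N p) (ℕ.m⊔n≤o⇒n≤o M N q))
  where
  ⊔-dist : ∀ u u′ v v′ → ℚ.∣ u ℚ.- u′ ∣ ℚ.< e → ℚ.∣ v ℚ.- v′ ∣ ℚ.< e →
           ℚ.∣ (u ℚ.⊔ v) ℚ.- (u′ ℚ.⊔ v′) ∣ ℚ.< e
  ⊔-dist u u′ v v′ f g = <⇒dist (u ℚ.⊔ v) (u′ ℚ.⊔ v′)
    (⊔-< u v u′ v′ (dist⇒< u u′ f) (dist⇒< v v′ g))
    (⊔-< u′ v′ u v (dist⇒<′ u u′ f) (dist⇒<′ v v′ g))

record Positive (x : ℝ) : Set where
  constructor positive
  field
    0<x : 0ℝ < x

inv : ℚ → ℚ
inv q with q ℚ.≟ 0ℚ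
... | yes _   = 0ℚ
... | no  q≢0 = (ℚ.1/ q) {{ℚ.≢-nonZero q≢0}}

inv-inverse : ∀ {q} → 0ℚ ℚ.< q → q ℚ.* inv q ≡ 1ℚ
inv-inverse {q} 0<q with q ℚ.≟ 0ℚ
... | yes q≡0 = contradiction (sym q≡0) (ℚ.<⇒≢ 0<q)
... | no  q≢0 = ℚ.*-inverseʳ q {{ℚ.≢-nonZero q≢0}}

0<inv : ∀ {q} → 0ℚ ℚ.< q → 0ℚ ℚ.< inv q
0<inv {q} 0<q with 0ℚ ℚ.<? inv q
... | yes h = h
... | no  h = contradiction (ℚ.<-≤-trans 0<1 1≤0) (ℚ.<-irrefl refl)
  where
  1≤0 : 1ℚ ℚ.≤ 0ℚ
  1≤0 = subst₂ ℚ._≤_ (inv-inverse 0<q) (ℚ.*-zeroʳ q)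
    (ℚ.*-monoˡ-≤-nonNeg q {{ℚ.nonNegative (ℚ.<⇒≤ 0<q)}} (ℚ.≮⇒≥ h))

inv-diff : ∀ {p q} → 0ℚ ℚ.< p → 0ℚ ℚ.< q →
           inv p ℚ.- inv q ≡ (inv p ℚ.* inv q) ℚ.* (q ℚ.- p)
inv-diff {p} {q} 0<p 0<q = trans
  (cong₂ (λ a b → inv p ℚ.* a ℚ.- inv q ℚ.* b)
         (sym (inv-inverse 0<q)) (sym (inv-inverse 0<p)) ∘′
   cong₂ ℚ._-_ (sym (ℚ.*-identityʳ (inv p))) (sym (ℚ.*-identityʳ (inv q))))
  (lemma p q (inv p) (inv q))
  where
  open +-*-Solver
  _∘′_ : ∀ {a b c : ℚ} → b ≡ c → a ≡ b → a ≡ c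
  f ∘′ g = trans g f
  lemma : ∀ p q p′ q′ →
    p′ ℚ.* (q ℚ.* q′) ℚ.- q′ ℚ.* (p ℚ.* p′) ≡ (p′ ℚ.* q′) ℚ.* (q ℚ.- p)
  lemma = solve 4 (λ p q p′ q′ →
    p′ :* (q :* q′) :- q′ :* (p :* p′) := (p′ :* q′) :* (q :- p)) refl

inv-anti : ∀ {p q} → 0ℚ ℚ.< p → p ℚ.≤ q → inv q ℚ.≤ inv p
inv-anti {p} {q} 0<p p≤q = subst₂ ℚ._≤_ eq₁ eq₂
  (ℚ.*-monoˡ-≤-nonNeg (inv p ℚ.* inv q)
    {{ℚ.nonNegative (ℚ.<⇒≤ (0<* (0<inv 0<p) (0<inv 0<q)))}} p≤q)
  where
  open +-*-Solver
  0<q : 0ℚ ℚ.< q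
  0<q = ℚ.<-≤-trans 0<p p≤q
  eq₁ : (inv p ℚ.* inv q) ℚ.* p ≡ inv q
  eq₁ = trans (solve 3 (λ p p′ q′ → (p′ :* q′) :* p := (p :* p′) :* q′) refl p (inv p) (inv q))
    (trans (cong (ℚ._* inv q) (inv-inverse 0<p)) (ℚ.*-identityˡ (inv q)))
  eq₂ : (inv p ℚ.* inv q) ℚ.* q ≡ inv p
  eq₂ = trans (solve 3 (λ q p′ q′ → (p′ :* q′) :* q := (q :* q′) :* p′) refl q (inv p) (inv q))
    (trans (cong (ℚ._* inv p) (inv-inverse 0<q)) (ℚ.*-identityˡ (inv p)))

inv-dist : ∀ b p q δ → 0ℚ ℚ.< b → b ℚ.≤ p → b ℚ.≤ q →
           ℚ.∣ q ℚ.- p ∣ ℚ.< δ →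
           ℚ.∣ inv p ℚ.- inv q ∣ ℚ.< (inv b ℚ.* inv b) ℚ.* δ
inv-dist b p q δ 0<b b≤p b≤q d = ℚ.≤-<-trans
  (ℚ.≤-trans (ℚ.≤-reflexive eq)
    (ℚ.*-monoʳ-≤-nonNeg ℚ.∣ z ∣ {{ℚ.∣-∣-nonNeg z}} st≤))
  (ℚ.*-monoʳ-<-pos (inv b ℚ.* inv b)
    {{ℚ.positive (0<* (0<inv 0<b) (0<inv 0<b))}} d)
  where
  s t z : ℚ
  s = inv p
  t = inv q
  z = q ℚ.- p
  0<p : 0ℚ ℚ.< p
  0<p = ℚ.<-≤-trans 0<b b≤p
  0<q : 0ℚ ℚ.< q
  0<q = ℚ.<-≤-trans 0<b b≤q
  st≤ : s ℚ.* t ℚ.≤ inv b ℚ.* inv b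
  st≤ = ℚ.≤-trans
    (ℚ.*-monoʳ-≤-nonNeg t {{ℚ.nonNegative (ℚ.<⇒≤ (0<inv 0<q))}} (inv-anti 0<b b≤p))
    (ℚ.*-monoˡ-≤-nonNeg (inv b) {{ℚ.nonNegative (ℚ.<⇒≤ (0<inv 0<b))}} (inv-anti 0<b b≤q))
  eq : ℚ.∣ s ℚ.- t ∣ ≡ (s ℚ.* t) ℚ.* ℚ.∣ z ∣
  eq = trans (cong ℚ.∣_∣ (inv-diff 0<p 0<q))
    (trans (ℚ.∣p*q∣≡∣p∣*∣q∣ (s ℚ.* t) z)
      (cong (ℚ._* ℚ.∣ z ∣) (ℚ.0≤p⇒∣p∣≡p (ℚ.<⇒≤ (0<* (0<inv 0<p) (0<inv 0<q))))))

-- The sequence is inverted termwise, with inv 0ℚ = 0ℚ.  The latter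
-- affects only finitely many terms, because x is positive.
_⁻¹ : (x : ℝ) {{_ : Positive x}} → ℝ
(x ⁻¹) .seq i = inv (seq x i)
(_⁻¹ x {{positive (b , 0<b , N , h)}}) .cauchy e 0<e =
  let (δ , 0<δ , b⁻²δ≡e) = quot e (inv b ℚ.* inv b) 0<e (0<* (0<inv 0<b) (0<inv 0<b))
      (M , c) = cauchy x δ 0<δ
  in N ℕ.⊔ M , λ i j p q → subst (_ ℚ.<_) b⁻²δ≡e
    (inv-dist b (seq x i) (seq x j) δ 0<b
      (b≤ i (ℕ.m⊔n≤o⇒m≤o N M p)) (b≤ j (ℕ.m⊔n≤o⇒m≤o N M q))
      (c j i (ℕ.m⊔n≤o⇒n≤o N M q) (ℕ.m⊔n≤o⇒n≤o N M p)))
  where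
  b≤ : ∀ i → N ℕ.≤ i → b ℚ.≤ seq x i
  b≤ i N≤i = subst (ℚ._≤ seq x i) (ℚ.+-identityˡ b) (h i N≤i)

_/_ : (x y : ℝ) {{_ : Positive y}} → ℝ
x / y = x * y ⁻¹

instance
  fromℕ-positive : ∀ {n} .{{_ : ℕ.NonZero n}} → Positive (fromℕ n)
  fromℕ-positive {suc n} = positive
    (q , 0<q , 0 , λ _ _ → ℚ.≤-reflexive (ℚ.+-identityˡ q))
    where
    q = ℤ.+ suc n ℚ./ 1
    0<q : 0ℚ ℚ.< q
    0<q = ℚ.positive⁻¹ q {{ℚ.normalize-pos (suc n) 1}}

  +-positive : ∀ {x y} {{_ : Positive x}} {{_ : Positive y}} → Positive (x + y)
  +-positive {x} {y} {{positive (a , 0<a , M , f)}} {{positive (b , 0<b , N , g)}} =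
    positive (a ℚ.+ b , 0<+ 0<a 0<b , M ℕ.⊔ N , λ i p →
      ℚ.≤-trans (ℚ.≤-reflexive (lemma a b))
        (ℚ.+-mono-≤ (f i (ℕ.m⊔n≤o⇒m≤o M N p)) (g i (ℕ.m⊔n≤o⇒n≤o M N p))))
    where
    open +-*-Solver
    lemma : ∀ a b → 0ℚ ℚ.+ (a ℚ.+ b) ≡ (0ℚ ℚ.+ a) ℚ.+ (0ℚ ℚ.+ b)
    lemma = solve 2 (λ a b →
      con 0ℚ :+ (a :+ b) := (con 0ℚ :+ a) :+ (con 0ℚ :+ b)) refl

  *-positive : ∀ {x y} {{_ : Positive x}} {{_ : Positive y}} → Positive (x * y)
  *-positive {x} {y} {{positive (a , 0<a , M , f)}} {{positive (b , 0<b , N , g)}} =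
    positive (a ℚ.* b , 0<* 0<a 0<b , M ℕ.⊔ N , λ i p →
      let a≤ = ≤′ {a} (f i (ℕ.m⊔n≤o⇒m≤o M N p))
          b≤ = ≤′ {b} (g i (ℕ.m⊔n≤o⇒n≤o M N p))
      in ℚ.≤-trans (ℚ.≤-reflexive (ℚ.+-identityˡ (a ℚ.* b)))
        (ℚ.≤-trans
          (ℚ.*-monoʳ-≤-nonNeg b {{ℚ.nonNegative (ℚ.<⇒≤ 0<b)}} a≤)
          (ℚ.*-monoˡ-≤-nonNeg (seq x i)
            {{ℚ.nonNegative (ℚ.<⇒≤ (ℚ.<-≤-trans 0<a a≤))}} b≤)))
    where
    ≤′ : ∀ {p q} → 0ℚ ℚ.+ p ℚ.≤ q → p ℚ.≤ q
    ≤′ {p} = subst (ℚ._≤ _) (ℚ.+-identityˡ p)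

  ⁻¹-positive : ∀ {x} {{_ : Positive x}} → Positive (x ⁻¹)
  ⁻¹-positive {x} {{positive (a , 0<a , M , f)}} =
    let (b , 0<b , N , g) = bounded x
    in positive (inv b , 0<inv 0<b , M ℕ.⊔ N , λ i p →
      ⁻¹-bound a b (seq x i) 0<a
        (f i (ℕ.m⊔n≤o⇒m≤o M N p)) (g i (ℕ.m⊔n≤o⇒n≤o M N p)))
    where
    ⁻¹-bound : ∀ a b q → 0ℚ ℚ.< a → 0ℚ ℚ.+ a ℚ.≤ q → ℚ.∣ q ∣ ℚ.≤ b →
               0ℚ ℚ.+ inv b ℚ.≤ inv q
    ⁻¹-bound a b q 0<a a≤q q≤b =
      ℚ.≤-trans (ℚ.≤-reflexive (ℚ.+-identityˡ (inv b)))
        (inv-anti (ℚ.<-≤-trans 0<a (subst (ℚ._≤ q) (ℚ.+-identityˡ a) a≤q))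
          (ℚ.≤-trans (p≤∣p∣ q) q≤b))

1≤⇒positive : ∀ {x} → 1ℝ ≤ x → Positive x
1≤⇒positive {x} 1≤x =
  let (N , c) = cauchy x ¼ 0<¼
  in cases N (λ i N≤i → c i N N≤i ℕ.≤-refl) (seq x N ℚ.≤? ½)
  where
  ¼ : ℚ
  ¼ = ½ ℚ.* ½
  0<¼ : 0ℚ ℚ.< ¼
  0<¼ = from-yes (0ℚ ℚ.<? ¼)
  small : ∀ p q → q ℚ.≤ ½ → ℚ.∣ p ℚ.- q ∣ ℚ.< ¼ → p ℚ.+ ¼ ℚ.≤ 1ℚ
  small p q q≤½ d = ℚ.+-monoˡ-≤ ¼ {p}
    (ℚ.≤-trans (ℚ.<⇒≤ (dist⇒< p q d)) (ℚ.+-monoˡ-≤ ¼ q≤½))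
  big : ∀ p q → ½ ℚ.< q → ℚ.∣ p ℚ.- q ∣ ℚ.< ¼ → 0ℚ ℚ.+ ¼ ℚ.≤ p
  big p q ½<q d = ℚ.≮⇒≥ λ p<¼ →
    ℚ.<-asym ½<q (ℚ.<-trans (dist⇒<′ p q d) (ℚ.+-monoˡ-< ¼ {p} {¼} p<¼))
  cases : ∀ N → (∀ i → N ℕ.≤ i → ℚ.∣ seq x i ℚ.- seq x N ∣ ℚ.< ¼) →
          Dec (seq x N ℚ.≤ ½) → Positive x
  cases N c (yes xN≤½) = contradiction
    (¼ , 0<¼ , N , λ i N≤i → small (seq x i) (seq x N) xN≤½ (c i N≤i)) 1≤x
  cases N c (no xN≰½) = positive
    (¼ , 0<¼ , N , λ i N≤i → big (seq x i) (seq x N) (ℚ.≰⇒> xN≰½) (c i N≤i))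

------------------------------------------------------------------------
-- Graphs

-- A finite loopless multigraph, given by the multiplicities of its
-- edges.  The vertex set is a subset of an ambient Fin N, so that
-- deleting vertices does not rename the remaining ones.
record Graph (N : ℕ) : Set where
  field
    V        : Subset N
    mult     : Fin N → Fin N → ℕ
    mult-sym : ∀ u v → mult u v ≡ mult v u
    loopless : ∀ v → mult v v ≡ 0
    incident : ∀ u v → 0 ℕ.< mult u v → u ∈ V

open Graph public

module _ {N : ℕ} where

  vertices : Graph N → List (Fin N)
  vertices G = filter (_∈? V G) (allFin N)

  degree : Graph N → Fin N → ℕ
  degree G v = sum (mult G v)

  Adjacent : Graph N → Fin N → Fin N → Set
  Adjacent G u v = 0 ℕ.< mult G u v

  Connected : Graph N → Fin N → Fin N → Set
  Connected G = Star (Adjacent G)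

  infixl 6 _∖_

  _∖_ : Graph N → Subset N → Graph N
  (G ∖ S) .V = V G ─ S
  (G ∖ S) .mult u v =
    if does (u ∈? S) ∨ does (v ∈? S) then 0 else mult G u v
  (G ∖ S) .mult-sym u v
    rewrite ∨-comm (does (u ∈? S)) (does (v ∈? S)) | mult-sym G u v = refl
  (G ∖ S) .loopless v with does (v ∈? S)
  ... | true  = refl
  ... | false = loopless G v
  (G ∖ S) .incident u v h with u ∈? S | v ∈? S
  ... | no u∉S | no _ = x∈p∧x∉q⇒x∈p─q (incident G u v h) u∉S

  iso : Graph N → ℕ
  iso G = length (filter (λ v → degree G v ℕ.≟ 0) (vertices G))

  private module Reachability (G : Graph N) where

    -- There is a walk from u to v whose inner vertices are all below k.
    Via : ℕ → Fin N → Fin N → Set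
    Via zero    u v = u ≡ v ⊎ Adjacent G u v
    Via (suc k) u v = Via k u v ⊎
      (Σ (Fin N) λ w → toℕ w ≡ k × Via k u w × Via k w v)

    via? : ∀ k u v → Dec (Via k u v)
    via? zero    u v = (u ≟ᶠ v) ⊎-dec (0 ℕ.<? mult G u v)
    via? (suc k) u v = via? k u v ⊎-dec
      any? (λ w → (toℕ w ℕ.≟ k) ×-dec (via? k u w ×-dec via? k w v))

    via-trans : ∀ k {u w v} → toℕ w ℕ.< k → Via k u w → Via k w v → Via k u v
    via-trans (suc k) {u} {w} {v} w<1+k p q with toℕ w ℕ.≟ k
    ... | yes w≡k = inj₂ (w , w≡k , fst p , snd q)
      where
      same : ∀ {x} → toℕ x ≡ k → x ≡ w
      same x≡k = toℕ-injective (trans x≡k (sym w≡k))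
      fst : ∀ {u} → Via (suc k) u w → Via k u w
      fst (inj₁ p) = p
      fst (inj₂ (x , x≡k , p , _)) = subst (Via k _) (same x≡k) p
      snd : ∀ {v} → Via (suc k) w v → Via k w v
      snd (inj₁ q) = q
      snd (inj₂ (x , x≡k , _ , q)) = subst (λ y → Via k y _) (same x≡k) q
    ... | no w≢k = go p q
      where
      w<k : toℕ w ℕ.< k
      w<k = ℕ.≤∧≢⇒< (ℕ.≤-pred w<1+k) w≢k
      go : Via (suc k) u w → Via (suc k) w v → Via (suc k) u v
      go (inj₁ p) (inj₁ q) = inj₁ (via-trans k w<k p q)
      go (inj₁ p) (inj₂ (x , e , q , r)) = inj₂ (x , e , via-trans k w<k p q , r)
      go (inj₂ (x , e , p , q)) (inj₁ r) = inj₂ (x , e , p , via-trans k w<k q r)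
      go (inj₂ (x , e , p , _)) (inj₂ (y , e′ , _ , r)) =
        inj₂ (x , e , p , subst (λ z → Via k z v) (toℕ-injective (trans e′ (sym e))) r)

    via-suc* : ∀ k {u v} → Via zero u v → Via k u v
    via-suc* zero    p = p
    via-suc* (suc k) p = inj₁ (via-suc* k p)

    sound : ∀ k {u v} → Via k u v → Connected G u v
    sound zero    (inj₁ refl) = ε
    sound zero    (inj₂ uv)   = uv ◅ ε
    sound (suc k) (inj₁ p)    = sound k p
    sound (suc k) (inj₂ (_ , _ , p , q)) = sound k p ◅◅ sound k q

    complete : ∀ {u v} → Connected G u v → Via N u v
    complete ε          = via-suc* N (inj₁ refl)
    complete (_◅_ {j = w} uw wv) =
      via-trans N (toℕ<n w) (via-suc* N (inj₂ uw)) (complete wv)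

  connected? : ∀ G u v → Dec (Connected G u v)
  connected? G u v = map′ (sound N) complete (via? N u v)
    where open Reachability G

  -- Connectivity is an equivalence relation on vertices; removing
  -- duplicates up to it leaves one vertex from every component.
  ω : Graph N → ℕ
  ω G = length (deduplicate (connected? G) (vertices G))

  Tough : (t : ℝ) {{_ : Positive t}} → Graph N → Set
  Tough t G = ∀ S → S ⊆ V G → fromℕ (ω (G ∖ S)) ≤ 1ℝ ⊔ fromℕ ∣ S ∣ / t

  record SpanningSubgraph (F G : Graph N) : Set where
    field
      same-vertices : V F ≡ V G
      mult-≤        : ∀ u v → mult F u v ℕ.≤ mult G u v

  record NearFactor (r : ℕ) (G : Graph N) : Set where
    field
      F                : Graph N
      spanning         : SpanningSubgraph F G
      degrees          : ∀ v → v ∈ V G → degree F v ≡ r ⊎ degree F v ≡ suc r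
      at-most-one-suc  : ∀ u v → u ∈ V G → v ∈ V G →
                         degree F u ≡ suc r → degree F v ≡ suc r → u ≡ v

-- Only the underlying simple graph matters.  Deviations of degree sequences of
-- subgraphs from a target f form a jump system, and for jump systems Gallai's
-- lemma holds: if every vertex is short in one optimal subgraph and exceeded in
-- another, then optimal subgraphs deviate at most once in each component.
-- Shifting f at the other vertices until they are saturated turns this into
-- Tutte's barrier: disjoint sets S and T with
-- D + f(S) + Σ_T deg_{G - S} ≤ (number of components of G - S - T) + f(T)
-- whenever every subgraph deviates from f by at least D.  If every subgraph
-- deviates from r by at least 2, take such a barrier for D = 2, choose greedily
-- an independent set I of vertices of T of smallest degree in G - S below r, and
-- then a maximal set J of further independent vertices of degree r.  Deleting S
-- and the neighbours of I and J isolates I and J; deleting S, T - I and the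
-- neighbours of I leaves many components; the two hypotheses then contradict
-- each other.  A subgraph of deviation 1 with a vertex of degree r - 1 is
-- repaired by adding an unused edge there.

module Submission where

-- By the handshake lemma all deviations have the parity of the sum of f, so a step from one degree
-- vector towards another is always completed by a second one. A first step that lowers an optimal
-- deviation forces the second to raise it; every exchange between optima rests on this. The same
-- parity makes a unit shift of f worth a whole unit of D. Vertices of T of degree exactly r in G -
-- S cancel out of the barrier inequality, so picking them must be paid for otherwise: those with at
-- most one neighbour in U are moved to U beforehand, and for the others two neighbours in U supply
-- the missing units. The real number n never meets the graph. The sets built from I and J are
-- estimated for every rational a in [0 , 1] in place of 1 / n, and a is chosen only once these sets
-- are known, to fit their sizes. Barriers are found only up to double negation. This suffices:
-- whether some subgraph deviates by at most 1 is decided by enumeration, and in the negative case a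
-- barrier only has to yield a contradiction.

-- Finite sums and counting.

module Sums where

  open import Data.Bool.Base using (Bool; if_then_else_)
  open import Data.Fin.Base using (Fin; zero; suc)
  open import Data.Fin.Properties using (_≟_; any?; suc-injective)
  open import Data.Nat.Base
  open import Data.Nat.Properties hiding (_≟_; suc-injective)
  open import Data.Product.Base using (∃-syntax; _,_)
  open import Function.Base using (_∘_)
  open import Relation.Binary.PropositionalEquality
  open import Relation.Nullary using (yes; no; contradiction)
  open import Algebra.Properties.CommutativeMonoid.Sum +-0-commutativeMonoid public
    using (sum; sum-cong-≗; ∑-distrib-+; ∑-comm)

  ∑-mono-≤ : ∀ {n} {f g : Fin n → ℕ} → (∀ i → f i ≤ g i) → sum f ≤ sum g
  ∑-mono-≤ {zero}  h = z≤n
  ∑-mono-≤ {suc n} h = +-mono-≤ (h zero) (∑-mono-≤ (h ∘ suc))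

  ∑-mono-< : ∀ {n} {f g : Fin n → ℕ} → (∀ i → f i ≤ g i) →
             ∀ j → f j < g j → sum f < sum g
  ∑-mono-< h zero    lt = +-mono-<-≤ lt (∑-mono-≤ (h ∘ suc))
  ∑-mono-< h (suc j) lt = +-mono-≤-< (h zero) (∑-mono-< (h ∘ suc) j lt)

  ∑-const : ∀ n c → sum {n} (λ _ → c) ≡ n * c
  ∑-const zero    c = refl
  ∑-const (suc n) c = cong (c +_) (∑-const n c)

  ∑-zero : ∀ n → sum {n} (λ _ → 0) ≡ 0
  ∑-zero n = trans (∑-const n 0) (*-zeroʳ n)

  ∑-*ˡ : ∀ {n} c (f : Fin n → ℕ) → sum (λ i → c * f i) ≡ c * sum f
  ∑-*ˡ {zero}  c f = sym (*-zeroʳ c)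
  ∑-*ˡ {suc n} c f = trans (cong (c * f zero +_) (∑-*ˡ c (f ∘ suc)))
                           (sym (*-distribˡ-+ c (f zero) _))

  -- Free of subtraction, so that a change at a single vertex can be tracked in `ℕ`; most later
  -- counts that single out one vertex go through it.
  ∑-agree : ∀ {n} {f g : Fin n → ℕ} p → (∀ s → s ≢ p → f s ≡ g s) →
            sum f + g p ≡ sum g + f p
  ∑-agree {f = f} {g} zero h
    rewrite sum-cong-≗ (λ s → h (suc s) λ ())
          | +-comm (f zero + sum (g ∘ suc)) (g zero)
          | +-comm (f zero) (sum (g ∘ suc))
          | +-assoc (g zero) (sum (g ∘ suc)) (f zero) = refl
  ∑-agree {f = f} {g} (suc p) h
    rewrite h zero (λ ())
          | +-assoc (g zero) (sum (f ∘ suc)) (g (suc p))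
          | +-assoc (g zero) (sum (g ∘ suc)) (f (suc p))
    = cong (g zero +_) (∑-agree p (λ s s≢p → h (suc s) (s≢p ∘ suc-injective)))

  ∑-<⇒∃< : ∀ {n} {f g : Fin n → ℕ} → sum f < sum g → ∃[ i ] f i < g i
  ∑-<⇒∃< {f = f} {g} lt with any? (λ i → f i <? g i)
  ... | yes p = p
  ... | no ¬p = contradiction (∑-mono-≤ (λ i → ≮⇒≥ (λ q → ¬p (i , q)))) (<⇒≱ lt)

  ⟦_⟧ : Bool → ℕ
  ⟦ b ⟧ = if b then 1 else 0

  count : ∀ {n} → (Fin n → Bool) → ℕ
  count P = sum (λ i → ⟦ P i ⟧)

  δ : ∀ {n} → Fin n → Fin n → ℕ
  δ i j with i ≟ j
  ... | yes _ = 1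
  ... | no  _ = 0

  δ-≡ : ∀ {n} (i : Fin n) → δ i i ≡ 1
  δ-≡ i with i ≟ i
  ... | yes _ = refl
  ... | no ¬p = contradiction refl ¬p

  δ-≢ : ∀ {n} {i j : Fin n} → i ≢ j → δ i j ≡ 0
  δ-≢ {i = i} {j} i≢j with i ≟ j
  ... | yes p = contradiction p i≢j
  ... | no _  = refl

  ∑-δ : ∀ {n} (i : Fin n) → sum (δ i) ≡ 1
  ∑-δ {n} i = begin
    sum (δ i)              ≡⟨ +-identityʳ _ ⟨
    sum (δ i) + 0          ≡⟨ ∑-agree i (λ s s≢i → δ-≢ (s≢i ∘ sym)) ⟩
    sum {n} (λ _ → 0) + δ i i ≡⟨ cong₂ _+_ (∑-zero n) (δ-≡ i) ⟩
    1                      ∎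
    where open ≡-Reasoning

  -- Otherwise the point masses at `u` and `v` would fit below `g` together and force its sum up to
  -- two.
  only-one : ∀ {N} (g : Fin N → ℕ) → sum g ≤ 1 → ∀ u v → 1 ≤ g u → 1 ≤ g v → u ≡ v
  only-one g le u v gu gv with u ≟ v
  ... | yes e = e
  ... | no u≢v = contradiction le (<⇒≱ (begin
      2                          ≡⟨ cong₂ _+_ (∑-δ u) (∑-δ v) ⟨
      sum (δ u) + sum (δ v)      ≡⟨ ∑-distrib-+ (δ u) (δ v) ⟨
      sum (λ s → δ u s + δ v s)  ≤⟨ ∑-mono-≤ entry ⟩
      sum g                      ∎))
    where
    open ≤-Reasoning
    entry : ∀ s → δ u s + δ v s ≤ g s
    entry s with u ≟ s | v ≟ s
    ... | yes refl | yes refl = contradiction refl u≢v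
    ... | yes refl | no _     = gu
    ... | no _     | yes refl = gv
    ... | no _     | no _     = z≤n

-- Unit moves on the integer line.

module Integers where

  open import Data.Fin.Base using (zero; suc)
  open import Data.Integer.Base as ℤ using (ℤ; +_; -[1+_]; ∣_∣; +<+; -<+)
  import Data.Integer.Properties as ℤ
  open import Data.Integer.Solver using (module +-*-Solver)
  open import Data.Nat.Base
  open import Data.Nat.Properties hiding (_≟_; suc-injective)
  open import Data.Product.Base using (∃-syntax; _×_; _,_; proj₁; proj₂)
  open import Data.Sum.Base using (_⊎_; inj₁; inj₂)
  open import Relation.Binary.PropositionalEquality
  open import Relation.Nullary using (contradiction)
  open Sums

  -- c is one unit closer to b than a is.
  data Toward (a b c : ℤ) : Set where
    up   : ∀ k → c ≡ a ℤ.+ + 1 → b ≡ c ℤ.+ + k → Toward a b c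
    down : ∀ k → a ≡ c ℤ.+ + 1 → c ≡ b ℤ.+ + k → Toward a b c

  toward-dist : ∀ {a b c} → Toward a b c → ∣ a ℤ.- b ∣ ≡ suc ∣ c ℤ.- b ∣
  toward-dist {a} {b} {c} (up k refl refl) = trans
    (cong ∣_∣ (solve 2 (λ a k → a :- ((a :+ con (+ 1)) :+ k) := :- (con (+ 1) :+ k)) refl a (+ k)))
    (trans (ℤ.∣-i∣≡∣i∣ (+ suc k)) (cong suc (sym (trans
      (cong ∣_∣ (solve 2 (λ c k → c :- (c :+ k) := :- k) refl (a ℤ.+ + 1) (+ k)))
      (ℤ.∣-i∣≡∣i∣ (+ k))))))
    where open +-*-Solver
  toward-dist {a} {b} {c} (down k refl refl) = trans
    (cong ∣_∣ (solve 2 (λ b k → ((b :+ k) :+ con (+ 1)) :- b := con (+ 1) :+ k) refl b (+ k)))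
    (cong suc (sym (cong ∣_∣ (solve 2 (λ b k → (b :+ k) :- b := k) refl b (+ k)))))
    where open +-*-Solver

  down-neg : ∀ {a b c} k → a ≡ c ℤ.+ + 1 → c ≡ b ℤ.+ + k →
             (ℤ.- c ≡ ℤ.- a ℤ.+ + 1) × (ℤ.- b ≡ ℤ.- c ℤ.+ + k)
  down-neg {b = b} k refl refl =
    solve 1 (λ c → :- c := :- (c :+ con (+ 1)) :+ con (+ 1)) refl (b ℤ.+ + k) ,
    solve 2 (λ b k → :- b := :- (b :+ k) :+ k) refl b (+ k)
    where open +-*-Solver

  toward-neg : ∀ {a b c} → Toward a b c → Toward (ℤ.- a) (ℤ.- b) (ℤ.- c)
  toward-neg {a} (up k refl refl) = down k
    (solve 1 (λ a → :- a := :- (a :+ con (+ 1)) :+ con (+ 1)) refl a)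
    (solve 2 (λ c k → :- c := :- (c :+ k) :+ k) refl (a ℤ.+ + 1) (+ k))
    where open +-*-Solver
  toward-neg (down k a≡ c≡) = let (c≡′ , b≡′) = down-neg k a≡ c≡ in up k c≡′ b≡′

  toward-shift : ∀ {a b c} f → Toward a b c → Toward (a ℤ.- f) (b ℤ.- f) (c ℤ.- f)
  toward-shift {a} f (up k refl refl) = up k
    (solve 2 (λ a f → (a :+ con (+ 1)) :- f := (a :- f) :+ con (+ 1)) refl a f)
    (solve 3 (λ c k f → (c :+ k) :- f := (c :- f) :+ k) refl (a ℤ.+ + 1) (+ k) f)
    where open +-*-Solver
  toward-shift {b = b} f (down k refl refl) = down k
    (solve 2 (λ a f → (a :+ con (+ 1)) :- f := (a :- f) :+ con (+ 1)) refl (b ℤ.+ + k) f)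
    (solve 3 (λ c k f → (c :+ k) :- f := (c :- f) :+ k) refl b (+ k) f)
    where open +-*-Solver

  succ-abs : ∀ a → ∣ a ℤ.+ + 1 ∣ ≡ suc ∣ a ∣ ⊎ ∣ a ∣ ≡ suc ∣ a ℤ.+ + 1 ∣
  succ-abs (+ n)          = inj₁ (+-comm n 1)
  succ-abs -[1+ zero ]    = inj₂ refl
  succ-abs -[1+ suc n ]   = inj₂ refl

  toward-abs : ∀ {a b c} → Toward a b c → ∣ c ∣ ≡ suc ∣ a ∣ ⊎ ∣ a ∣ ≡ suc ∣ c ∣
  toward-abs {a} (up k refl _) = succ-abs a
  toward-abs {c = c} (down k refl _) with succ-abs c
  ... | inj₁ e = inj₂ e
  ... | inj₂ e = inj₁ e

  Pos Neg : ℤ → Set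
  Pos a = + 0 ℤ.< a
  Neg a = a ℤ.< + 0

  neg-pos : ∀ {a} → Neg a → Pos (ℤ.- a)
  neg-pos -<+ = +<+ (s≤s z≤n)

  pos-neg : ∀ {a} → Pos a → Neg (ℤ.- a)
  pos-neg {+ suc n} _ = -<+
  pos-neg {+ zero} (+<+ ())

  neg-pos⁻ : ∀ {a} → Neg (ℤ.- a) → Pos a
  neg-pos⁻ {+ suc n} _ = +<+ (s≤s z≤n)
  neg-pos⁻ {+ zero} (+<+ ())
  neg-pos⁻ { -[1+ n ]} (+<+ ())

  pos-neg⁻ : ∀ {a} → Pos (ℤ.- a) → Neg a
  pos-neg⁻ { -[1+ n ]} _ = -<+
  pos-neg⁻ {+ zero} (+<+ ())
  pos-neg⁻ {+ suc n} ()

  sign : ∀ a → a ≡ + 0 ⊎ Pos a ⊎ Neg a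
  sign (+ zero)   = inj₁ refl
  sign (+ suc n)  = inj₂ (inj₁ (+<+ (s≤s z≤n)))
  sign -[1+ n ]   = inj₂ (inj₂ -<+)

  -- What a unit move from `a` towards `b` satisfies when it also leads away from zero: `c` then
  -- lies between zero and `b`, so it has the sign of `b`, and that of `a` unless `a` is zero.
  record Raised (a b c : ℤ) : Set where
    field
      bounded  : ∣ c ∣ ≤ ∣ b ∣
      c≢0      : c ≢ + 0
      keep-pos : Pos a → Pos c
      keep-neg : Neg a → Neg c
      goal-pos : Pos c → Pos b
      goal-neg : Neg c → Neg b

  raised-up : ∀ {a b c} k → c ≡ a ℤ.+ + 1 → b ≡ c ℤ.+ + k → ∣ c ∣ ≡ suc ∣ a ∣ → Raised a b c
  raised-up {+ n} k refl refl e = record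
    { bounded = m≤m+n (n + 1) k
    ; c≢0 = λ z → 1+n≢0 (trans (+-comm 1 n) (ℤ.+-injective z))
    ; keep-pos = λ _ → +<+ (m≤n+m 1 n)
    ; keep-neg = λ { (+<+ ()) }
    ; goal-pos = λ _ → +<+ (≤-trans (m≤n+m 1 n) (m≤m+n (n + 1) k))
    ; goal-neg = λ { (+<+ ()) } }
  raised-up { -[1+ zero ]}  k refl refl ()
  raised-up { -[1+ suc n ]} k refl refl e = contradiction e (<⇒≢ (n≤1+n (2 + n)))

  raised : ∀ {a b c} → Toward a b c → ∣ c ∣ ≡ suc ∣ a ∣ → Raised a b c
  raised (up k c≡ b≡) e = raised-up k c≡ b≡ e
  raised {a} {b} {c} (down k a≡ c≡) e = record
    { bounded  = subst₂ _≤_ (ℤ.∣-i∣≡∣i∣ c) (ℤ.∣-i∣≡∣i∣ b) bounded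
    ; c≢0      = λ { refl → c≢0 refl }
    ; keep-pos = λ p → neg-pos⁻ (keep-neg (pos-neg p))
    ; keep-neg = λ p → pos-neg⁻ (keep-pos (neg-pos p))
    ; goal-pos = λ p → neg-pos⁻ (goal-neg (pos-neg p))
    ; goal-neg = λ p → pos-neg⁻ (goal-pos (neg-pos p))
    }
    where
    neg = down-neg k a≡ c≡
    open Raised (raised-up {ℤ.- a} k (proj₁ neg) (proj₂ neg) (trans (ℤ.∣-i∣≡∣i∣ c) (trans e (cong suc (sym (ℤ.∣-i∣≡∣i∣ a))))))

  -- As `b` is nearer to zero than `a`, the move from `a` towards zero is also a move towards `b`.
  lower : ∀ {a} b → ∣ b ∣ < ∣ a ∣ → ∃[ c ] Toward a b c × ∣ a ∣ ≡ suc ∣ c ∣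
  lower {+ zero} b ()
  lower {+ suc n} b (s≤s lt) = + n , down _ (cong +_ (+-comm 1 n)) (eq b lt) , refl
    where
    gap : ℤ → ℕ
    gap (+ m)    = n ∸ m
    gap -[1+ m ] = n + suc m
    eq : ∀ b → ∣ b ∣ ≤ n → + n ≡ b ℤ.+ + gap b
    eq (+ m) le = cong +_ (sym (m+[n∸m]≡n le))
    eq -[1+ m ] le = sym (trans (ℤ.⊖-≥ (m≤n+m (suc m) n)) (cong +_ (m+n∸n≡m n (suc m))))
  lower { -[1+ n ]} b (s≤s lt) = c n , up (gap n b) refl (eq n b lt) , abs n
    where
    c : ℕ → ℤ
    c n = -[1+ n ] ℤ.+ + 1
    abs : ∀ n → suc n ≡ suc ∣ c n ∣
    abs zero = refl
    abs (suc n) = refl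
    gap : ℕ → ℤ → ℕ
    gap n (+ m)    = n + m
    gap n -[1+ m ] = n ∸ suc m
    c-neg : ∀ n → c n ≡ ℤ.- (+ n)
    c-neg zero    = refl
    c-neg (suc n) = refl
    eq : ∀ n b → ∣ b ∣ ≤ n → b ≡ c n ℤ.+ + gap n b
    eq n (+ m) le = sym (trans (cong₂ ℤ._+_ (c-neg n) (ℤ.pos-+ n m)) (
      solve 2 (λ n m → :- n :+ (n :+ m) := m) refl (+ n) (+ m)))
      where open +-*-Solver
    eq n -[1+ m ] le = sym (trans (cong (λ z → c n ℤ.+ z) (trans (sym (ℤ.⊖-≥ le)) (sym (ℤ.m-n≡m⊖n n (suc m)))))
      (trans (cong (ℤ._+ (+ n ℤ.- + suc m)) (c-neg n))
      (solve 2 (λ n m → :- n :+ (n :- m) := :- m) refl (+ n) (+ suc m))))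
      where open +-*-Solver

  -- The first move of an entry that has to cross zero; from size two on it stays negative.
  rise : ∀ {a b} → Neg a → Pos b →
         ∃[ c ] Toward a b c × ∣ a ∣ ≡ suc ∣ c ∣ × (2 ≤ ∣ a ∣ → Neg c)
  rise { -[1+ zero ]} {+ m} -<+ p = + 0 , up m refl refl , refl , λ { (s≤s ()) }
  rise { -[1+ suc n ]} {+ m} -<+ p =
    -[1+ n ] , up (suc n + m) refl
      (solve 2 (λ n m → m := :- n :+ (n :+ m)) refl (+ suc n) (+ m)) , refl , λ _ → -<+
    where open +-*-Solver

-- Jump systems and exchanges between optimal vectors.

module JumpSystems where

  open import Data.Empty using (⊥; ⊥-elim)
  open import Data.Fin.Base using (Fin; zero; suc)
  open import Data.Fin.Properties using (_≟_; any?)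
  open import Data.Integer.Base as ℤ using (ℤ; +_; -[1+_]; ∣_∣; +<+)
  import Data.Integer.Properties as ℤ
  open import Data.Nat.Base
  open import Data.Nat.Properties hiding (_≟_; suc-injective)
  open import Data.Product.Base using (∃-syntax; _×_; _,_; proj₁; proj₂)
  open import Data.Sum.Base using (_⊎_; inj₁; inj₂)
  open import Function.Base using (_∘_)
  open import Relation.Binary.Construct.Closure.ReflexiveTransitive using (Star; ε; _◅_)
  open import Relation.Binary.Definitions using (tri<; tri≈; tri>)
  open import Relation.Binary.PropositionalEquality
  open import Relation.Nullary using (¬_; yes; no; contradiction; Dec; ¬?)
  open import Relation.Nullary.Decidable using (_×-dec_)
  open Sums
  open Integers

  record Step {N} (x y z : Fin N → ℤ) : Set where
    constructor step
    field
      site   : Fin N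
      toward : Toward (x site) (y site) (z site)
      rest   : ∀ s → s ≢ site → z s ≡ x s

  open Step

  dev : ∀ {N} → (Fin N → ℤ) → ℕ
  dev x = sum (λ p → ∣ x p ∣)

  dist : ∀ {N} → (Fin N → ℤ) → (Fin N → ℤ) → ℕ
  dist x y = sum (λ p → ∣ x p ℤ.- y p ∣)

  dist-sym : ∀ {N} (x y : Fin N → ℤ) → dist x y ≡ dist y x
  dist-sym x y = sum-cong-≗ (λ p → ℤ.∣i-j∣≡∣j-i∣ (x p) (y p))

  ∑-drop : ∀ {N} {f g : Fin N → ℕ} p → (∀ s → s ≢ p → f s ≡ g s) →
           f p ≡ suc (g p) → sum f ≡ suc (sum g)
  ∑-drop {f = f} {g} p same fp = +-cancelʳ-≡ (g p) (sum f) (suc (sum g))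
    (trans (∑-agree p same) (trans (cong (λ m → sum g + m) fp) (+-suc (sum g) (g p))))

  step-dist : ∀ {N} {x y z : Fin N → ℤ} → Step x y z → dist x y ≡ suc (dist z y)
  step-dist {y = y} s = ∑-drop (site s)
    (λ t t≢ → cong (λ a → ∣ a ℤ.- y t ∣) (sym (rest s t t≢))) (toward-dist (toward s))

  -- The constant-parity form of the two-step axiom: a step towards a member is always completed by
  -- a second one. `flip` is the toggling of an edge, the only link between the vectors and
  -- adjacency.
  record JumpSystem {N : ℕ} (Adj : Fin N → Fin N → Set) (D : ℕ) : Set₁ where
    field
      I       : Set
      x       : I → Fin N → ℤ
      jump    : ∀ i j {a} → Step (x i) (x j) a → ∃[ k ] Step a (x j) (x k)
      flip    : ∀ i {u w} → Adj u w → ∃[ k ]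
                (∀ s → s ≢ u → s ≢ w → x k s ≡ x i s) ×
                ((x k u ≡ x i u ℤ.+ + 1 × x k w ≡ x i w ℤ.+ + 1) ⊎
                 (x i u ≡ x k u ℤ.+ + 1 × x i w ≡ x k w ℤ.+ + 1))
      bound   : ∀ i → D ≤ dev (x i)
      adj-sym : ∀ {u w} → Adj u w → Adj w u
      adj-irr : ∀ {u w} → Adj u w → u ≢ w

    Opt : I → Set
    Opt i = dev (x i) ≡ D

    Critical : Fin N → Set
    Critical u = (∃[ i ] Opt i × Pos (x i u)) × (∃[ i ] Opt i × Neg (x i u))

  neg-+1 : ∀ {a b} → a ≡ b ℤ.+ + 1 → ℤ.- b ≡ ℤ.- a ℤ.+ + 1
  neg-+1 {b = b} e = proj₁ (down-neg {b = b} 0 e (sym (ℤ.+-identityʳ b)))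

  dev-neg : ∀ {N} (x : Fin N → ℤ) → dev (λ s → ℤ.- x s) ≡ dev x
  dev-neg x = sum-cong-≗ (λ p → ℤ.∣-i∣≡∣i∣ (x p))

  -- Negation exchanges the two signs, so that only one of two mirror-image cases has to be argued.
  opposite : ∀ {N} {Adj : Fin N → Fin N → Set} {D} → JumpSystem Adj D → JumpSystem Adj D
  opposite J = record
    { I = I
    ; x = λ i s → ℤ.- x i s
    ; jump = jump′
    ; flip = flip′
    ; bound = λ i → subst (_ ≤_) (sym (dev-neg (x i))) (bound i)
    ; adj-sym = adj-sym
    ; adj-irr = adj-irr
    }
    where
    open JumpSystem J
    jump′ : ∀ i j {a} → Step (λ s → ℤ.- x i s) (λ s → ℤ.- x j s) a →
            ∃[ k ] Step a (λ s → ℤ.- x j s) (λ s → ℤ.- x k s)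
    jump′ i j {a} (step p t r) =
      let (k , step q t′ r′) = jump i j {λ s → ℤ.- a s} (step p
            (subst₂ (λ u v → Toward u v (ℤ.- a p)) (ℤ.neg-involutive _) (ℤ.neg-involutive _)
              (toward-neg t))
            (λ s s≢ → trans (cong ℤ.-_ (r s s≢)) (ℤ.neg-involutive _)))
      in k , step q
           (subst (λ u → Toward u (ℤ.- x j q) (ℤ.- x k q)) (ℤ.neg-involutive _) (toward-neg t′))
           (λ s s≢ → trans (cong ℤ.-_ (r′ s s≢)) (ℤ.neg-involutive _))
    flip′ : ∀ i {u w} → _ → ∃[ k ] _ × _
    flip′ i uw with flip i uw
    ... | k , same , inj₁ (p , q) = k , (λ s a b → cong ℤ.-_ (same s a b)) , inj₂ (neg-+1 p , neg-+1 q)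
    ... | k , same , inj₂ (p , q) = k , (λ s a b → cong ℤ.-_ (same s a b)) , inj₁ (neg-+1 p , neg-+1 q)

  ∑-≡⇒∃< : ∀ {N} {f g : Fin N → ℕ} → sum f ≡ sum g → ∀ u → g u < f u → ∃[ p ] f p < g p
  ∑-≡⇒∃< {f = f} {g} e u lt with any? (λ p → f p <? g p)
  ... | yes p = p
  ... | no ¬p = contradiction (sym e) (<⇒≢ (∑-mono-< (λ p → ≮⇒≥ (λ q → ¬p (p , q))) u lt))

  nonzero-sign : ∀ {a} → a ≢ + 0 → Pos a ⊎ Neg a
  nonzero-sign {a} a≢0 with sign a
  ... | inj₁ a≡0 = contradiction a≡0 a≢0
  ... | inj₂ s   = s

  pos≢0 : ∀ {a} → Pos a → a ≢ + 0
  pos≢0 (+<+ ()) refl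

  neg≢0 : ∀ {a} → Neg a → a ≢ + 0
  neg≢0 (+<+ ()) refl

  pos⇒¬neg : ∀ {a} → Pos a → ¬ Neg a
  pos⇒¬neg (+<+ _) (+<+ ())

  abs≥1 : ∀ {a} → a ≢ + 0 → 1 ≤ ∣ a ∣
  abs≥1 {+ zero}   h = contradiction refl h
  abs≥1 {+ suc n}  h = s≤s z≤n
  abs≥1 { -[1+ n ]} h = s≤s z≤n

  module Optimal {N : ℕ} {Adj : Fin N → Fin N → Set} {D : ℕ} (J : JumpSystem Adj D)
    (crit : ∀ u → (∀ i → JumpSystem.x J i u ≡ + 0) ⊎ JumpSystem.Critical J u) where

    open JumpSystem J

    -- Here `a` is an optimal `x i` after a step that lowers the deviation. The step back into the
    -- system only moves an entry of `a` away from zero, so no sign of `a` is lost.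
    record Progress (i j : I) (a : Fin N → ℤ) : Set where
      field
        k       : I
        optimal : Opt k
        closer  : dist (x k) (x j) < dist (x i) (x j)
        second  : Step a (x j) (x k)
        raises  : ∣ x k (site second) ∣ ≡ suc ∣ a (site second) ∣

      target-raised : Raised (a (site second)) (x j (site second)) (x k (site second))
      target-raised = raised (toward second) raises

      grown : ∀ s → x k s ≡ a s ⊎ (s ≡ site second × Raised (a s) (x j s) (x k s))
      grown s with s ≟ site second
      ... | yes refl = inj₂ (refl , target-raised)
      ... | no s≢    = inj₁ (rest second s s≢)

      grown-pos : ∀ s → Pos (a s) → Pos (x k s)
      grown-pos s p with grown s
      ... | inj₁ e       = subst Pos (sym e) p
      ... | inj₂ (_ , r) = Raised.keep-pos r p

      grown-neg : ∀ s → Neg (a s) → Neg (x k s)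
      grown-neg s p with grown s
      ... | inj₁ e       = subst Neg (sym e) p
      ... | inj₂ (_ , r) = Raised.keep-neg r p

      grown-abs : ∀ s → ∣ a s ∣ ≤ ∣ x k s ∣
      grown-abs s with s ≟ site second
      ... | yes refl = subst (_ ≤_) (sym raises) (n≤1+n _)
      ... | no s≢    = ≤-reflexive (cong ∣_∣ (sym (rest second s s≢)))

    -- A second step that lowered the deviation as well would reach a member two below the bound. So
    -- it raises, optimality returns, and both steps have shortened the distance to `x j`.
    progress : ∀ {i j a} → Opt i → (s : Step (x i) (x j) a) →
               ∣ x i (site s) ∣ ≡ suc ∣ a (site s) ∣ → Progress i j a
    progress {i} {j} {a} opt s drop with jump i j s
    ... | k , t with toward-abs (toward t)
    ... | inj₁ up-again = record
      { k = k ; optimal = trans dev-k (trans (sym dev-i) opt) ; closer = closer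
      ; second = t ; raises = up-again }
      where
      dev-i : dev (x i) ≡ suc (dev a)
      dev-i = ∑-drop (site s) (λ r r≢ → cong ∣_∣ (sym (rest s r r≢))) drop
      dev-k : dev (x k) ≡ suc (dev a)
      dev-k = ∑-drop (site t) (λ r r≢ → cong ∣_∣ (rest t r r≢)) up-again
      closer : dist (x k) (x j) < dist (x i) (x j)
      closer = subst (dist (x k) (x j) <_) (sym (trans (step-dist s) (cong suc (step-dist t))))
                 (s≤s (n≤1+n _))
    ... | inj₂ down-again = contradiction (bound k) (<⇒≱ (subst (dev (x k) <_) eq (s≤s (n≤1+n _))))
      where
      eq : suc (suc (dev (x k))) ≡ D
      eq = begin
        suc (suc (dev (x k))) ≡⟨ cong suc (∑-drop (site t) (λ r r≢ → cong ∣_∣ (sym (rest t r r≢))) down-again) ⟨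
        suc (dev a)           ≡⟨ ∑-drop (site s) (λ r r≢ → cong ∣_∣ (sym (rest s r r≢))) drop ⟨
        dev (x i)             ≡⟨ opt ⟩
        D                     ∎
        where open ≡-Reasoning

    record Advance (i j : I) (p : Fin N) : Set where
      field
        k        : I
        optimal  : Opt k
        closer   : dist (x k) (x j) < dist (x i) (x j)
        keep-pos : ∀ s → s ≢ p → Pos (x i s) → Pos (x k s)
        keep-neg : ∀ s → s ≢ p → Neg (x i s) → Neg (x k s)
        keep-abs : ∀ s → s ≢ p → ∣ x i s ∣ ≤ ∣ x k s ∣

    update : Fin N → ℤ → (Fin N → ℤ) → Fin N → ℤ
    update p c y s with s ≟ p
    ... | yes _ = c
    ... | no _  = y s

    update-≡ : ∀ p c y → update p c y p ≡ c
    update-≡ p c y with p ≟ p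
    ... | yes _ = refl
    ... | no p≢p = contradiction refl p≢p

    update-≢ : ∀ p c y {s} → s ≢ p → update p c y s ≡ y s
    update-≢ p c y {s} s≢p with s ≟ p
    ... | yes s≡p = contradiction s≡p s≢p
    ... | no _ = refl

    step-at : ∀ i j p {c} → Toward (x i p) (x j p) c → Step (x i) (x j) (update p c (x i))
    step-at i j p {c} t = step p (subst (Toward _ _) (sym (update-≡ p c (x i))) t)
      (λ s → update-≢ p c (x i))

    progress-at : ∀ i j p {c} → Opt i → Toward (x i p) (x j p) c → ∣ x i p ∣ ≡ suc ∣ c ∣ →
                  Progress i j (update p c (x i))
    progress-at i j p {c} opt t drop = progress opt (step-at i j p t)
      (trans drop (cong (suc ∘ ∣_∣) (sym (update-≡ p c (x i)))))

    advance : ∀ i j p → Opt i → ∣ x j p ∣ < ∣ x i p ∣ → Advance i j p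
    advance i j p opt lt with lower (x j p) lt
    ... | c , t , drop = record
      { k = k ; optimal = optimal ; closer = closer
      ; keep-pos = λ s s≢ h → grown-pos s (subst Pos (sym (update-≢ p c (x i) s≢)) h)
      ; keep-neg = λ s s≢ h → grown-neg s (subst Neg (sym (update-≢ p c (x i) s≢)) h)
      ; keep-abs = λ s s≢ → subst (λ b → ∣ b ∣ ≤ ∣ x k s ∣) (update-≢ p c (x i) s≢) (grown-abs s)
      }
      where open Progress (progress-at i j p opt t drop)

    -- The two optima can be brought closer without end. Equal deviations give a site `p` at which
    -- the vector smaller at `u` is the larger one; lowering it there does not shrink its entry at
    -- `u`. If the sizes at `u` agree, both are at least two, and one of them can be lowered without
    -- reaching zero: 1 + 2 still meets the bound.
    no-gap : ∀ n u i j → dist (x i) (x j) < n → Opt i → Opt j →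
             Neg (x i u) → Pos (x j u) → 3 ≤ ∣ x i u ∣ + ∣ x j u ∣ → ⊥
    no-gap (suc n) u i j (s≤s d) oi oj ni pj gap with <-cmp ∣ x i u ∣ ∣ x j u ∣
    ... | tri< lt _ _ = no-gap n u k j (≤-trans closer d) optimal oj (keep-neg u u≢p ni) pj
        (≤-trans gap (+-monoˡ-≤ _ (keep-abs u u≢p)))
      where
      p = proj₁ (∑-≡⇒∃< (trans oj (sym oi)) u lt)
      p< = proj₂ (∑-≡⇒∃< (trans oj (sym oi)) u lt)
      open Advance (advance i j p oi p<)
      u≢p : u ≢ p
      u≢p e = <-asym lt (subst (λ s → ∣ x j s ∣ < ∣ x i s ∣) (sym e) p<)
    ... | tri> _ _ lt = no-gap n u i k
        (≤-trans (subst₂ _<_ (dist-sym (x k) (x i)) (dist-sym (x j) (x i)) closer) d) oi optimal ni (keep-pos u u≢p pj)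
        (≤-trans gap (+-monoʳ-≤ ∣ x i u ∣ (keep-abs u u≢p)))
      where
      p = proj₁ (∑-≡⇒∃< (trans oi (sym oj)) u lt)
      p< = proj₂ (∑-≡⇒∃< (trans oi (sym oj)) u lt)
      open Advance (advance j i p oj p<)
      u≢p : u ≢ p
      u≢p e = <-asym lt (subst (λ s → ∣ x i s ∣ < ∣ x j s ∣) (sym e) p<)
    ... | tri≈ _ eq _ with rise ni pj
    ... | c , t , drop , neg-c = no-gap n u k j (≤-trans closer d) optimal oj
        (subst Neg (sym same) (neg-c big)) pj
        (subst (λ b → 3 ≤ ∣ b ∣ + ∣ x j u ∣) (sym same) gap′)
      where
      open Progress (progress-at i j u oi t drop)
      big : 2 ≤ ∣ x i u ∣
      big with 2 ≤? ∣ x i u ∣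
      ... | yes h = h
      ... | no h  = contradiction gap (<⇒≱ (s≤s (+-mono-≤ (≤-pred (≰⇒> h))
                      (subst (_≤ 1) eq (≤-pred (≰⇒> h))))))
      -- A second step at `u` would push a negative entry further down while heading for the
      -- positive `x j u`.
      same : x k u ≡ c
      same with grown u
      ... | inj₁ e = trans e (update-≡ u c (x i))
      ... | inj₂ (_ , r) = contradiction
              (Raised.goal-neg r (Raised.keep-neg r (subst Neg (sym (update-≡ u c (x i))) (neg-c big))))
              (pos⇒¬neg pj)
      gap′ : 3 ≤ ∣ c ∣ + ∣ x j u ∣
      gap′ = +-mono-≤ (≤-pred (subst (2 ≤_) drop big)) (subst (2 ≤_) eq big)

    -- At a critical site some optimum has the opposite sign and size at least one, so `no-gap`
    -- leaves room for size one only.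
    unit : ∀ i u → Opt i → ∣ x i u ∣ ≤ 1
    unit i u oi with crit u
    ... | inj₁ zeros = ≤-trans (≤-reflexive (cong ∣_∣ (zeros i))) z≤n
    ... | inj₂ ((j , oj , pj) , (l , ol , nl)) with ∣ x i u ∣ ≤? 1
    ... | yes h = h
    ... | no h with sign (x i u)
    ... | inj₁ e = contradiction (≤-trans (≤-reflexive (cong ∣_∣ e)) z≤n) h
    ... | inj₂ (inj₁ p) = ⊥-elim (no-gap _ u l i ≤-refl ol oi nl p
            (+-mono-≤ (abs≥1 (neg≢0 nl)) (≰⇒> h)))
    ... | inj₂ (inj₂ m) = ⊥-elim (no-gap _ u i j ≤-refl oi oj m pj
            (subst (3 ≤_) (+-comm ∣ x j u ∣ ∣ x i u ∣) (+-mono-≤ (abs≥1 (pos≢0 pj)) (≰⇒> h))))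

    -- The entries are 1 and -1, and a flip of the edge moves both in the same direction: one
    -- becomes 0, the other 2 or -2. The deviation is unchanged, against `unit`.
    mixed-signs : ∀ i {u w} → Adj u w → Opt i → Pos (x i u) → Neg (x i w) → ⊥
    mixed-signs i {u} {w} uw oi pu nw with flip i uw
    ... | k , same , moved = contradiction (both moved) λ { (s≤s ()) }
      where
      u≢w : u ≢ w
      u≢w = adj-irr uw
      one-pos : ∀ {a} → Pos a → ∣ a ∣ ≤ 1 → a ≡ + 1
      one-pos {+ suc zero} _ _ = refl
      one-pos {+ suc (suc n)} _ (s≤s ())
      one-pos {+ zero} (+<+ ())
      one-neg : ∀ {a} → Neg a → ∣ a ∣ ≤ 1 → a ≡ -[1+ 0 ]
      one-neg { -[1+ zero ]} _ _ = refl
      one-neg { -[1+ suc n ]} _ (s≤s ())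
      one-neg {+ n} (+<+ ())
      xu = one-pos pu (unit i u oi)
      xw = one-neg nw (unit i w oi)
      -1≡b+1 : ∀ {b} → -[1+ 0 ] ≡ b ℤ.+ + 1 → ∣ b ∣ ≡ 2
      -1≡b+1 {+ zero} ()
      -1≡b+1 {+ suc b} ()
      -1≡b+1 { -[1+ zero ]} ()
      -1≡b+1 { -[1+ suc zero ]} e = refl
      -1≡b+1 { -[1+ suc (suc b) ]} ()
      1≡b+1 : ∀ {b} → + 1 ≡ b ℤ.+ + 1 → ∣ b ∣ ≡ 0
      1≡b+1 {+ zero} _ = refl
      1≡b+1 {+ suc b} e = contradiction (ℤ.+-injective e) (<⇒≢ (subst (1 <_) (+-comm 1 (suc b)) (s≤s (s≤s z≤n))))
      1≡b+1 { -[1+ zero ]} ()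
      1≡b+1 { -[1+ suc b ]} ()
      dev-same : ∀ a b → (∀ s → s ≢ a → s ≢ b → x k s ≡ x i s) → a ≢ b →
                 ∣ x k a ∣ ≡ suc ∣ x i a ∣ → ∣ x i b ∣ ≡ suc ∣ x k b ∣ → Opt k
      dev-same a b same a≢b ea eb = trans (suc-cancel (begin
        suc (dev (x k))                            ≡⟨ +-comm 1 _ ⟩
        dev (x k) + 1                              ≡⟨ cong (λ m → dev (x k) + m) (∑-δ b) ⟨
        dev (x k) + sum (δ b)                      ≡⟨ ∑-distrib-+ _ (δ b) ⟨
        sum (λ s → ∣ x k s ∣ + δ b s)              ≡⟨ sum-cong-≗ pointwise ⟩
        sum (λ s → ∣ x i s ∣ + δ a s)              ≡⟨ ∑-distrib-+ _ (δ a) ⟩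
        dev (x i) + sum (δ a)                      ≡⟨ cong (λ m → dev (x i) + m) (∑-δ a) ⟩
        dev (x i) + 1                              ≡⟨ +-comm _ 1 ⟩
        suc (dev (x i))                            ∎)) oi
        where
        open ≡-Reasoning
        suc-cancel : ∀ {m n} → suc m ≡ suc n → m ≡ n
        suc-cancel refl = refl
        pointwise : ∀ s → ∣ x k s ∣ + δ b s ≡ ∣ x i s ∣ + δ a s
        pointwise s with b ≟ s | a ≟ s
        ... | yes refl | yes refl = contradiction refl a≢b
        ... | yes refl | no _     = trans (+-comm _ 1) (trans (sym eb) (sym (+-identityʳ _)))
        ... | no _     | yes refl = trans (+-identityʳ _) (trans ea (+-comm 1 _))
        ... | no b≢s   | no a≢s   = cong (λ z → ∣ z ∣ + 0) (same s (a≢s ∘ sym) (b≢s ∘ sym))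
      both : _ → 2 ≤ 1
      both (inj₁ (eu , ew)) = subst (_≤ 1) ku (unit k u (dev-same u w same u≢w
          (trans ku (cong (suc ∘ ∣_∣) (sym xu)))
          (trans (cong ∣_∣ xw) (cong suc (sym (cong ∣_∣ (trans ew (cong (ℤ._+ + 1) xw))))))))
        where
        ku : ∣ x k u ∣ ≡ 2
        ku = cong ∣_∣ (trans eu (cong (ℤ._+ + 1) xu))
      both (inj₂ (eu , ew)) = subst (_≤ 1) kw (unit k w (dev-same w u (λ s a b → same s b a) (u≢w ∘ sym)
          (trans kw (cong (suc ∘ ∣_∣) (sym xw)))
          (trans (cong ∣_∣ xu) (cong suc (sym (1≡b+1 {x k u} (trans (sym xu) eu)))))))
        where
        kw : ∣ x k w ∣ ≡ 2
        kw = -1≡b+1 {x k w} (trans (sym xw) ew)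

    -- Since `x i` is nowhere larger in size than `x j`, a raising step towards `x i` is possible
    -- only at `u`, where it ends negative. The entry at `w` stays positive, so the edge carries
    -- mixed signs.
    cross : ∀ i j {u w} → Adj u w → (∀ p → ∣ x i p ∣ ≤ ∣ x j p ∣) →
            Neg (x i u) → Pos (x j w) → ∀ {a} → Progress j i a →
            (∀ s → s ≢ u → a s ≡ x j s) → ⊥
    cross i j {u} {w} uw below nu pw {a} P a≡ = go (site second) refl (site second ≟ u)
      where
      open Progress P
      go : ∀ q → q ≡ site second → Dec (q ≡ u) → ⊥
      go q refl (no q≢u) = <⇒≱
        (≤-trans (≤-reflexive (trans (cong (suc ∘ ∣_∣) (sym (a≡ q q≢u))) (sym raises)))
                 (Raised.bounded target-raised))
        (below q)
      go q refl (yes refl) =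
        mixed-signs k (adj-sym uw) optimal
          (grown-pos w (subst Pos (sym (a≡ w (adj-irr uw ∘ sym))) pw)) nku
        where
        nku : Neg (x k u)
        nku with nonzero-sign (Raised.c≢0 target-raised)
        ... | inj₂ m = m
        ... | inj₁ p = contradiction nu (pos⇒¬neg (Raised.goal-pos target-raised p))

    -- Take an optimum positive at `u` and bring it as close to `x i` as lowering steps off `u`
    -- allow. Its sizes then agree with those of `x i` everywhere, so it is nonzero at `w` too: a
    -- negative entry there is refuted by `mixed-signs`, a positive one by `cross`.
    both-neg : ∀ i {u w} → Adj u w → Opt i → Neg (x i u) → Neg (x i w) → ⊥
    both-neg i {u} {w} uw oi nu nw with crit u
    ... | inj₁ zeros = neg≢0 nu (zeros i)
    ... | inj₂ ((j₀ , oj₀ , pj₀) , _) = descend _ j₀ ≤-refl oj₀ pj₀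
      where
      abs-one : ∀ k s → Opt k → x k s ≢ + 0 → ∣ x k s ∣ ≡ 1
      abs-one k s ok h = ≤-antisym (unit k s ok) (abs≥1 h)
      descend : ∀ n j → dist (x j) (x i) < n → Opt j → Pos (x j u) → ⊥
      descend (suc n) j (s≤s d) oj pj
        with any? (λ p → ¬? (p ≟ u) ×-dec (∣ x i p ∣ <? ∣ x j p ∣))
      ... | yes (p , p≢u , lt) = descend n k (≤-trans closer d) optimal (keep-pos u (p≢u ∘ sym) pj)
        where open Advance (advance j i p oj lt)
      ... | no none = by-sign (nonzero-sign xjw≢0)
        where
        below : ∀ p → ∣ x j p ∣ ≤ ∣ x i p ∣
        below p with p ≟ u
        ... | yes refl = ≤-reflexive (trans (abs-one j p oj (pos≢0 pj)) (sym (abs-one i p oi (neg≢0 nu))))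
        ... | no p≢u   = ≮⇒≥ (λ lt → none (p , p≢u , lt))
        -- Both deviations are `D`, so domination at every site is equality.
        above : ∀ p → ∣ x i p ∣ ≤ ∣ x j p ∣
        above p = ≮⇒≥ (λ lt → <⇒≢ (∑-mono-< below p lt) (trans oj (sym oi)))
        xjw≢0 : x j w ≢ + 0
        xjw≢0 e = contradiction (≤-trans (abs≥1 (neg≢0 nw)) (subst (λ z → ∣ x i w ∣ ≤ ∣ z ∣) e (above w))) λ ()
        by-sign : Pos (x j w) ⊎ Neg (x j w) → ⊥
        by-sign (inj₂ m) = mixed-signs j uw oj pj m
        by-sign (inj₁ p) with rise {ℤ.- x j u} {ℤ.- x i u} (pos-neg pj) (neg-pos nu)
        ... | c′ , t′ , drop′ , _ = cross i j uw above nu p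
          (progress-at j i u oj t drop) (λ s → update-≢ u c (x j))
          where
          c = ℤ.- c′
          t : Toward (x j u) (x i u) c
          t = subst₂ (λ a b → Toward a b c) (ℤ.neg-involutive _) (ℤ.neg-involutive _) (toward-neg t′)
          drop : ∣ x j u ∣ ≡ suc ∣ c ∣
          drop = trans (sym (ℤ.∣-i∣≡∣i∣ (x j u))) (trans drop′ (cong suc (sym (ℤ.∣-i∣≡∣i∣ c′))))

  -- Gallai's lemma: when every site is critical or constantly zero, an optimal
  -- vector has at most one nonzero entry in each component.
  module Gallai {N : ℕ} {Adj : Fin N → Fin N → Set} {D : ℕ} (J : JumpSystem Adj D)
    (crit : ∀ u → (∀ i → JumpSystem.x J i u ≡ + 0) ⊎ JumpSystem.Critical J u) where

    open JumpSystem J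
    open Optimal J crit public

    crit⁻ : ∀ u → (∀ i → ℤ.- x i u ≡ + 0) ⊎ JumpSystem.Critical (opposite J) u
    crit⁻ u with crit u
    ... | inj₁ zeros = inj₁ (λ i → cong ℤ.-_ (zeros i))
    ... | inj₂ ((i , oi , pi) , (j , oj , nj)) = inj₂
      ((j , trans (dev-neg (x j)) oj , neg-pos nj) , (i , trans (dev-neg (x i)) oi , pos-neg pi))

    Separated : Fin N → Fin N → Set
    Separated u w = u ≢ w → ∀ i → Opt i → x i u ≢ + 0 → x i w ≢ + 0 → ⊥

    adjacent-separated : ∀ {u w} → Adj u w → Separated u w
    adjacent-separated uw _ i oi u≢0 w≢0 with nonzero-sign u≢0 | nonzero-sign w≢0
    ... | inj₁ pu | inj₁ pw = Optimal.both-neg (opposite J) crit⁻ i uw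
                                (trans (dev-neg (x i)) oi) (pos-neg pu) (pos-neg pw)
    ... | inj₁ pu | inj₂ nw = mixed-signs i uw oi pu nw
    ... | inj₂ nu | inj₁ pw = mixed-signs i (adj-sym uw) oi pw nu
    ... | inj₂ nu | inj₂ nw = both-neg i uw oi nu nw

    -- A site with an edge is not constantly zero, because flipping the edge changes its entry;
    -- hence it is critical.
    adjacent⇒deviates : ∀ {u t} → Adj u t → I → ∃[ j ] Opt j × x j t ≢ + 0
    adjacent⇒deviates {u} {t} ut i with crit t
    ... | inj₂ ((j , oj , pj) , _) = j , oj , pos≢0 pj
    ... | inj₁ zeros with flip i ut
    ... | k , _ , inj₁ (_ , e) = contradiction (trans (sym (zeros k)) (trans e (cong (ℤ._+ + 1) (zeros i)))) λ ()
    ... | k , _ , inj₂ (_ , e) = contradiction (trans (sym (zeros i)) (trans e (cong (ℤ._+ + 1) (zeros k)))) λ ()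

    -- An optimum `j` nonzero at `t` vanishes at `u` and `w`. With one unit added to `i` at `t` and
    -- one to `j` at each of `u` and `w`, the totals are `D` + 1 and `D` + 2, so `j` is larger than
    -- `i` at some site, which cannot be `t`, `u` or `w`. Lowering `j` there keeps `t` nonzero and
    -- shortens the distance to `i`, without end.
    separated-trans : ∀ {u t w} → Adj u t → Separated t w → Separated u w
    separated-trans {u} {t} {w} ut tw u≢w i oi u≢0 w≢0 with t ≟ w
    ... | yes refl = adjacent-separated ut (adj-irr ut) i oi u≢0 w≢0
    ... | no t≢w =
      let (j , oj , j≢0) = adjacent⇒deviates ut i in descend _ j ≤-refl oj j≢0
      where
      is-zero : ∀ a → (a ≢ + 0 → ⊥) → a ≡ + 0
      is-zero a h with a ℤ.≟ + 0
      ... | yes e = e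
      ... | no ¬e = ⊥-elim (h ¬e)
      descend : ∀ n j → dist (x j) (x i) < n → Opt j → x j t ≢ + 0 → ⊥
      descend (suc n) j (s≤s d) oj t≢0 = found (∑-<⇒∃< sums)
        where
        x-u : x j u ≡ + 0
        x-u = is-zero _ (λ h → adjacent-separated ut (adj-irr ut) j oj h t≢0)
        x-w : x j w ≡ + 0
        x-w = is-zero _ (λ h → tw t≢w j oj t≢0 h)
        sums : sum (λ p → ∣ x i p ∣ + δ t p) < sum (λ p → ∣ x j p ∣ + (δ u p + δ w p))
        sums = subst₂ _<_
          (sym (trans (∑-distrib-+ _ (δ t)) (cong₂ _+_ oi (∑-δ t))))
          (sym (trans (∑-distrib-+ _ (λ p → δ u p + δ w p))
            (cong₂ _+_ oj (trans (∑-distrib-+ (δ u) (δ w)) (cong₂ _+_ (∑-δ u) (∑-δ w))))))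
          (+-monoʳ-< D (s≤s (s≤s z≤n)))
        found : ∃[ p ] ∣ x i p ∣ + δ t p < ∣ x j p ∣ + (δ u p + δ w p) → ⊥
        found (p , lt) with p ≟ t
        ... | yes refl = <⇒≱ lt (begin
              ∣ x j p ∣ + (δ u p + δ w p) ≡⟨ cong₂ (λ a b → ∣ x j p ∣ + (a + b)) (δ-≢ (adj-irr ut)) (δ-≢ (t≢w ∘ sym)) ⟩
              ∣ x j p ∣ + 0               ≡⟨ +-identityʳ _ ⟩
              ∣ x j p ∣                   ≤⟨ unit j p oj ⟩
              1                           ≡⟨ δ-≡ p ⟨
              δ p p                       ≤⟨ m≤n+m _ _ ⟩
              ∣ x i p ∣ + δ p p           ∎)
          where open ≤-Reasoning
        ... | no p≢t with p ≟ u | p ≟ w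
        ... | yes refl | _ = <⇒≱ lt (begin
              ∣ x j p ∣ + (δ p p + δ w p) ≡⟨ cong₂ (λ a b → ∣ a ∣ + (δ p p + b)) x-u (δ-≢ (u≢w ∘ sym)) ⟩
              δ p p + 0                   ≡⟨ trans (+-identityʳ _) (δ-≡ p) ⟩
              1                           ≤⟨ abs≥1 u≢0 ⟩
              ∣ x i p ∣                   ≤⟨ m≤m+n _ _ ⟩
              ∣ x i p ∣ + δ t p           ∎)
          where open ≤-Reasoning
        ... | no p≢u | yes refl = <⇒≱ lt (begin
              ∣ x j p ∣ + (δ u p + δ p p) ≡⟨ cong₂ (λ a b → ∣ a ∣ + (b + δ p p)) x-w (δ-≢ u≢w) ⟩
              δ p p                       ≡⟨ δ-≡ p ⟩
              1                           ≤⟨ abs≥1 w≢0 ⟩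
              ∣ x i p ∣                   ≤⟨ m≤m+n _ _ ⟩
              ∣ x i p ∣ + δ t p           ∎)
          where open ≤-Reasoning
        ... | no p≢u | no p≢w = descend n k (≤-trans closer d) optimal k≢0
          where
          lt′ : ∣ x i p ∣ < ∣ x j p ∣
          lt′ = subst₂ _<_ (trans (cong (λ m → ∣ x i p ∣ + m) (δ-≢ (p≢t ∘ sym))) (+-identityʳ _))
            (trans (cong₂ (λ a b → ∣ x j p ∣ + (a + b)) (δ-≢ (p≢u ∘ sym)) (δ-≢ (p≢w ∘ sym))) (+-identityʳ _)) lt
          open Advance (advance j i p oj lt′)
          k≢0 : x k t ≢ + 0
          k≢0 with nonzero-sign t≢0
          ... | inj₁ pt = pos≢0 (keep-pos t (p≢t ∘ sym) pt)
          ... | inj₂ nt = neg≢0 (keep-neg t (p≢t ∘ sym) nt)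

    connected-separated : ∀ {u w} → Star Adj u w → Separated u w
    connected-separated ε            u≢u = contradiction refl u≢u
    connected-separated (ut ◅ path)      = separated-trans ut (connected-separated path)

-- Degree vectors of subgraphs as a jump system.

module Barriers where

  open import Data.Bool.Base using (Bool; true; false; _∧_; _∨_; not; _xor_)
  import Data.Bool.Properties as Bool
  open import Data.Bool.Properties using (∨-comm; ∧-comm)
  open import Data.Empty using (⊥)
  open import Data.Fin.Base using (Fin; zero; suc)
  open import Data.Fin.Properties using (_≟_; any?)
  open import Data.Integer.Base as ℤ using (ℤ; +_; -[1+_]; ∣_∣; +<+; -<+)
  import Data.Integer.Properties as ℤ
  open import Data.Integer.Solver using (module +-*-Solver)
  open import Data.Integer.Solver using () renaming (module +-*-Solver to ℤ-Solver)
  open import Data.Nat.Base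
  import Data.Nat.Properties as ℕ
  open import Data.Nat.Properties hiding (_≟_; suc-injective)
  open import Data.Nat.Solver using () renaming (module +-*-Solver to ℕ-Solver)
  open import Data.Product.Base using (∃-syntax; _×_; _,_; proj₁; proj₂)
  open import Data.Sum.Base using (_⊎_; inj₁; inj₂)
  open import Function.Base using (_∘_)
  open import Relation.Binary.Construct.Closure.ReflexiveTransitive as Star using (Star)
  open import Relation.Binary.PropositionalEquality
  open import Relation.Nullary using (¬_; yes; no; contradiction; Dec; does)
  open import Relation.Nullary.Decidable using (dec-true; dec-false; _×-dec_)
  open import Algebra.Properties.AbelianGroup ℤ.+-0-abelianGroup using (∙-cancelʳ)
  open Sums
  open Integers
  open JumpSystems

  Rel : ℕ → Set
  Rel N = Fin N → Fin N → Bool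

  record IsGraph {N} (E : Rel N) : Set where
    field
      symm  : ∀ u v → E u v ≡ E v u
      irrfl : ∀ v → E v v ≡ false

  record Sub {N} (E : Rel N) : Set where
    field
      rel     : Rel N
      rel-sym : ∀ u v → rel u v ≡ rel v u
      rel-⊆   : ∀ u v → rel u v ≡ true → E u v ≡ true

  open Sub public

  deg : ∀ {N} → Rel N → Fin N → ℕ
  deg E v = count (E v)

  diff : ∀ {N} → Rel N → Rel N → ℕ
  diff F G = sum (λ u → sum (λ w → ⟦ F u w xor G u w ⟧))

  edge : ∀ {N} → Fin N → Fin N → Rel N
  edge u w p q = (does (p ≟ u) ∧ does (q ≟ w)) ∨ (does (p ≟ w) ∧ does (q ≟ u))

  edge-sym : ∀ {N} (u w p q : Fin N) → edge u w p q ≡ edge u w q p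
  edge-sym u w p q = trans (∨-comm (does (p ≟ u) ∧ does (q ≟ w)) _)
    (cong₂ _∨_ (∧-comm (does (p ≟ w)) _) (∧-comm (does (p ≟ u)) _))

  edge-hit : ∀ {N} (u w : Fin N) → edge u w u w ≡ true
  edge-hit u w rewrite dec-true (u ≟ u) refl | dec-true (w ≟ w) refl = refl

  edge-true : ∀ {N} (u w p q : Fin N) → edge u w p q ≡ true → (p ≡ u × q ≡ w) ⊎ (p ≡ w × q ≡ u)
  edge-true u w p q h with p ≟ u | q ≟ w | p ≟ w | q ≟ u
  ... | yes a | yes b | _     | _     = inj₁ (a , b)
  ... | yes a | no _  | yes c | yes d = inj₂ (c , d)
  ... | no _  | _     | yes c | yes d = inj₂ (c , d)

  edge-miss : ∀ {N} (u w p q : Fin N) → ¬ (p ≡ u × q ≡ w) → ¬ (p ≡ w × q ≡ u) → edge u w p q ≡ false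
  edge-miss u w p q h k with edge u w p q in e
  ... | false = refl
  ... | true with edge-true u w p q e
  ...   | inj₁ x = contradiction x h
  ...   | inj₂ x = contradiction x k

  xor-false : ∀ b → b xor false ≡ b
  xor-false true  = refl
  xor-false false = refl

  xor-true : ∀ b → b xor true ≡ not b
  xor-true true  = refl
  xor-true false = refl

  toggle : ∀ {N} → Fin N → Fin N → Rel N → Rel N
  toggle u w F p q = F p q xor edge u w p q

  module _ {N : ℕ} {E : Rel N} (G : IsGraph E) where
    open IsGraph G

    adjacent⇒≢ : ∀ {u w} → E u w ≡ true → u ≢ w
    adjacent⇒≢ {u} e refl = contradiction (trans (sym e) (irrfl u)) λ ()

    toggleSub : ∀ u w → E u w ≡ true → Sub E → Sub E
    toggleSub u w e F = record
      { rel     = toggle u w (rel F)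
      ; rel-sym = λ p q → cong₂ _xor_ (rel-sym F p q) (edge-sym u w p q)
      ; rel-⊆   = ⊆
      }
      where
      ⊆ : ∀ p q → toggle u w (rel F) p q ≡ true → E p q ≡ true
      ⊆ p q h with edge u w p q in eq
      ... | false = rel-⊆ F p q (trans (sym (xor-false (rel F p q))) h)
      ... | true with edge-true u w p q eq
      ...   | inj₁ (refl , refl) = e
      ...   | inj₂ (refl , refl) = trans (symm w u) e

    toggle-deg-other : ∀ u w (F : Rel N) s → s ≢ u → s ≢ w → deg (toggle u w F) s ≡ deg F s
    toggle-deg-other u w F s s≢u s≢w = sum-cong-≗ λ q → cong ⟦_⟧
      (trans (cong (F s q xor_) (edge-miss u w s q (s≢u ∘ proj₁) (s≢w ∘ proj₁))) (xor-false (F s q)))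

    toggle-deg₁ : ∀ u w (F : Rel N) → u ≢ w → ∀ b → F u w ≡ b →
                  deg F u + ⟦ not b ⟧ ≡ deg (toggle u w F) u + ⟦ b ⟧
    toggle-deg₁ u w F u≢w b e = trans (cong (λ c → deg F u + ⟦ c ⟧)
        (trans (sym (trans (cong (F u w xor_) (edge-hit u w)) (xor-true _)) ) refl ∘′ cong not (sym e)))
        (trans (∑-agree w (λ q q≢w → cong ⟦_⟧ (sym (trans
          (cong (F u q xor_) (edge-miss u w u q (q≢w ∘ proj₂) (u≢w ∘ proj₁))) (xor-false (F u q))))))
        (cong (λ c → deg (toggle u w F) u + ⟦ c ⟧) e))
      where
      _∘′_ : ∀ {a b c : Bool} → b ≡ c → a ≡ b → a ≡ c
      f ∘′ g = trans g f

    toggle-deg₂ : ∀ u w (F : Rel N) → u ≢ w → ∀ b → F w u ≡ b →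
                  deg F w + ⟦ not b ⟧ ≡ deg (toggle u w F) w + ⟦ b ⟧
    toggle-deg₂ u w F u≢w b e = trans (toggle-deg₁ w u F (u≢w ∘ sym) b e)
      (cong (_+ ⟦ b ⟧) (sum-cong-≗ λ q → cong (λ c → ⟦ F w q xor c ⟧)
        (∨-comm (does (w ≟ w) ∧ does (q ≟ u)) _)))

    -- The measure on which `sub-jump` recurses: the toggled edge is one on which the two subgraphs
    -- disagree.
    toggle-diff : ∀ u w (F H : Sub E) → rel F u w ≡ not (rel H u w) →
                  diff (toggle u w (rel F)) (rel H) < diff (rel F) (rel H)
    toggle-diff u w F H e = ∑-mono-< (λ p → ∑-mono-≤ (entry p)) u
        (∑-mono-< (entry u) w strict)
      where
      cancel : ∀ b c → b ≡ not c → ⟦ (b xor true) xor c ⟧ ≡ 0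
      cancel .(not true) true refl = refl
      cancel .(not false) false refl = refl
      differ : ∀ b c → b ≡ not c → ⟦ b xor c ⟧ ≡ 1
      differ .(not true) true refl = refl
      differ .(not false) false refl = refl
      entry : ∀ p q → ⟦ toggle u w (rel F) p q xor rel H p q ⟧ ≤ ⟦ rel F p q xor rel H p q ⟧
      entry p q with edge u w p q in eq
      ... | false = ≤-reflexive (cong (λ b → ⟦ b xor rel H p q ⟧) (xor-false (rel F p q)))
      ... | true  = ≤-trans (≤-reflexive (cancel _ _ e′)) z≤n
        where
        e′ : rel F p q ≡ not (rel H p q)
        e′ with edge-true u w p q eq
        ... | inj₁ (refl , refl) = e
        ... | inj₂ (refl , refl) = trans (rel-sym F w u) (trans e (cong not (rel-sym H u w)))
      strict : ⟦ toggle u w (rel F) u w xor rel H u w ⟧ < ⟦ rel F u w xor rel H u w ⟧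
      strict = subst₂ _<_ (sym (trans (cong (λ b → ⟦ (rel F u w xor b) xor rel H u w ⟧) (edge-hit u w)) (cancel _ _ e)))
                 (sym (differ _ _ e)) (s≤s z≤n)

    degℤ : Sub E → Fin N → ℤ
    degℤ F v = + deg (rel F) v

    missing : ∀ (F H : Rel N) v → deg F v < deg H v → ∃[ w ] F v w ≡ false × H v w ≡ true
    missing F H v lt with ∑-<⇒∃< lt
    ... | w , l = w , cases (F v w) (H v w) l
      where
      cases : ∀ b c → ⟦ b ⟧ < ⟦ c ⟧ → b ≡ false × c ≡ true
      cases false true  _ = refl , refl
      cases false false ()
      cases true  true  (s≤s ())
      cases true  false ()

    private
      up-gap : ∀ {d e} {a : ℤ} k → a ≡ + d ℤ.+ + 1 → + e ≡ a ℤ.+ + k → d < e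
      up-gap {d} k refl eq = subst (d <_) (sym (ℤ.+-injective eq))
        (≤-trans (≤-reflexive (+-comm 1 d)) (m≤m+n (d + 1) k))

      down-gap : ∀ {d e} {a : ℤ} k → + d ≡ a ℤ.+ + 1 → a ≡ + e ℤ.+ + k → e < d
      down-gap {d} {e} k eq refl = subst (e <_) (sym (ℤ.+-injective eq))
        (≤-trans (≤-reflexive (+-comm 1 e)) (+-monoˡ-≤ 1 (m≤m+n e k)))

    toggle-add : ∀ {v w} (e : E v w ≡ true) (F : Sub E) → rel F v w ≡ false →
                 degℤ (toggleSub v w e F) v ≡ degℤ F v ℤ.+ + 1 ×
                 degℤ (toggleSub v w e F) w ≡ degℤ F w ℤ.+ + 1
    toggle-add {v} {w} e F Fvw =
      cong +_ (sym (trans (toggle-deg₁ v w (rel F) (adjacent⇒≢ e) false Fvw) (+-identityʳ _))) ,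
      cong +_ (sym (trans (toggle-deg₂ v w (rel F) (adjacent⇒≢ e) false (trans (rel-sym F w v) Fvw)) (+-identityʳ _)))

    toggle-remove : ∀ {v w} (e : E v w ≡ true) (F : Sub E) → rel F v w ≡ true →
                    degℤ F v ≡ degℤ (toggleSub v w e F) v ℤ.+ + 1 ×
                    degℤ F w ≡ degℤ (toggleSub v w e F) w ℤ.+ + 1
    toggle-remove {v} {w} e F Fvw =
      cong +_ (trans (sym (+-identityʳ _)) (toggle-deg₁ v w (rel F) (adjacent⇒≢ e) true Fvw)) ,
      cong +_ (trans (sym (+-identityʳ _)) (toggle-deg₂ v w (rel F) (adjacent⇒≢ e) true (trans (rel-sym F w v) Fvw)))

    toggle-rest : ∀ {v w} (e : E v w ≡ true) (F : Sub E) {a : Fin N → ℤ} →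
                  degℤ (toggleSub v w e F) v ≡ a v → (∀ s → s ≢ v → a s ≡ degℤ F s) →
                  ∀ s → s ≢ w → degℤ (toggleSub v w e F) s ≡ a s
    toggle-rest {v} {w} e F {a} eq rest s s≢w = cases (s ≟ v)
      where
      cases : Dec (s ≡ v) → degℤ (toggleSub v w e F) s ≡ a s
      cases (yes s≡v) = subst (λ s → degℤ (toggleSub v w e F) s ≡ a s) (sym s≡v) eq
      cases (no s≢v)  = trans (cong +_ (toggle-deg-other v w (rel F) s s≢v s≢w)) (sym (rest s s≢v))

    -- Toggling an edge at the site of the step overshoots at its other end w by
    -- one unit: either that is a step towards H, or undoing it is the next step.
    sub-jump : ∀ n (F H : Sub E) {a} → diff (rel F) (rel H) < n →
               Step (degℤ F) (degℤ H) a → ∃[ K ] Step a (degℤ H) (degℤ K)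
    sub-jump (suc n) F H {a} (s≤s d) (step v (up k a≡ h≡) rest) =
        go (missing (rel F) (rel H) v (up-gap k a≡ h≡))
      where
      go : ∃[ w ] rel F v w ≡ false × rel H v w ≡ true → ∃[ K ] Step a (degℤ H) (degℤ K)
      go (w , Fvw , Hvw) = cases (deg (rel F) w <? deg (rel H) w)
        where
        e = rel-⊆ H v w Hvw
        F₁ = toggleSub v w e F
        aw : a w ≡ degℤ F w
        aw = rest w (adjacent⇒≢ e ∘ sym)
        F₁w : degℤ F₁ w ≡ a w ℤ.+ + 1
        F₁w = trans (proj₂ (toggle-add e F Fvw)) (cong (ℤ._+ + 1) (sym aw))
        same : ∀ s → s ≢ w → degℤ F₁ s ≡ a s
        same = toggle-rest e F (trans (proj₁ (toggle-add e F Fvw)) (sym a≡)) rest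
        cases : Dec (deg (rel F) w < deg (rel H) w) → ∃[ K ] Step a (degℤ H) (degℤ K)
        cases (yes lt) = F₁ , step w (up _ F₁w
          (trans (cong +_ (sym (m+[n∸m]≡n lt))) (cong (λ z → z ℤ.+ + (deg (rel H) w ∸ suc (deg (rel F) w))) (trans (cong +_ (+-comm 1 _))
            (sym (trans F₁w (cong (ℤ._+ + 1) aw))))))) same
        cases (no ge) = sub-jump n F₁ H
          (≤-trans (toggle-diff v w F H (trans Fvw (cong not (sym Hvw)))) d)
          (step w (down _ F₁w (trans aw (cong +_ (sym (m+[n∸m]≡n (≮⇒≥ ge))))))
            (λ s s≢w → sym (same s s≢w)))
    sub-jump (suc n) F H {a} (s≤s d) (step v (down k a≡ h≡) rest) =
        go (missing (rel H) (rel F) v (down-gap k a≡ h≡))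
      where
      go : ∃[ w ] rel H v w ≡ false × rel F v w ≡ true → ∃[ K ] Step a (degℤ H) (degℤ K)
      go (w , Hvw , Fvw) = cases (deg (rel H) w <? deg (rel F) w)
        where
        e = rel-⊆ F v w Fvw
        F₁ = toggleSub v w e F
        aw : a w ≡ degℤ F w
        aw = rest w (adjacent⇒≢ e ∘ sym)
        F₁w : a w ≡ degℤ F₁ w ℤ.+ + 1
        F₁w = trans aw (proj₂ (toggle-remove e F Fvw))
        F₁w′ : deg (rel F) w ≡ suc (deg (rel F₁) w)
        F₁w′ = trans (ℤ.+-injective (proj₂ (toggle-remove e F Fvw))) (+-comm _ 1)
        same : ∀ s → s ≢ w → degℤ F₁ s ≡ a s
        same = toggle-rest e F
          (∙-cancelʳ (+ 1) _ _ (trans (sym (proj₁ (toggle-remove e F Fvw))) a≡)) rest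
        cases : Dec (deg (rel H) w < deg (rel F) w) → ∃[ K ] Step a (degℤ H) (degℤ K)
        cases (yes lt) = F₁ , step w (down _ F₁w
          (cong +_ (sym (m+[n∸m]≡n (≤-pred (≤-trans lt (≤-reflexive F₁w′))))))) same
        cases (no ge) = sub-jump n F₁ H
          (≤-trans (toggle-diff v w F H (trans Fvw (cong not (sym Hvw)))) d)
          (step w (up _ F₁w (trans (cong +_ (sym (m+[n∸m]≡n (≮⇒≥ ge)))) (cong (λ z → z ℤ.+ + (deg (rel H) w ∸ deg (rel F) w)) (sym aw))))
            (λ s s≢w → sym (same s s≢w)))

    excess : (Fin N → ℕ) → Sub E → Fin N → ℤ
    excess f F v = degℤ F v ℤ.- + f v

    private
      shift-step : ∀ f (F H : Sub E) {a} → Step (excess f F) (excess f H) a →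
                   Step (degℤ F) (degℤ H) (λ v → a v ℤ.- ℤ.- + f v)
      shift-step f F H {a} (step v t r) = step v
        (subst₂ (λ x y → Toward x y (a v ℤ.- ℤ.- + f v)) (undo v F) (undo v H) (toward-shift (ℤ.- + f v) t))
        (λ s s≢ → trans (cong (ℤ._- ℤ.- + f s) (r s s≢)) (undo s F))
        where
        open +-*-Solver
        undo : ∀ v K → excess f K v ℤ.- ℤ.- + f v ≡ degℤ K v
        undo v K = solve 2 (λ d f → (d :- f) :- (:- f) := d) refl (degℤ K v) (+ f v)

      unshift-step : ∀ f (H K : Sub E) {a} → Step (λ v → a v ℤ.- ℤ.- + f v) (degℤ H) (degℤ K) →
                     Step a (excess f H) (excess f K)
      unshift-step f H K {a} (step v t r) = step v
        (subst (λ x → Toward x (excess f H v) (excess f K v)) (undo v) (toward-shift (+ f v) t))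
        (λ s s≢ → trans (cong (ℤ._- + f s) (r s s≢)) (undo s))
        where
        open +-*-Solver
        undo : ∀ v → (a v ℤ.- ℤ.- + f v) ℤ.- + f v ≡ a v
        undo v = solve 2 (λ a f → (a :- (:- f)) :- f := a) refl (a v) (+ f v)

      succ-shift : ∀ {a} b f → a ≡ b ℤ.+ + 1 → a ℤ.- f ≡ (b ℤ.- f) ℤ.+ + 1
      succ-shift b f refl = solve 2 (λ b f → (b :+ con (+ 1)) :- f := (b :- f) :+ con (+ 1)) refl b f
        where open +-*-Solver

    Adj : Fin N → Fin N → Set
    Adj u w = E u w ≡ true

    jumpSystem : ∀ f D → (∀ F → D ≤ dev (excess f F)) → JumpSystem Adj D
    jumpSystem f D bound = record
      { I       = Sub E
      ; x       = excess f
      ; jump    = λ F H s → let (K , t) = sub-jump _ F H ≤-refl (shift-step f F H s)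
                            in K , unshift-step f H K t
      ; flip    = λ F uw → toggleSub _ _ uw F , flip-rest F uw , flip F uw
      ; bound   = bound
      ; adj-sym = λ {u} {w} uw → trans (symm w u) uw
      ; adj-irr = adjacent⇒≢
      }
      where
      flip-rest : ∀ F {u w} (uw : Adj u w) s → s ≢ u → s ≢ w →
                  excess f (toggleSub u w uw F) s ≡ excess f F s
      flip-rest F {u} {w} uw s s≢u s≢w =
        cong (λ d → + d ℤ.- + f s) (toggle-deg-other u w (rel F) s s≢u s≢w)
      flip : ∀ F {u w} (uw : Adj u w) →
        (excess f (toggleSub u w uw F) u ≡ excess f F u ℤ.+ + 1 ×
         excess f (toggleSub u w uw F) w ≡ excess f F w ℤ.+ + 1) ⊎
        (excess f F u ≡ excess f (toggleSub u w uw F) u ℤ.+ + 1 ×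
         excess f F w ≡ excess f (toggleSub u w uw F) w ℤ.+ + 1)
      flip F {u} {w} uw with rel F u w in eq
      ... | false = let (p , q) = toggle-add uw F eq in
        inj₁ (succ-shift (degℤ F u) (+ f u) p , succ-shift (degℤ F w) (+ f w) q)
      ... | true  = let (p , q) = toggle-remove uw F eq in
        inj₂ (succ-shift (degℤ (toggleSub u w uw F) u) (+ f u) p , succ-shift (degℤ (toggleSub u w uw F) w) (+ f w) q)

  -- Tutte barriers and their extension by one vertex.

  data Part : Set where
    S T U O : Part

  isS : Part → Bool
  isS S = true
  isS _ = false

  -- The share of one vertex in f(S) plus the degrees of T off S; `gain` is its share in f(T).
  cost : Part → ℕ → ℕ → ℕ
  cost S f d = f
  cost T f d = d
  cost _ f d = 0

  gain : Part → ℕ → ℕ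
  gain T f = f
  gain _ f = 0

  degOff : ∀ {N} → Rel N → (Fin N → Part) → Fin N → ℕ
  degOff E part v = count (λ u → E v u ∧ not (isS (part u)))

  Linked : ∀ {N} → Rel N → (Fin N → Part) → Fin N → Fin N → Set
  Linked E part u w = E u w ≡ true × part u ≡ U × part w ≡ U

  -- S and T are the two sides of Tutte's barrier, U is the rest of the graph,
  -- O consists of the points that are not vertices; reps picks vertices from
  -- distinct components of the subgraph induced on U.
  record Barrier {N} (E : Rel N) (A : Fin N → Bool) (f : Fin N → ℕ) (D : ℕ) : Set where
    field
      part      : Fin N → Part
      outside   : ∀ v → A v ≡ false → part v ≡ O
      inside    : ∀ v → A v ≡ true → part v ≢ O
      reps      : Fin N → Bool
      reps-U    : ∀ v → reps v ≡ true → part v ≡ U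
      separated : ∀ u w → reps u ≡ true → reps w ≡ true → u ≢ w → ¬ Star (Linked E part) u w
      value     : D + sum (λ v → cost (part v) (f v) (degOff E part v))
                  ≤ count reps + sum (λ v → gain (part v) (f v))

  -- Optimal subgraphs short at a vertex, or exceeding there, are obtained by refuting their
  -- absence; this collects the resulting double negations over all vertices.
  ¬¬-∀ : ∀ {n} {P : Fin n → Set} → (∀ i → ¬ ¬ P i) → ¬ ¬ (∀ i → P i)
  ¬¬-∀ {zero}  h k = k λ ()
  ¬¬-∀ {suc n} h k = h zero λ p → ¬¬-∀ (h ∘ suc) λ ps → k λ { zero → p ; (suc i) → ps i }

  true≢false : ∀ {b} → b ≡ true → b ≢ false
  true≢false refl ()

  ∧-true : ∀ {a b} → a ∧ b ≡ true → a ≡ true × b ≡ true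
  ∧-true {true} {true} _ = refl , refl

  set : ∀ {N} {A : Set} → Fin N → A → (Fin N → A) → Fin N → A
  set v a g p with p ≟ v
  ... | yes _ = a
  ... | no _  = g p

  set-≡ : ∀ {N} {A : Set} (v : Fin N) (a : A) g → set v a g v ≡ a
  set-≡ v a g with v ≟ v
  ... | yes _ = refl
  ... | no h  = contradiction refl h

  set-≢ : ∀ {N} {A : Set} {v : Fin N} {a : A} {g} {p} → p ≢ v → set v a g p ≡ g p
  set-≢ {v = v} {p = p} p≢v with p ≟ v
  ... | yes h = contradiction h p≢v
  ... | no _  = refl

  delete : ∀ {N} → Fin N → (Fin N → Bool) → Fin N → Bool
  delete v = set v false

  remove : ∀ {N} → Fin N → Rel N → Rel N
  remove v E p q = E p q ∧ (not (does (p ≟ v)) ∧ not (does (q ≟ v)))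

  module _ {N} (v : Fin N) where

    delete-count : ∀ A → A v ≡ true → count A ≡ suc (count (delete v A))
    delete-count A e = ∑-drop v (λ s s≢v → cong ⟦_⟧ (sym (set-≢ s≢v)))
      (trans (cong ⟦_⟧ e) (cong (suc ∘ ⟦_⟧) (sym (set-≡ v false A))))

    remove-true : ∀ E {p q} → remove v E p q ≡ true → E p q ≡ true × p ≢ v × q ≢ v
    remove-true E {p} {q} h with E p q | p ≟ v | q ≟ v
    ... | true | no a | no b = refl , a , b

    remove-≢ : ∀ E {p q} → p ≢ v → q ≢ v → remove v E p q ≡ E p q
    remove-≢ E {p} {q} p≢v q≢v rewrite dec-false (p ≟ v) p≢v | dec-false (q ≟ v) q≢v =
      Bool.∧-identityʳ (E p q)

    remove-to : ∀ E p → remove v E p v ≡ false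
    remove-to E p rewrite dec-true (v ≟ v) refl | Bool.∧-zeroʳ (not (does (p ≟ v))) = Bool.∧-zeroʳ (E p v)

    remove-from : ∀ E q → remove v E v q ≡ false
    remove-from E q rewrite dec-true (v ≟ v) refl = Bool.∧-zeroʳ (E v q)

    remove-graph : ∀ {E} → IsGraph E → IsGraph (remove v E)
    remove-graph G = record
      { symm  = λ p q → cong₂ _∧_ (IsGraph.symm G p q) (Bool.∧-comm (not (does (p ≟ v))) _)
      ; irrfl = λ p → cong (_∧ (not (does (p ≟ v)) ∧ not (does (p ≟ v)))) (IsGraph.irrfl G p)
      }

  -- A lower bound for all deviations together with their common parity; the next possible value
  -- after `D` is `D` + 2.
  Parity : ∀ {N} {E : Rel N} → IsGraph E → (Fin N → ℕ) → ℕ → Set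
  Parity {E = E} G f D = ∀ (F : Sub E) → ∃[ k ] dev (excess G f F) ≡ D + (k + k)

  Alive : ∀ {N} → Rel N → (Fin N → Bool) → Set
  Alive E A = ∀ u v → E u v ≡ true → A u ≡ true

  -- The target that is left once all edges at `v` are used: each neighbour has one edge fewer to
  -- find.
  lowered : ∀ {N} → Rel N → Fin N → (Fin N → ℕ) → Fin N → ℕ
  lowered E v f = set v 0 (λ p → f p ∸ ⟦ E p v ⟧)

  module _ {N} {E : Rel N} {A : Fin N → Bool} {v : Fin N} (Av : A v ≡ true) where

    private
      alive : ∀ {p} → p ≢ v → A p ≡ true → delete v A p ≡ true
      alive p≢v h = trans (set-≢ {g = A} p≢v) h

      dead : ∀ {p} → A p ≡ false → p ≢ v × delete v A p ≡ false
      dead h = (λ { refl → true≢false Av h }) , trans (set-≢ {g = A} λ { refl → true≢false Av h }) h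

    -- A vertex put into S or T lies outside U, so the walks between representatives are those of
    -- the smaller graph; only the inequality remains to be checked.
    module Extend (X : Part) (X≢O : X ≢ O) (X≢U : X ≢ U) {f D}
      (B : Barrier (remove v E) (delete v A) f D) where

      open Barrier B

      part⁺ : Fin N → Part
      part⁺ = set v X part

      part-v : part v ≡ O
      part-v = outside v (set-≡ v false A)

      U⇒≢v : ∀ {p} → part p ≡ U → p ≢ v
      U⇒≢v e refl = contradiction (trans (sym part-v) e) λ ()

      U⁺ : ∀ {p} → part⁺ p ≡ U → p ≢ v × part p ≡ U
      U⁺ {p} e with p ≟ v
      ... | yes refl = contradiction e X≢U
      ... | no p≢v   = p≢v , e

      extend : ∀ {f⁺ D⁺} →
        D⁺ + sum (λ p → cost (part⁺ p) (f⁺ p) (degOff E part⁺ p))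
          ≤ count reps + sum (λ p → gain (part⁺ p) (f⁺ p)) →
        Barrier E A f⁺ D⁺
      extend value⁺ = record
        { part      = part⁺
        ; outside   = λ p h → trans (set-≢ (proj₁ (dead h))) (outside p (proj₂ (dead h)))
        ; inside    = inside⁺
        ; reps      = reps
        ; reps-U    = λ p h → trans (set-≢ (U⇒≢v (reps-U p h))) (reps-U p h)
        ; separated = λ u w ru rw u≢w path → separated u w ru rw u≢w (Star.map link path)
        ; value     = value⁺
        }
        where
        inside⁺ : ∀ p → A p ≡ true → part⁺ p ≢ O
        inside⁺ p h with p ≟ v
        ... | yes _  = X≢O
        ... | no p≢v = inside p (alive p≢v h)
        link : ∀ {u w} → Linked E part⁺ u w → Linked (remove v E) part u w
        link (e , pu , pw) = let (u≢ , pu′) = U⁺ pu ; (w≢ , pw′) = U⁺ pw in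
          trans (remove-≢ v E u≢ w≢) e , pu′ , pw′

    module _ (G : IsGraph E) where

      open IsGraph G

      -- With `f v` zero, `v` costs nothing in S, and there it takes its edges out of the degrees
      -- that count, exactly as its deletion does.
      extend-S : ∀ {f D} → f v ≡ 0 → Barrier (remove v E) (delete v A) f D → Barrier E A f D
      extend-S {f} {D} fv B = extend (subst₂ (λ a b → D + a ≤ count reps + b)
          (sum-cong-≗ costs) (sum-cong-≗ gains) value)
        where
        open Extend S (λ ()) (λ ()) B
        open Barrier B
        degs : ∀ p → p ≢ v → degOff (remove v E) part p ≡ degOff E part⁺ p
        degs p p≢v = sum-cong-≗ λ u → cong ⟦_⟧ (entry u)
          where
          entry : ∀ u → remove v E p u ∧ not (isS (part u)) ≡ E p u ∧ not (isS (part⁺ u))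
          entry u = cases (u ≟ v)
            where
            cases : Dec (u ≡ v) → remove v E p u ∧ not (isS (part u)) ≡ E p u ∧ not (isS (part⁺ u))
            cases (yes refl) = trans (cong (_∧ not (isS (part v))) (remove-to v E p)) (sym (trans
              (cong (λ X → E p v ∧ not (isS X)) (set-≡ v S part)) (Bool.∧-zeroʳ (E p v))))
            cases (no u≢v) = cong₂ (λ b X → b ∧ not (isS X)) (remove-≢ v E p≢v u≢v) (sym (set-≢ u≢v))
        costs : ∀ p → cost (part p) (f p) (degOff (remove v E) part p) ≡ cost (part⁺ p) (f p) (degOff E part⁺ p)
        costs p = cases (p ≟ v)
          where
          cases : Dec (p ≡ v) → cost (part p) (f p) (degOff (remove v E) part p) ≡ cost (part⁺ p) (f p) (degOff E part⁺ p)
          cases (yes refl) = trans (cong (λ X → cost X (f v) (degOff (remove v E) part v)) part-v)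
            (trans (sym fv) (sym (cong (λ X → cost X (f v) (degOff E part⁺ v)) (set-≡ v S part))))
          cases (no p≢v) = trans (cong (cost (part p) (f p)) (degs p p≢v))
            (sym (cong (λ X → cost X (f p) (degOff E part⁺ p)) (set-≢ p≢v)))
        gains : ∀ p → gain (part p) (f p) ≡ gain (part⁺ p) (f p)
        gains p = cases (p ≟ v)
          where
          cases : Dec (p ≡ v) → gain (part p) (f p) ≡ gain (part⁺ p) (f p)
          cases (yes refl) = trans (cong (λ X → gain X (f v)) part-v)
            (sym (cong (λ X → gain X (f v)) (set-≡ v S part)))
          cases (no p≢v) = sym (cong (λ X → gain X (f p)) (set-≢ p≢v))

      -- The premise keeps the truncated subtraction in `lowered` exact.
      lowered-restore : ∀ {f} → (∀ p → E p v ≡ true → 1 ≤ f p) →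
                        ∀ p → p ≢ v → f p ≡ lowered E v f p + ⟦ E p v ⟧
      lowered-restore {f} f≥1 p p≢v = trans (sym (m∸n+n≡m e≤f))
          (cong (_+ ⟦ E p v ⟧) (sym (set-≢ {g = λ p → f p ∸ ⟦ E p v ⟧} p≢v)))
        where
        e≤f : ⟦ E p v ⟧ ≤ f p
        e≤f with E p v in eq
        ... | true  = f≥1 p eq
        ... | false = z≤n

      -- A neighbour of `v` in T pays one edge more and gains one unit more. A neighbour in S costs
      -- one unit more, which `v` saves because that edge does not count for it. What is left over
      -- is `f v` minus the degree of `v`, that is `c`.
      extend-T : ∀ {f D} → (∀ p → E p v ≡ true → 1 ≤ f p) → ∀ c → f v ≡ c + deg E v →
                 Barrier (remove v E) (delete v A) (lowered E v f) D → Barrier E A f (D + c)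
      extend-T {f} {D} f≥1 c fv B = extend (+-cancelʳ-≤ (sum gain′) _ _ (begin
          D + c + sum cost⁺ + sum gain′        ≡⟨ rearrange D c (sum cost⁺) (sum gain′) ⟩
          D + (sum cost⁺ + sum gain′ + c)      ≡⟨ cong (λ m → D + m) total ⟩
          D + (sum cost′ + sum gain⁺)          ≡⟨ +-assoc D _ _ ⟨
          D + sum cost′ + sum gain⁺            ≤⟨ +-monoˡ-≤ _ value ⟩
          count reps + sum gain′ + sum gain⁺   ≡⟨ swap (count reps) (sum gain′) (sum gain⁺) ⟩
          count reps + sum gain⁺ + sum gain′   ∎))
        where
        open ≤-Reasoning
        open Extend T (λ ()) (λ ()) B
        open Barrier B
        cost⁺ cost′ gain⁺ gain′ σ : Fin N → ℕ
        cost⁺ p = cost (part⁺ p) (f p) (degOff E part⁺ p)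
        cost′ p = cost (part p) (lowered E v f p) (degOff (remove v E) part p)
        gain⁺ p = gain (part⁺ p) (f p)
        gain′ p = gain (part p) (lowered E v f p)
        σ p     = ⟦ E p v ∧ isS (part⁺ p) ⟧

        rearrange : ∀ a b c d → a + b + c + d ≡ a + (c + d + b)
        rearrange = solve 4 (λ a b c d → a :+ b :+ c :+ d := a :+ (c :+ d :+ b)) refl
          where open ℕ-Solver hiding (⟦_⟧)
        swap : ∀ a b c → a + b + c ≡ a + c + b
        swap = solve 3 (λ a b c → a :+ b :+ c := a :+ c :+ b) refl
          where open ℕ-Solver hiding (⟦_⟧)

        σ-sum : sum σ + degOff E part⁺ v ≡ deg E v
        σ-sum = trans (sym (∑-distrib-+ σ _)) (sum-cong-≗ λ p →
          trans (cong (λ b → ⟦ b ∧ isS (part⁺ p) ⟧ + ⟦ E v p ∧ not (isS (part⁺ p)) ⟧) (symm p v))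
            (split (E v p) (isS (part⁺ p))))
          where
          split : ∀ a b → ⟦ a ∧ b ⟧ + ⟦ a ∧ not b ⟧ ≡ ⟦ a ⟧
          split true true   = refl
          split true false  = refl
          split false _     = refl

        degs : ∀ p → p ≢ v → degOff E part⁺ p ≡ degOff (remove v E) part p + ⟦ E p v ⟧
        degs p p≢v = begin-equality
          degOff E part⁺ p                                  ≡⟨ +-identityʳ _ ⟨
          degOff E part⁺ p + 0                              ≡⟨ cong (λ b → degOff E part⁺ p + ⟦ b ∧ not (isS (part v)) ⟧) (remove-to v E p) ⟨
          degOff E part⁺ p + ⟦ remove v E p v ∧ not (isS (part v)) ⟧
            ≡⟨ ∑-agree v (λ u u≢v → cong₂ (λ b X → ⟦ b ∧ not (isS X) ⟧) (sym (remove-≢ v E p≢v u≢v)) (set-≢ u≢v)) ⟩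
          degOff (remove v E) part p + ⟦ E p v ∧ not (isS (part⁺ v)) ⟧
            ≡⟨ cong (λ b → degOff (remove v E) part p + ⟦ b ⟧) (trans (cong (λ X → E p v ∧ not (isS X)) (set-≡ v T part)) (Bool.∧-identityʳ (E p v))) ⟩
          degOff (remove v E) part p + ⟦ E p v ⟧ ∎

        balance : ∀ X f f′ d d′ e → f ≡ f′ + ⟦ e ⟧ → d ≡ d′ + ⟦ e ⟧ →
                  cost X f d + gain X f′ ≡ cost X f′ d′ + gain X f + ⟦ e ∧ isS X ⟧
        balance S f f′ d d′ e refl refl = trans (+-identityʳ _) (cong₂ (λ a b → a + ⟦ b ⟧) (sym (+-identityʳ f′)) (sym (Bool.∧-identityʳ e)))
        balance T f f′ d d′ e refl refl rewrite Bool.∧-zeroʳ e =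
          solve 3 (λ d f e → d :+ e :+ f := d :+ (f :+ e) :+ con 0) refl d′ f′ ⟦ e ⟧
          where open ℕ-Solver hiding (⟦_⟧)
        balance U f f′ d d′ e _ _ rewrite Bool.∧-zeroʳ e = refl
        balance O f f′ d d′ e _ _ rewrite Bool.∧-zeroʳ e = refl

        balance-at : ∀ p → p ≢ v → cost⁺ p + gain′ p ≡ cost′ p + gain⁺ p + σ p
        balance-at p p≢v = subst
          (λ X → cost X (f p) (degOff E part⁺ p) + gain′ p ≡ cost′ p + gain X (f p) + ⟦ E p v ∧ isS X ⟧)
          (sym (set-≢ p≢v))
          (balance (part p) (f p) (lowered E v f p) (degOff E part⁺ p) (degOff (remove v E) part p) (E p v)
            (lowered-restore f≥1 p p≢v) (degs p p≢v))

        total : sum cost⁺ + sum gain′ + c ≡ sum cost′ + sum gain⁺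
        total = +-cancelʳ-≡ (deg E v) _ _ (begin-equality
          sum cost⁺ + sum gain′ + c + deg E v      ≡⟨ +-assoc (sum cost⁺ + sum gain′) c (deg E v) ⟩
          sum cost⁺ + sum gain′ + (c + deg E v)    ≡⟨ cong₂ _+_ (sym (∑-distrib-+ cost⁺ gain′)) (sym fv) ⟩
          sum (λ p → cost⁺ p + gain′ p) + f v      ≡⟨ cong (λ m → sum (λ p → cost⁺ p + gain′ p) + m) at-v′ ⟨
          sum (λ p → cost⁺ p + gain′ p) + (cost′ v + gain⁺ v + σ v) ≡⟨ ∑-agree v balance-at ⟩
          sum (λ p → cost′ p + gain⁺ p + σ p) + (cost⁺ v + gain′ v)
            ≡⟨ cong₂ _+_ (trans (∑-distrib-+ (λ p → cost′ p + gain⁺ p) σ) (cong (_+ sum σ) (∑-distrib-+ cost′ gain⁺))) at-v ⟩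
          sum cost′ + sum gain⁺ + sum σ + degOff E part⁺ v ≡⟨ +-assoc (sum cost′ + sum gain⁺) (sum σ) (degOff E part⁺ v) ⟩
          sum cost′ + sum gain⁺ + (sum σ + degOff E part⁺ v) ≡⟨ cong (λ m → sum cost′ + sum gain⁺ + m) σ-sum ⟩
          sum cost′ + sum gain⁺ + deg E v          ∎)
          where
          at-v : cost⁺ v + gain′ v ≡ degOff E part⁺ v
          at-v = trans (cong₂ (λ X Y → cost X (f v) (degOff E part⁺ v) + gain Y (lowered E v f v)) (set-≡ v T part) part-v)
            (+-identityʳ _)
          at-v′ : cost′ v + gain⁺ v + σ v ≡ f v
          at-v′ = trans (cong₂ _+_
            (cong₂ (λ X Y → cost X (lowered E v f v) (degOff (remove v E) part v) + gain Y (f v)) part-v (set-≡ v T part))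
            (cong (λ b → ⟦ b ∧ isS (part⁺ v) ⟧) (irrfl v))) (+-identityʳ _)

      -- T consists of `v`, S is empty and there are no representatives: the surplus of `f v` over
      -- the degree of `v` alone covers `D`.
      whole : ∀ {f D} → D + deg E v ≤ f v → Barrier E A f D
      whole {f} {D} le = record
        { part = part ; outside = outside ; inside = inside ; reps = λ _ → false
        ; reps-U = λ _ () ; separated = λ _ _ () ; value = value }
        where
        side : Bool → Part
        side true  = U
        side false = O
        part : Fin N → Part
        part = set v T (λ p → side (A p))
        outside : ∀ p → A p ≡ false → part p ≡ O
        outside p h = trans (set-≢ (proj₁ (dead h))) (cong side h)
        inside : ∀ p → A p ≡ true → part p ≢ O
        inside p h e with p ≟ v
        ... | no _ = contradiction (trans (sym (cong side h)) e) λ ()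
        no-S : ∀ p → isS (part p) ≡ false
        no-S p with p ≟ v
        ... | yes _ = refl
        ... | no _ with A p
        ...   | true  = refl
        ...   | false = refl
        no-gain : ∀ b n → gain (side b) n ≡ 0
        no-gain true  n = refl
        no-gain false n = refl
        no-cost : ∀ b m n → cost (side b) m n ≡ 0
        no-cost true  m n = refl
        no-cost false m n = refl
        only : ∀ (g : Fin N → ℕ) → (∀ p → p ≢ v → g p ≡ 0) → sum g ≡ g v
        only g h = trans (sym (+-identityʳ _)) (trans (∑-agree v h) (cong (_+ g v) (∑-zero N)))
        value : D + sum (λ p → cost (part p) (f p) (degOff E part p)) ≤
                count {N} (λ _ → false) + sum (λ p → gain (part p) (f p))
        value = begin
          D + sum (λ p → cost (part p) (f p) (degOff E part p))
            ≡⟨ cong (λ m → D + m) (only _ λ p p≢v → trans (cong (λ X → cost X (f p) (degOff E part p)) (set-≢ p≢v)) (no-cost (A p) _ _)) ⟩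
          D + cost (part v) (f v) (degOff E part v)
            ≡⟨ cong (λ X → D + cost X (f v) (degOff E part v)) (set-≡ v T (λ p → side (A p))) ⟩
          D + degOff E part v
            ≡⟨ cong (λ m → D + m) (sum-cong-≗ λ u → cong ⟦_⟧ (trans (cong (λ b → E v u ∧ not b) (no-S u)) (Bool.∧-identityʳ (E v u)))) ⟩
          D + deg E v
            ≤⟨ le ⟩
          f v
            ≡⟨ cong (λ X → gain X (f v)) (set-≡ v T (λ p → side (A p))) ⟨
          gain (part v) (f v)
            ≡⟨ only (λ p → gain (part p) (f p)) (λ p p≢v → trans (cong (λ X → gain X (f p)) (set-≢ p≢v)) (no-gain (A p) _)) ⟨
          sum (λ p → gain (part p) (f p))
            ≤⟨ m≤n+m _ _ ⟩
          count {N} (λ _ → false) + sum (λ p → gain (part p) (f p)) ∎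
          where open ≤-Reasoning

      parity-S : ∀ {f D} → Parity G f D → Parity (remove-graph v G) f D
      parity-S P F = P (record
        { rel = rel F ; rel-sym = rel-sym F
        ; rel-⊆ = λ p q h → proj₁ (remove-true v E (rel-⊆ F p q h)) })

      -- Adding all edges at `v` to a subgraph of the rest changes no other excess, since `lowered`
      -- has accounted for them, and leaves `v` short by exactly `c`.
      parity-T : ∀ {f D} → (∀ p → E p v ≡ true → 1 ≤ f p) → ∀ c → f v ≡ c + deg E v →
                 Parity G f (D + c) → Parity (remove-graph v G) (lowered E v f) D
      parity-T {f} {D} f≥1 c fv P F = let (k , e) = P star in k ,
          +-cancelʳ-≡ c _ _ (trans (sym dev-star) (trans e (swap D c (k + k))))
        where
        swap : ∀ a b c → a + b + c ≡ a + c + b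
        swap = solve 3 (λ a b c → a :+ b :+ c := a :+ c :+ b) refl
          where open ℕ-Solver hiding (⟦_⟧)
        at : Rel N
        at p q = does (p ≟ v) ∨ does (q ≟ v)
        star : Sub E
        star = record
          { rel = λ p q → rel F p q ∨ (E p q ∧ at p q)
          ; rel-sym = λ p q → cong₂ _∨_ (rel-sym F p q) (cong₂ _∧_ (symm p q) (Bool.∨-comm (does (p ≟ v)) _))
          ; rel-⊆ = ⊆
          }
          where
          ⊆ : ∀ p q → rel F p q ∨ (E p q ∧ at p q) ≡ true → E p q ≡ true
          ⊆ p q h with rel F p q in eq
          ... | true  = proj₁ (remove-true v E (rel-⊆ F p q eq))
          ... | false = proj₁ (∧-true h)
        not-F : ∀ p q → remove v E p q ≡ false → rel F p q ≡ false
        not-F p q h with rel F p q in eq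
        ... | false = refl
        ... | true  = contradiction h (true≢false (rel-⊆ F p q eq))
        star-v : ∀ q → rel star v q ≡ E v q
        star-v q = trans (cong₂ (λ a b → a ∨ (E v q ∧ (b ∨ does (q ≟ v)))) (not-F v q (remove-from v E q)) (dec-true (v ≟ v) refl))
          (Bool.∧-identityʳ (E v q))
        star-to : ∀ p → rel star p v ≡ E p v
        star-to p = trans (rel-sym star p v) (trans (star-v p) (symm v p))
        star-≢ : ∀ p q → p ≢ v → q ≢ v → rel star p q ≡ rel F p q
        star-≢ p q p≢v q≢v = trans (cong₂ (λ a b → rel F p q ∨ (E p q ∧ (a ∨ b))) (dec-false (p ≟ v) p≢v) (dec-false (q ≟ v) q≢v))
          (trans (cong (rel F p q ∨_) (Bool.∧-zeroʳ (E p q))) (Bool.∨-identityʳ _))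
        deg-star : ∀ p → p ≢ v → deg (rel star) p ≡ deg (rel F) p + ⟦ E p v ⟧
        deg-star p p≢v = trans (sym (+-identityʳ _)) (trans
          (cong (λ b → deg (rel star) p + ⟦ b ⟧) (sym (not-F p v (remove-to v E p))))
          (trans (∑-agree v (λ q q≢v → cong ⟦_⟧ (star-≢ p q p≢v q≢v)))
            (cong (λ b → deg (rel F) p + ⟦ b ⟧) (star-to p))))
        excess-≢ : ∀ p → p ≢ v → ∣ excess G f star p ∣ ≡ ∣ excess (remove-graph v G) (lowered E v f) F p ∣
        excess-≢ p p≢v = cong ∣_∣ (trans
          (cong₂ (λ a b → + a ℤ.- + b) (deg-star p p≢v) (lowered-restore f≥1 p p≢v))
          (trans (cong₂ ℤ._-_ (ℤ.pos-+ (deg (rel F) p) ⟦ E p v ⟧) (ℤ.pos-+ (lowered E v f p) ⟦ E p v ⟧))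
            (cancel (+ deg (rel F) p) (+ lowered E v f p) (+ ⟦ E p v ⟧))))
          where
          cancel : ∀ a b e → (a ℤ.+ e) ℤ.- (b ℤ.+ e) ≡ a ℤ.- b
          cancel = solve 3 (λ a b e → (a :+ e) :- (b :+ e) := a :- b) refl
            where open ℤ-Solver hiding (⟦_⟧)
        dev-star : dev (excess G f star) ≡ dev (excess (remove-graph v G) (lowered E v f) F) + c
        dev-star = trans (sym (+-identityʳ _)) (trans
          (cong (λ m → dev (excess G f star) + m) (sym at-v′))
          (trans (∑-agree v excess-≢) (cong (λ m → dev (excess (remove-graph v G) (lowered E v f) F) + m) at-v)))
          where
          at-v : ∣ excess G f star v ∣ ≡ c
          at-v = trans (cong₂ (λ a b → ∣ + a ℤ.- + b ∣) (sum-cong-≗ λ q → cong ⟦_⟧ (star-v q)) fv)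
            (trans (cong ∣_∣ (gap (+ deg E v) (+ c))) (ℤ.∣-i∣≡∣i∣ (+ c)))
            where
            gap : ∀ d c → d ℤ.- (c ℤ.+ d) ≡ ℤ.- c
            gap = solve 2 (λ d c → d :- (c :+ d) := :- c) refl
              where open ℤ-Solver hiding (⟦_⟧)
          at-v′ : ∣ excess (remove-graph v G) (lowered E v f) F v ∣ ≡ 0
          at-v′ = cong₂ (λ a b → ∣ + a ℤ.- + b ∣)
            (trans (sum-cong-≗ λ q → cong ⟦_⟧ (not-F v q (remove-from v E q))) (∑-zero N))
            (set-≡ v 0 (λ p → f p ∸ ⟦ E p v ⟧))

  -- Shifting the target at one vertex.

  nonneg-succ : ∀ a {b} → b ≡ a ℤ.+ + 1 → ¬ Neg a → ∣ b ∣ ≡ suc ∣ a ∣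
  nonneg-succ a refl ¬neg with succ-abs a
  ... | inj₁ e = e
  nonneg-succ (+ n) refl ¬neg | inj₂ e = +-comm n 1
  nonneg-succ -[1+ n ] refl ¬neg | inj₂ e = contradiction -<+ ¬neg

  neg-succ : ∀ a {b} → b ≡ a ℤ.+ + 1 → Neg a → ∣ a ∣ ≡ suc ∣ b ∣
  neg-succ -[1+ zero ] refl _ = refl
  neg-succ -[1+ suc n ] refl _ = refl
  neg-succ (+ n) _ (+<+ ())

  module _ {N} {E : Rel N} (G : IsGraph E) where

    -- A deviation that drops was not `D`, hence at least `D` + 2 by parity, and stays at `D` + 1 or
    -- above.
    parity-shift : ∀ f f′ {D} →
      (∀ F → dev (excess G f′ F) ≡ suc (dev (excess G f F)) ⊎
             (dev (excess G f F) ≡ suc (dev (excess G f′ F)) × dev (excess G f F) ≢ D)) →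
      Parity G f D → Parity G f′ (suc D)
    parity-shift f f′ {D} h P F with P F | h F
    ... | k , e     | inj₁ e′ = k , trans e′ (cong suc e)
    ... | zero , e  | inj₂ (_ , ≢D) = contradiction (trans e (+-identityʳ D)) ≢D
    ... | suc k , e | inj₂ (e′ , _) = k , cong pred (trans (sym e′) (trans e
          (trans (+-suc D (k + suc k)) (cong suc (trans (cong (λ m → D + m) (+-suc k k)) (+-suc D (k + k)))))))

    Unbalanced : (Fin N → ℕ) → ℕ → (ℤ → Set) → Fin N → Set
    Unbalanced f D P v = ∃[ F ] dev (excess G f F) ≡ D × P (excess G f F v)

    module _ {f : Fin N → ℕ} {D : ℕ} (v : Fin N) where

      private
        same-dev : ∀ f′ → (∀ p → p ≢ v → f′ p ≡ f p) → ∀ F p → p ≢ v →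
                   ∣ excess G f F p ∣ ≡ ∣ excess G f′ F p ∣
        same-dev f′ h F p p≢v = cong (λ m → ∣ + deg (rel F) p ℤ.- + m ∣) (sym (h p p≢v))

        decrement : ∀ d {m n} → m ≡ suc n → + d ℤ.- + n ≡ (+ d ℤ.- + m) ℤ.+ + 1
        decrement d {n = n} refl = solve 2 (λ d n → d :- n :=
              (d :- (con (+ 1) :+ n)) :+ con (+ 1)) refl (+ d) (+ n)
          where open ℤ-Solver hiding (⟦_⟧)

        neg? : ∀ a → Dec (Neg a)
        neg? a = a ℤ.<? + 0

        pos? : ∀ a → Dec (Pos a)
        pos? a = + 0 ℤ.<? a

      -- Lowering `f v` improves only the subgraphs short at `v`, and by assumption none of these is
      -- optimal.
      parity-decrease : ∀ {m} → f v ≡ suc m → ¬ Unbalanced f D Neg v →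
                        Parity G f D → Parity G (set v m f) (suc D)
      parity-decrease {m} fv none = parity-shift f f′ λ F → cases F (neg? (excess G f F v))
        where
        f′ = set v m f
        off : ∀ p → p ≢ v → f′ p ≡ f p
        off p p≢v = set-≢ p≢v
        step-v : ∀ F → excess G f′ F v ≡ excess G f F v ℤ.+ + 1
        step-v F = decrement (deg (rel F) v) (trans fv (cong suc (sym (set-≡ v m f))))
        cases : ∀ F → Dec (Neg (excess G f F v)) →
                dev (excess G f′ F) ≡ suc (dev (excess G f F)) ⊎
                (dev (excess G f F) ≡ suc (dev (excess G f′ F)) × dev (excess G f F) ≢ D)
        cases F (no ¬neg) = inj₁ (∑-drop v (λ p p≢v → sym (same-dev f′ off F p p≢v)) (nonneg-succ (excess G f F v) (step-v F) ¬neg))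
        cases F (yes neg) = inj₂ (∑-drop v (same-dev f′ off F) (neg-succ (excess G f F v) (step-v F) neg) , λ e → none (F , e , neg))

      parity-increase : ¬ Unbalanced f D Pos v →
                        Parity G f D → Parity G (set v (suc (f v)) f) (suc D)
      parity-increase none = parity-shift f f′ λ F → cases F (pos? (excess G f F v))
        where
        f′ = set v (suc (f v)) f
        off : ∀ p → p ≢ v → f′ p ≡ f p
        off p p≢v = set-≢ p≢v
        step-v : ∀ F → excess G f F v ≡ excess G f′ F v ℤ.+ + 1
        step-v F = decrement (deg (rel F) v) (set-≡ v (suc (f v)) f)
        nonneg : ∀ {a b} → b ≡ a ℤ.+ + 1 → Pos b → ¬ Neg a
        nonneg { -[1+ zero ]} refl (+<+ ())
        nonneg { -[1+ suc n ]} refl ()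
        nonneg {+ n} refl _ (+<+ ())
        neg : ∀ {a b} → b ≡ a ℤ.+ + 1 → ¬ Pos b → Neg a
        neg {+ n} refl h = contradiction (+<+ (m≤n+m 1 n)) h
        neg { -[1+ n ]} _ _ = -<+
        cases : ∀ F → Dec (Pos (excess G f F v)) →
                dev (excess G f′ F) ≡ suc (dev (excess G f F)) ⊎
                (dev (excess G f F) ≡ suc (dev (excess G f′ F)) × dev (excess G f F) ≢ D)
        cases F (no ¬pos) = inj₁ (∑-drop v (λ p p≢v → sym (same-dev f′ off F p p≢v)) (neg-succ (excess G f′ F v) (step-v F) (neg {excess G f′ F v} (step-v F) ¬pos)))
        cases F (yes pos) = inj₂ (∑-drop v (same-dev f′ off F) (nonneg-succ (excess G f′ F v) (step-v F) (nonneg {excess G f′ F v} (step-v F) pos)) , λ e → none (F , e , pos))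

    -- One unit of change at `v` shifts the balance by at most one, which the extra unit of
    -- deficiency absorbs.
    weaken : ∀ {A f f′ D} v →
      (∀ X p d → cost X (f p) d + gain X (f′ p) ≤ cost X (f′ p) d + gain X (f p) + δ v p) →
      Barrier E A f′ (suc D) → Barrier E A f D
    weaken {f = f} {f′} {D} v h B = record
      { part = part ; outside = outside ; inside = inside ; reps = reps
      ; reps-U = reps-U ; separated = separated
      ; value = +-cancelʳ-≤ (sum (g f′)) _ _ (begin
          D + sum (c f) + sum (g f′)                  ≡⟨ +-assoc D _ _ ⟩
          D + (sum (c f) + sum (g f′))                ≡⟨ cong (λ m → D + m) (∑-distrib-+ (c f) (g f′)) ⟨
          D + sum (λ p → c f p + g f′ p)              ≤⟨ +-monoʳ-≤ D (∑-mono-≤ λ p → h (part p) p _) ⟩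
          D + sum (λ p → c f′ p + g f p + δ v p)      ≡⟨ cong (λ m → D + m) (trans (∑-distrib-+ (λ p → c f′ p + g f p) (δ v)) (cong₂ _+_ (∑-distrib-+ (c f′) (g f)) (∑-δ v))) ⟩
          D + (sum (c f′) + sum (g f) + 1)            ≡⟨ rearrange D (sum (c f′)) (sum (g f)) ⟩
          suc D + sum (c f′) + sum (g f)              ≤⟨ +-monoˡ-≤ _ value ⟩
          count reps + sum (g f′) + sum (g f)         ≡⟨ swap (count reps) (sum (g f′)) (sum (g f)) ⟩
          count reps + sum (g f) + sum (g f′)         ∎)
      }
      where
      open ≤-Reasoning
      open Barrier B
      c g : (Fin N → ℕ) → Fin N → ℕ
      c f p = cost (part p) (f p) (degOff E part p)
      g f p = gain (part p) (f p)
      rearrange : ∀ a b c → a + (b + c + 1) ≡ suc a + b + c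
      rearrange = solve 3 (λ a b c → a :+ (b :+ c :+ con 1) := con 1 :+ a :+ b :+ c) refl
        where open ℕ-Solver hiding (⟦_⟧)
      swap : ∀ a b c → a + b + c ≡ a + c + b
      swap = solve 3 (λ a b c → a :+ b :+ c := a :+ c :+ b) refl
        where open ℕ-Solver hiding (⟦_⟧)

    weaken-decrease : ∀ {A f D} v {m} → f v ≡ suc m → Barrier E A (set v m f) (suc D) → Barrier E A f D
    weaken-decrease {f = f} v {m} fv = weaken v λ X p d → cases X p d (p ≟ v)
      where
      f′ = set v m f
      cases : ∀ X p d → Dec (p ≡ v) → cost X (f p) d + gain X (f′ p) ≤ cost X (f′ p) d + gain X (f p) + δ v p
      cases X p d (no p≢v) rewrite set-≢ {a = m} {g = f} p≢v = m≤m+n _ _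
      cases X p d (yes refl) rewrite fv | set-≡ p m f | δ-≡ p = by X
        where
        by : ∀ X → cost X (suc m) d + gain X m ≤ cost X m d + gain X (suc m) + 1
        by S = ≤-reflexive (trans (+-identityʳ _) (sym (trans (cong (_+ 1) (+-identityʳ m)) (+-comm m 1))))
        by T = ≤-trans (+-monoʳ-≤ d (n≤1+n m)) (m≤m+n _ _)
        by U = z≤n
        by O = z≤n

    weaken-increase : ∀ {A f D} v → Barrier E A (set v (suc (f v)) f) (suc D) → Barrier E A f D
    weaken-increase {f = f} v = weaken v λ X p d → cases X p d (p ≟ v)
      where
      f′ = set v (suc (f v)) f
      cases : ∀ X p d → Dec (p ≡ v) → cost X (f p) d + gain X (f′ p) ≤ cost X (f′ p) d + gain X (f p) + δ v p
      cases X p d (no p≢v) rewrite set-≢ {a = suc (f v)} {g = f} p≢v = m≤m+n _ _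
      cases X p d (yes refl) rewrite set-≡ p (suc (f p)) f | δ-≡ p = by X
        where
        by : ∀ X → cost X (f p) d + gain X (suc (f p)) ≤ cost X (suc (f p)) d + gain X (f p) + 1
        by S = ≤-trans (≤-reflexive (+-identityʳ _)) (≤-trans (n≤1+n _) (≤-trans (≤-reflexive (sym (+-identityʳ _))) (m≤m+n _ 1)))
        by T = ≤-reflexive (trans (+-suc d (f p)) (+-comm 1 _))
        by U = z≤n
        by O = z≤n

  -- The critical case, and the induction that reaches it.

  nonzero : ℤ → Bool
  nonzero (+ zero)  = false
  nonzero (+ suc n) = true
  nonzero -[1+ n ]  = true

  nonzero-true : ∀ {a} → nonzero a ≡ true → a ≢ + 0
  nonzero-true () refl

  abs-nonzero : ∀ a → ∣ a ∣ ≤ 1 → ∣ a ∣ ≡ ⟦ nonzero a ⟧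
  abs-nonzero (+ zero)         _ = refl
  abs-nonzero (+ suc zero)     _ = refl
  abs-nonzero (+ suc (suc n))  (s≤s ())
  abs-nonzero -[1+ zero ]      _ = refl
  abs-nonzero -[1+ suc n ]     (s≤s ())

  module _ {N} {E : Rel N} (G : IsGraph E) {A : Fin N → Bool} (alive : Alive E A)
    {f : Fin N → ℕ} (dead-f : ∀ p → A p ≡ false → f p ≡ 0) where

    emptySub : Sub E
    emptySub = record { rel = λ _ _ → false ; rel-sym = λ _ _ → refl ; rel-⊆ = λ _ _ () }

    dev-empty : dev (excess G f emptySub) ≡ sum f
    dev-empty = sum-cong-≗ λ p → trans
      (cong (λ d → ∣ + d ℤ.- + f p ∣) (∑-zero N))
      (trans (cong ∣_∣ (ℤ.+-identityˡ (ℤ.- + f p))) (ℤ.∣-i∣≡∣i∣ (+ f p)))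

    dead-excess : ∀ F p → A p ≡ false → excess G f F p ≡ + 0
    dead-excess F p h = cong₂ (λ d n → + d ℤ.- + n)
      (trans (sum-cong-≗ λ q → cong ⟦_⟧ (no-edge q)) (∑-zero N)) (dead-f p h)
      where
      no-edge : ∀ q → rel F p q ≡ false
      no-edge q with rel F p q in eq
      ... | false = refl
      ... | true  = contradiction h (true≢false (alive p q (rel-⊆ F p q eq)))

    -- S and T can be empty: an optimal subgraph deviates by one at each site where it deviates at
    -- all, and these sites lie in distinct components, so there are `D` of them to serve as
    -- representatives.
    gallai-barrier : ∀ {D} → Parity G f D →
      (∀ v → A v ≡ true → Unbalanced G f D Pos v × Unbalanced G f D Neg v) → Barrier E A f D
    gallai-barrier {D} P crit = fromOptimal optimal
      where
      JS : JumpSystem (Adj G) D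
      JS = jumpSystem G f D λ F → let (k , e) = P F in subst (D ≤_) (sym e) (m≤m+n D _)
      critical : ∀ u → (∀ F → excess G f F u ≡ + 0) ⊎ JumpSystem.Critical JS u
      critical u with A u in eq
      ... | false = inj₁ λ F → dead-excess F u eq
      ... | true  = inj₂ (crit u eq)
      open Gallai JS critical using (unit; connected-separated)
      optimal : ∃[ F ] dev (excess G f F) ≡ D
      optimal with any? (λ v → A v Bool.≟ true)
      ... | yes (v , Av) = let (F , e , _) = proj₁ (crit v Av) in F , e
      -- Without vertices `crit` supplies no optimal subgraph, but the empty one is optimal and `D`
      -- is zero.
      ... | no none = emptySub , trans zero-dev (sym D≡0)
        where
        all-dead : ∀ p → A p ≡ false
        all-dead p with A p in eq
        ... | false = refl
        ... | true  = contradiction (p , eq) none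
        zero-dev : dev (excess G f emptySub) ≡ 0
        zero-dev = trans dev-empty (trans (sum-cong-≗ λ p → dead-f p (all-dead p)) (∑-zero N))
        D≡0 : D ≡ 0
        D≡0 = let (k , e) = P emptySub in m+n≡0⇒m≡0 D (trans (sym e) zero-dev)
      fromOptimal : ∃[ F ] dev (excess G f F) ≡ D → Barrier E A f D
      fromOptimal (F , opt) = record
        { part      = λ p → side (A p)
        ; outside   = λ p h → cong side h
        ; inside    = λ p h e → contradiction (trans (sym (cong side h)) e) λ ()
        ; reps      = λ p → nonzero (excess G f F p)
        ; reps-U    = λ p h → cong side (rep-alive p h)
        ; separated = λ u w ru rw u≢w path → connected-separated (Star.map proj₁ path) u≢w F opt
                        (nonzero-true ru) (nonzero-true rw)
        ; value     = ≤-reflexive (begin-equality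
            D + sum (λ p → cost (side (A p)) (f p) (degOff E (λ p → side (A p)) p))
              ≡⟨ cong₂ _+_ (sym opt) (trans (sum-cong-≗ λ p → no-cost (A p)) (∑-zero N)) ⟩
            dev (excess G f F) + 0
              ≡⟨ cong₂ _+_ (sum-cong-≗ λ p → abs-nonzero _ (unit F p opt)) (sym (trans (sum-cong-≗ λ p → no-gain (A p)) (∑-zero N))) ⟩
            count (λ p → nonzero (excess G f F p)) + sum (λ p → gain (side (A p)) (f p)) ∎)
        }
        where
        open ≤-Reasoning
        side : Bool → Part
        side true  = U
        side false = O
        rep-alive : ∀ p → nonzero (excess G f F p) ≡ true → A p ≡ true
        rep-alive p h with A p in eq
        ... | true  = refl
        ... | false = contradiction (dead-excess F p eq) (nonzero-true h)
        no-cost : ∀ b {m n} → cost (side b) m n ≡ 0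
        no-cost true  = refl
        no-cost false = refl
        no-gain : ∀ b {n} → gain (side b) n ≡ 0
        no-gain true  = refl
        no-gain false = refl

    -- The empty subgraph deviates by the sum of `f`; this limits how often shifts can raise `D`.
    deficiency-bound : ∀ {D} → Parity G f D → (∀ p → f p ≤ N) → D ≤ N * N
    deficiency-bound {D} P f≤N = let (k , e) = P emptySub in begin
        D                          ≤⟨ m≤m+n D _ ⟩
        D + (k + k)                ≡⟨ e ⟨
        dev (excess G f emptySub)  ≡⟨ dev-empty ⟩
        sum f                      ≤⟨ ∑-mono-≤ f≤N ⟩
        sum {N} (λ _ → N)          ≡⟨ ∑-const N N ⟩
        N * N                      ∎
      where open ≤-Reasoning

  count≤ : ∀ {N} (P : Fin N → Bool) → count P ≤ N
  count≤ {N} P = ≤-trans (∑-mono-≤ λ i → ⟦b⟧≤1 (P i)) (≤-reflexive (trans (∑-const N 1) (*-identityʳ N)))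
    where
    ⟦b⟧≤1 : ∀ b → ⟦ b ⟧ ≤ 1
    ⟦b⟧≤1 true  = s≤s z≤n
    ⟦b⟧≤1 false = z≤n

  -- Each D below is a lower bound of the right parity for the deviation of every
  -- subgraph from f.  Vertices that f leaves no freedom at are put into S or T;
  -- at a vertex where no optimal subgraph falls short of (exceeds) f, decreasing
  -- (increasing) f there raises D; Gallai's lemma settles the remaining case.
  BarrierBelow : ℕ → ℕ → Set
  BarrierBelow N n = ∀ m {E : Rel N} (G : IsGraph E) {A} → Alive E A → ∀ {f} →
    (∀ p → A p ≡ false → f p ≡ 0) → ∀ {D} → Parity G f D →
    count A < n → N * N < D + m → ¬ ¬ Barrier E A f D

  barrier-step : ∀ {N n} → BarrierBelow N n → BarrierBelow N (suc n)
  barrier-step {N} {n} ih m {E} G {A} alive {f} dead-f {D} P (s≤s A<n) fuel ¬B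
    with any? (λ v → (A v Bool.≟ true) ×-dec (f v ℕ.≟ 0))
  -- The fuel restarts because `count A` has dropped; one more than `N * N` is enough for any
  -- deficiency.
  ... | yes (v , Av , fv) = ih (suc (N * N)) (remove-graph v G) alive′ dead-f′
          (parity-S {A = A} Av G {f} {D} P) (≤-trans (≤-reflexive (sym (delete-count v A Av))) A<n)
          (m≤n+m _ D) (¬B ∘ extend-S Av G fv)
    where
    alive′ : Alive (remove v E) (delete v A)
    alive′ p q h = let (e , p≢v , _) = remove-true v E h in trans (set-≢ {g = A} p≢v) (alive p q e)
    dead-f′ : ∀ p → delete v A p ≡ false → f p ≡ 0
    dead-f′ p h with p ≟ v
    ... | yes refl = fv
    ... | no _     = dead-f p h
  ... | no no-zero with any? (λ v → (A v Bool.≟ true) ×-dec (deg E v ≤? f v))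
  ... | yes (v , Av , full) = at-T (c ≤? D)
    where
    c = f v ∸ deg E v
    fv : f v ≡ c + deg E v
    fv = sym (m∸n+n≡m full)
    f≥1 : ∀ p → E p v ≡ true → 1 ≤ f p
    f≥1 p e = n≢0⇒n>0 λ z → no-zero (p , alive p v e , z)
    alive′ : Alive (remove v E) (delete v A)
    alive′ p q h = let (e , p≢v , _) = remove-true v E h in trans (set-≢ {g = A} p≢v) (alive p q e)
    dead-f′ : ∀ p → delete v A p ≡ false → lowered E v f p ≡ 0
    dead-f′ p h with p ≟ v
    ... | yes refl = refl
    ... | no _     = trans (cong (_∸ ⟦ E p v ⟧) (dead-f p h)) (0∸n≡0 ⟦ E p v ⟧)
    at-T : Dec (c ≤ D) → ⊥
    -- `D ∸ c` would be truncated here, so `v` alone has to form the barrier.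
    at-T (no c≰D) = ¬B (whole Av G (≤-trans (+-monoˡ-≤ (deg E v) (<⇒≤ (≰⇒> c≰D))) (≤-reflexive (sym fv))))
    at-T (yes c≤D) = ih (suc (N * N)) (remove-graph v G) alive′ dead-f′
          (parity-T {A = A} Av G {f} {D ∸ c} f≥1 c fv (subst (Parity G f) (sym D≡) P))
          (≤-trans (≤-reflexive (sym (delete-count v A Av))) A<n)
          (m≤n+m _ (D ∸ c)) (λ B → ¬B (subst (Barrier E A f) D≡ (extend-T Av G f≥1 c fv B)))
      where
      D≡ : D ∸ c + c ≡ D
      D≡ = m∸n+n≡m c≤D
  -- From here on `f` lies strictly between zero and the degree on all of `A`, which bounds `f` by
  -- `N` and `D` by `N * N`.
  ... | no no-full = critical m fuel
    where
    f≤N : ∀ p → f p ≤ N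
    f≤N p with A p in eq
    ... | true  = ≤-trans (<⇒≤ (≰⇒> λ h → no-full (p , eq , h))) (count≤ (E p))
    ... | false = ≤-trans (≤-reflexive (dead-f p eq)) z≤n
    critical : ∀ m → N * N < D + m → ⊥
    critical zero fuel = <⇒≱ fuel (≤-trans (≤-reflexive (+-identityʳ D)) (deficiency-bound G alive dead-f P f≤N))
    critical (suc m) fuel = ¬¬-∀ unbalanced λ crit → ¬B (gallai-barrier G alive dead-f P crit)
      where
      fuel′ : N * N < suc D + m
      fuel′ = subst (N * N <_) (+-suc D m) fuel
      dead-set : ∀ v x → A v ≡ true → ∀ p → A p ≡ false → set v x f p ≡ 0
      dead-set v x Av p h with p ≟ v
      ... | yes refl = contradiction h (true≢false Av)
      ... | no _     = dead-f p h
      not-pos : ∀ v → A v ≡ true → ¬ ¬ Unbalanced G f D Pos v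
      not-pos v Av none = barrier-step ih m G alive (dead-set v (suc (f v)) Av)
        (parity-increase G v none P) (s≤s A<n) fuel′ (¬B ∘ weaken-increase G v)
      not-neg : ∀ v → A v ≡ true → ¬ ¬ Unbalanced G f D Neg v
      not-neg v Av none = barrier-step ih m G alive (dead-set v (pred (f v)) Av)
        (parity-decrease G v fv none P) (s≤s A<n) fuel′ (¬B ∘ weaken-decrease G v fv)
        where
        fv : f v ≡ suc (pred (f v))
        fv = sym (suc-pred (f v) {{≢-nonZero λ z → no-zero (v , Av , z)}})
      unbalanced : ∀ v → ¬ ¬ (A v ≡ true → Unbalanced G f D Pos v × Unbalanced G f D Neg v)
      unbalanced v k with A v in eq
      ... | false = k λ ()
      ... | true  = not-pos v eq λ p → not-neg v eq λ q → k λ _ → p , q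

  barrier : ∀ {N} n → BarrierBelow N n
  barrier zero    m G alive dead-f P ()
  barrier (suc n) = barrier-step (barrier n)

-- From a barrier to two vertex cuts.

module Certificates where

  open import Data.Bool.Base using (Bool; true; false; _∧_; _∨_; not)
  import Data.Bool.Properties as Bool
  open import Data.Fin.Base using (Fin; suc)
  open import Data.Fin.Properties using (_≟_; any?)
  open import Data.Nat.Base
  import Data.Nat.Properties as ℕ
  open import Data.Nat.Properties hiding (_≟_; suc-injective)
  open import Data.Nat.Solver using (module +-*-Solver)
  open import Data.Product.Base using (∃-syntax; _×_; _,_; proj₁; proj₂)
  open import Data.Sum.Base using (_⊎_; inj₁; inj₂)
  open import Function.Base using (_∘_; id)
  open import Relation.Binary.Construct.Closure.ReflexiveTransitive as Star using (Star; ε; _◅_)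
  open import Relation.Binary.PropositionalEquality
  open import Relation.Nullary using (¬_; yes; no; contradiction; Dec)
  open import Relation.Nullary.Decidable using (_×-dec_)
  open Sums
  open Integers
  open JumpSystems
  open Barriers
  open +-*-Solver using (solve; con; _:+_; _:*_; _:=_)

  isT isU : Part → Bool
  isT T = true
  isT _ = false
  isU U = true
  isU _ = false

  record RBarrier {N} (E : Rel N) (A : Fin N → Bool) (r : ℕ) : Set where
    field
      part      : Fin N → Part
      outside   : ∀ v → A v ≡ false → part v ≡ O
      inside    : ∀ v → A v ≡ true → part v ≢ O
      reps      : Fin N → Bool
      reps-U    : ∀ v → reps v ≡ true → part v ≡ U
      separated : ∀ u w → reps u ≡ true → reps w ≡ true → u ≢ w → ¬ Star (Linked E part) u w
      value     : 2 + r * count (isS ∘ part) + sum (λ v → ⟦ isT (part v) ⟧ * degOff E part v)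
                  ≤ count reps + r * count (isT ∘ part)

  -- Zero off the vertex set, as the barrier theorem demands of its target.
  constantly : ∀ {N} → (Fin N → Bool) → ℕ → Fin N → ℕ
  constantly A r v = ⟦ A v ⟧ * r

  rBarrier : ∀ {N} {E : Rel N} {A r} → Barrier E A (constantly A r) 2 → RBarrier E A r
  rBarrier {E = E} {A} {r} B = record
    { part = part ; outside = outside ; inside = inside ; reps = reps
    ; reps-U = reps-U ; separated = separated
    ; value = begin
        2 + r * count (isS ∘ part) + sum D
          ≡⟨ trans (+-assoc 2 (r * count (isS ∘ part)) (sum D)) (cong (λ m → 2 + (m + sum D)) (sym (∑-*ˡ r (λ v → ⟦ isS (part v) ⟧)))) ⟩
        2 + (sum (λ v → r * ⟦ isS (part v) ⟧) + sum D)
          ≡⟨ cong (2 +_) (∑-distrib-+ (λ v → r * ⟦ isS (part v) ⟧) D) ⟨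
        2 + sum (λ v → r * ⟦ isS (part v) ⟧ + D v)
          ≡⟨ cong (2 +_) (sum-cong-≗ λ v → costs v (part v) refl) ⟩
        2 + sum (λ v → cost (part v) (constantly A r v) (degOff E part v))
          ≤⟨ value ⟩
        count reps + sum (λ v → gain (part v) (constantly A r v))
          ≡⟨ cong (λ m → count reps + m) (trans (sum-cong-≗ λ v → gains v (part v) refl) (∑-*ˡ r (λ v → ⟦ isT (part v) ⟧))) ⟩
        count reps + r * count (isT ∘ part) ∎
    }
    where
    open ≤-Reasoning
    open Barrier B
    D : _ → ℕ
    D v = ⟦ isT (part v) ⟧ * degOff E part v
    constant : ∀ v → part v ≢ O → constantly A r v ≡ r
    constant v h with A v in eq
    ... | true  = *-identityˡ r
    ... | false = contradiction (outside v eq) h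
    costs : ∀ v X → X ≡ part v → r * ⟦ isS X ⟧ + ⟦ isT X ⟧ * degOff E part v ≡ cost X (constantly A r v) (degOff E part v)
    costs v S e = trans (+-identityʳ _) (trans (*-identityʳ r) (sym (constant v λ h → contradiction (trans e h) λ ())))
    costs v T e = cong₂ _+_ (*-zeroʳ r) (*-identityˡ _)
    costs v U e = trans (+-identityʳ _) (*-zeroʳ r)
    costs v O e = trans (+-identityʳ _) (*-zeroʳ r)
    gains : ∀ v X → X ≡ part v → gain X (constantly A r v) ≡ r * ⟦ isT X ⟧
    gains v T e = trans (constant v λ h → contradiction (trans e h) λ ()) (sym (*-identityʳ r))
    gains v S e = sym (*-zeroʳ r)
    gains v U e = sym (*-zeroʳ r)
    gains v O e = sym (*-zeroʳ r)

  degU : ∀ {N} → Rel N → (Fin N → Part) → Fin N → ℕ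
  degU E part v = count (λ u → E v u ∧ isU (part u))

  Tight : ∀ {N} → Rel N → (Fin N → Part) → ℕ → Fin N → Set
  Tight E part r v = part v ≡ T × degOff E part v ≡ r × degU E part v ≤ 1

  _≟T : ∀ X → Dec (X ≡ T)
  S ≟T = no λ ()
  T ≟T = yes refl
  U ≟T = no λ ()
  O ≟T = no λ ()

  isT-true : ∀ {X} → isT X ≡ true → X ≡ T
  isT-true {T} _ = refl

  count≤1 : ∀ {N} (P : Fin N → Bool) → count P ≤ 1 → ∀ {a b} → P a ≡ true → P b ≡ true → a ≡ b
  count≤1 P le {a} {b} pa pb = only-one (⟦_⟧ ∘ P) le a b
    (≤-reflexive (cong ⟦_⟧ (sym pa))) (≤-reflexive (cong ⟦_⟧ (sym pb)))

  -- A vertex of T that sends exactly r edges out of S, at most one of them to U,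
  -- may be moved to U: it hangs on to at most one component there.
  module _ {N} {E : Rel N} (G : IsGraph E) {A : Fin N → Bool} {r : ℕ} where

    open IsGraph G

    move : ∀ (B : RBarrier E A r) v → Tight E (RBarrier.part B) r v → RBarrier E A r
    move B v (Tv , dv , uv) = record
      { part = part′ ; outside = outside′ ; inside = inside′ ; reps = reps
      ; reps-U = λ p h → trans (set-≢ (rep≢v h)) (reps-U p h)
      ; separated = λ u w ru rw u≢w path → separated u w ru rw u≢w
          (subst₂ (Star (Linked E part)) (φ-≢ (rep≢v ru)) (φ-≢ (rep≢v rw)) (Star.kleisliStar φ link path))
      ; value = +-cancelʳ-≤ r _ _ (begin
          2 + r * count (isS ∘ part′) + sum (D part′) + r ≡⟨ +-assoc (2 + r * count (isS ∘ part′)) _ r ⟩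
          2 + r * count (isS ∘ part′) + (sum (D part′) + r) ≡⟨ cong₂ (λ a b → 2 + r * a + b) (sum-cong-≗ λ p → cong ⟦_⟧ (sameS p)) sumD ⟩
          2 + r * count (isS ∘ part) + sum (D part)    ≤⟨ value ⟩
          count reps + r * count (isT ∘ part)          ≡⟨ cong (λ m → count reps + m) (trans (cong (r *_) sumT) (*-suc r _)) ⟩
          count reps + (r + r * count (isT ∘ part′))   ≡⟨ trans (cong (λ m → count reps + m) (+-comm r _)) (sym (+-assoc (count reps) _ r)) ⟩
          count reps + r * count (isT ∘ part′) + r     ∎)
      }
      where
      open ≤-Reasoning
      open RBarrier B
      part′ : Fin N → Part
      part′ = set v U part
      D : (Fin N → Part) → Fin N → ℕ
      D part p = ⟦ isT (part p) ⟧ * degOff E part p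
      alive-v : ∀ {p} → A p ≡ false → p ≢ v
      alive-v h refl = contradiction (trans (sym Tv) (outside v h)) λ ()
      outside′ : ∀ p → A p ≡ false → part′ p ≡ O
      outside′ p h = trans (set-≢ (alive-v h)) (outside p h)
      inside′ : ∀ p → A p ≡ true → part′ p ≢ O
      inside′ p h with p ≟ v
      ... | yes _ = λ ()
      ... | no _  = inside p h
      rep≢v : ∀ {p} → reps p ≡ true → p ≢ v
      rep≢v h refl = contradiction (trans (sym Tv) (reps-U v h)) λ ()
      sameS : ∀ p → isS (part′ p) ≡ isS (part p)
      sameS p with p ≟ v
      ... | yes refl = cong isS (sym Tv)
      ... | no _     = refl
      same-deg : ∀ p → degOff E part′ p ≡ degOff E part p
      same-deg p = sum-cong-≗ λ u → cong (λ b → ⟦ E p u ∧ not b ⟧) (sameS u)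
      sumT : count (isT ∘ part) ≡ suc (count (isT ∘ part′))
      sumT = ∑-drop v (λ p p≢v → cong (⟦_⟧ ∘ isT) (sym (set-≢ p≢v)))
        (trans (cong (⟦_⟧ ∘ isT) Tv) (cong (λ X → suc ⟦ isT X ⟧) (sym (set-≡ v U part))))
      sumD : sum (D part′) + r ≡ sum (D part)
      sumD = trans (cong (λ m → sum (D part′) + m) (sym Dv)) (trans
        (∑-agree v λ p p≢v → cong₂ (λ X d → ⟦ isT X ⟧ * d) (set-≢ p≢v) (same-deg p))
        (trans (cong (λ X → sum (D part) + ⟦ isT X ⟧ * degOff E part′ v) (set-≡ v U part)) (+-identityʳ _)))
        where
        Dv : D part v ≡ r
        Dv = trans (cong (λ X → ⟦ isT X ⟧ * degOff E part v) Tv) (trans (*-identityˡ _) dv)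
      -- The only neighbour of `v` in U, or `v` itself if there is none. Sending `v` there turns
      -- walks through `v` into walks that avoid it.
      anchor : Fin N
      anchor with any? (λ u → (E v u ∧ isU (part u)) Bool.≟ true)
      ... | yes (u , _) = u
      ... | no _        = v
      anchored : ∀ {q} → E v q ≡ true → part q ≡ U → anchor ≡ q
      anchored {q} e Uq with any? (λ u → (E v u ∧ isU (part u)) Bool.≟ true)
      ... | yes (u , h) = count≤1 _ uv h (cong₂ (λ b X → b ∧ isU X) e Uq)
      ... | no none     = contradiction (q , cong₂ (λ b X → b ∧ isU X) e Uq) none
      φ : Fin N → Fin N
      φ = set v anchor id
      φ-≢ : ∀ {p} → p ≢ v → φ p ≡ p
      φ-≢ p≢v = set-≢ p≢v
      link : ∀ {p q} → Linked E part′ p q → Star (Linked E part) (φ p) (φ q)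
      link {p} {q} (e , Up , Uq) with p ≟ v | q ≟ v
      ... | yes refl | yes refl = contradiction (irrfl v) (true≢false e)
      ... | yes refl | no _     = subst (λ a → Star (Linked E part) a q) (sym (anchored e Uq)) ε
      ... | no _     | yes refl = subst (λ a → Star (Linked E part) p a) (sym (anchored (trans (symm v p) e) Up)) ε
      ... | no _     | no _     = (e , Up , Uq) ◅ ε

    -- No vertex can be moved to U any more; the two neighbours pay for the picks of degree `r`.
    Loose : RBarrier E A r → Set
    Loose B = ∀ v → RBarrier.part B v ≡ T → degOff E (RBarrier.part B) v ≡ r → 2 ≤ degU E (RBarrier.part B) v

    loosen : ∀ n (B : RBarrier E A r) → count (isT ∘ RBarrier.part B) < n → ∃[ B ] Loose B
    loosen (suc n) B (s≤s lt)
      with any? (λ v → (RBarrier.part B v ≟T) ×-dec (degOff E (RBarrier.part B) v ℕ.≟ r) ×-dec (degU E (RBarrier.part B) v ≤? 1))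
    ... | no none = B , λ v t d → ≰⇒> (λ u → none (v , t , d , u))
    ... | yes (v , tight@(Tv , _)) = loosen n (move B v tight) (≤-trans (≤-reflexive (sym fewer)) lt)
      where
      fewer : count (isT ∘ RBarrier.part B) ≡ suc (count (isT ∘ set v U (RBarrier.part B)))
      fewer = ∑-drop v (λ p p≢v → cong (⟦_⟧ ∘ isT) (sym (set-≢ p≢v)))
        (trans (cong (⟦_⟧ ∘ isT) Tv) (cong (λ X → suc ⟦ isT X ⟧) (sym (set-≡ v U (RBarrier.part B)))))

  -- Greedy choice of independent vertices in T.

  ⟦∧⟧ : ∀ a b → ⟦ a ∧ b ⟧ + ⟦ a ∧ not b ⟧ ≡ ⟦ a ⟧
  ⟦∧⟧ true  true  = refl
  ⟦∧⟧ true  false = refl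
  ⟦∧⟧ false _     = refl

  module Greedy {N} {E : Rel N} (G : IsGraph E) {A : Fin N → Bool} (alive : Alive E A) {r : ℕ}
    (B : RBarrier E A r) where

    open IsGraph G
    open RBarrier B

    d : Fin N → ℕ
    d = degOff E part

    -- `W` contains the neighbours of `I` off S, so `disjoint` makes `I` independent.
    record State : Set where
      field
        I W      : Fin N → Bool
        I-T      : ∀ v → I v ≡ true → part v ≡ T
        W-out    : ∀ v → W v ≡ true → part v ≡ T ⊎ part v ≡ U
        disjoint : ∀ v → I v ≡ true → W v ≡ false
        closed   : ∀ v u → I v ≡ true → E v u ≡ true → isS (part u) ≡ false → W u ≡ true

      done : Fin N → Bool
      done v = isT (part v) ∧ (I v ∨ W v)

      rest : Fin N → Bool
      rest v = isT (part v) ∧ not (I v ∨ W v)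

      rest+done : count done + count rest ≡ count (isT ∘ part)
      rest+done = trans (sym (∑-distrib-+ (⟦_⟧ ∘ done) (⟦_⟧ ∘ rest)))
        (sum-cong-≗ λ v → ⟦∧⟧ (isT (part v)) (I v ∨ W v))

      WU : Fin N → Bool
      WU v = W v ∧ isU (part v)

      -- `I` lies in T, and the disjoint set `W` is split between T and U.
      W-split : count W + count I ≡ count done + count WU
      W-split = trans (sym (∑-distrib-+ (⟦_⟧ ∘ W) (⟦_⟧ ∘ I))) (trans
        (sum-cong-≗ λ v → entry v (part v) refl (I v) refl (W v) refl) (∑-distrib-+ (⟦_⟧ ∘ done) (⟦_⟧ ∘ WU)))
        where
        entry : ∀ v X → part v ≡ X → ∀ i → I v ≡ i → ∀ w → W v ≡ w →
                ⟦ w ⟧ + ⟦ i ⟧ ≡ ⟦ isT X ∧ (i ∨ w) ⟧ + ⟦ w ∧ isU X ⟧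
        entry v X e true ei true ew = contradiction (disjoint v ei) (true≢false ew)
        entry v X e true ei false ew with trans (sym e) (I-T v ei)
        ... | refl = refl
        entry v X e false ei true ew with W-out v ew
        ... | inj₁ t with trans (sym e) t
        ...   | refl = refl
        entry v X e false ei true ew | inj₂ u with trans (sym e) u
        ...   | refl = refl
        entry v T e false ei false ew = refl
        entry v S e false ei false ew = refl
        entry v U e false ei false ew = refl
        entry v O e false ei false ew = refl

    open State

    start : State
    start = record
      { I = λ _ → false ; W = λ _ → false ; I-T = λ _ () ; W-out = λ _ () ; disjoint = λ _ () ; closed = λ _ _ () }

    module Pick (st : State) {v : Fin N} (pick : rest st v ≡ true) where

      private
        Tv : part v ≡ T
        Tv = isT-true (proj₁ (∧-true pick))

        not-or : ∀ {a b} → not (a ∨ b) ≡ true → a ≡ false × b ≡ false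
        not-or {false} {false} _ = refl , refl

        Iv : I st v ≡ false
        Iv = proj₁ (not-or (proj₂ (∧-true {isT (part v)} pick)))

        Wv : W st v ≡ false
        Wv = proj₂ (not-or (proj₂ (∧-true {isT (part v)} pick)))

      new : Fin N → Bool
      new u = (E v u ∧ not (isS (part u))) ∧ not (W st u)

      newT newU : Fin N → Bool
      newT u = new u ∧ isT (part u)
      newU u = new u ∧ isU (part u)

      private
        not-true : ∀ {b} → not b ≡ true → b ≡ false
        not-true {false} _ = refl

        new-true : ∀ {u} → new u ≡ true → E v u ≡ true × isS (part u) ≡ false × W st u ≡ false
        new-true {u} h = let (p , w) = ∧-true {E v u ∧ not (isS (part u))} h ; (e , s) = ∧-true {E v u} p in
          e , not-true s , not-true w

        new-I : ∀ {u} → new u ≡ true → I st u ≡ false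
        new-I {u} h with I st u in eq
        ... | false = refl
        ... | true  = contradiction Wv (true≢false (closed st u v eq
                        (trans (symm u v) (proj₁ (new-true h))) (cong isS Tv)))

        T-or-U : ∀ {X} → isS X ≡ false → X ≢ O → X ≡ T ⊎ X ≡ U
        T-or-U {T} _ _ = inj₁ refl
        T-or-U {U} _ _ = inj₂ refl
        T-or-U {O} _ h = contradiction refl h

        new-out : ∀ {u} → new u ≡ true → part u ≡ T ⊎ part u ≡ U
        new-out {u} h = let (e , s , _) = new-true h in
          T-or-U s (inside u (alive u v (trans (symm u v) e)))

        new-v : new v ≡ false
        new-v = cong (λ b → (b ∧ not (isS (part v))) ∧ not (W st v)) (irrfl v)

        or-false : ∀ {a b} → a ∨ b ≡ true → a ≡ true ⊎ b ≡ true
        or-false {true} _ = inj₁ refl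
        or-false {false} h = inj₂ h

        set-true : ∀ u → set v true (I st) u ≡ true → u ≡ v ⊎ I st u ≡ true
        set-true u h with u ≟ v
        ... | yes e = inj₁ e
        ... | no _  = inj₂ h

      next : State
      next = record
        { I = set v true (I st)
        ; W = λ u → W st u ∨ new u
        ; I-T = λ u h → I-T′ u (set-true u h)
        ; W-out = λ u h → W-out′ u (or-false h)
        ; disjoint = λ u h → disjoint′ u (set-true u h)
        ; closed = λ u w h → closed′ u w (set-true u h)
        }
        where
        I-T′ : ∀ u → u ≡ v ⊎ I st u ≡ true → part u ≡ T
        I-T′ u (inj₁ refl) = Tv
        I-T′ u (inj₂ h)    = I-T st u h
        W-out′ : ∀ u → W st u ≡ true ⊎ new u ≡ true → part u ≡ T ⊎ part u ≡ U
        W-out′ u (inj₁ h) = W-out st u h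
        W-out′ u (inj₂ h) = new-out h
        disjoint′ : ∀ u → u ≡ v ⊎ I st u ≡ true → W st u ∨ new u ≡ false
        disjoint′ u (inj₁ refl) = cong₂ _∨_ Wv new-v
        disjoint′ u (inj₂ h) with new u in eq
        ... | false = cong (_∨ false) (disjoint st u h)
        ... | true  = contradiction (new-I eq) (true≢false h)
        closed′ : ∀ u w → u ≡ v ⊎ I st u ≡ true → E u w ≡ true → isS (part w) ≡ false → W st w ∨ new w ≡ true
        closed′ u w (inj₁ refl) e s rewrite e | s with W st w
        ... | true  = refl
        ... | false = refl
        closed′ u w (inj₂ h) e s = cong (_∨ new w) (closed st u w h e s)

      count-I : count (I next) ≡ suc (count (I st))
      count-I = sym (trans (+-comm 1 _) (trans
        (cong (λ b → count (I st) + ⟦ b ⟧) (sym (set-≡ v true (I st))))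
        (trans (∑-agree v λ u u≢v → cong ⟦_⟧ (sym (set-≢ u≢v)))
          (trans (cong (λ b → count (I next) + ⟦ b ⟧) Iv) (+-identityʳ _)))))

      private
        ⟦∨⟧ : ∀ a b → (b ≡ true → a ≡ false) → ⟦ a ∨ b ⟧ ≡ ⟦ a ⟧ + ⟦ b ⟧
        ⟦∨⟧ true  true  h = contradiction (h refl) λ ()
        ⟦∨⟧ true  false h = refl
        ⟦∨⟧ false _     h = refl

      count-W : count (W next) ≡ count (W st) + count new
      count-W = trans (sum-cong-≗ λ u → ⟦∨⟧ (W st u) (new u) (λ h → proj₂ (proj₂ (new-true h))))
        (∑-distrib-+ (⟦_⟧ ∘ W st) (⟦_⟧ ∘ new))

      count-WU : count (WU next) ≡ count (WU st) + count newU
      count-WU = trans (sum-cong-≗ λ u → entry (W st u) (new u) (isU (part u)) (λ h → proj₂ (proj₂ (new-true h))))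
        (∑-distrib-+ (⟦_⟧ ∘ WU st) (⟦_⟧ ∘ newU))
        where
        entry : ∀ a b c → (b ≡ true → a ≡ false) → ⟦ (a ∨ b) ∧ c ⟧ ≡ ⟦ a ∧ c ⟧ + ⟦ b ∧ c ⟧
        entry true  true  c h = contradiction (h refl) λ ()
        entry true  false c h = sym (+-identityʳ _)
        entry false _     c h = refl

      done-next : ∀ u → ⟦ done next u ⟧ ≡ ⟦ done st u ⟧ + (δ v u + ⟦ newT u ⟧)
      done-next u with v ≟ u
      ... | yes refl = trans (cong₂ (λ X b → ⟦ isT X ∧ (b ∨ W next v) ⟧) Tv (set-≡ v true (I st)))
          (sym (cong₂ _+_ (trans (cong₂ (λ a b → ⟦ isT (part v) ∧ (a ∨ b) ⟧) Iv Wv) (cong ⟦_⟧ (Bool.∧-zeroʳ _)))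
            (cong (λ b → 1 + ⟦ b ∧ isT (part v) ⟧) new-v)))
      ... | no v≢u = trans (cong (λ b → ⟦ isT (part u) ∧ (b ∨ W next u) ⟧) (set-≢ {g = I st} (v≢u ∘ sym)))
          (entry (isT (part u)) (I st u) (W st u) (new u) new-I (λ h → proj₂ (proj₂ (new-true h))))
        where
        entry : ∀ t i w n → (n ≡ true → i ≡ false) → (n ≡ true → w ≡ false) →
                ⟦ t ∧ (i ∨ (w ∨ n)) ⟧ ≡ ⟦ t ∧ (i ∨ w) ⟧ + ⟦ n ∧ t ⟧
        entry t i w true h k rewrite h refl | k refl | Bool.∧-zeroʳ t | Bool.∧-identityʳ t = refl
        entry t i w false _ _ rewrite Bool.∨-identityʳ w = sym (+-identityʳ _)

      added : Fin N → ℕ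
      added u = δ v u + ⟦ newT u ⟧

      count-done : count (done next) ≡ count (done st) + sum added
      count-done = trans (sum-cong-≗ done-next) (∑-distrib-+ (⟦_⟧ ∘ done st) added)

      -- New vertices lie in T or in U; the extra unit is `v` itself.
      added+U : sum added + count newU ≡ suc (count new)
      added+U = trans (cong (_+ count newU) (trans (∑-distrib-+ (δ v) (⟦_⟧ ∘ newT)) (cong (_+ count newT) (∑-δ v))))
        (cong suc (trans (sym (∑-distrib-+ (⟦_⟧ ∘ newT) (⟦_⟧ ∘ newU))) (sum-cong-≗ entry)))
        where
        entry : ∀ u → ⟦ newT u ⟧ + ⟦ newU u ⟧ ≡ ⟦ new u ⟧
        entry u with new u in eq
        ... | false = refl
        ... | true with new-out eq
        ...   | inj₁ t rewrite t = refl
        ...   | inj₂ t rewrite t = refl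

      added-rest : ∀ u → added u ≤ ⟦ rest st u ⟧
      added-rest u with v ≟ u
      ... | yes refl = ≤-reflexive (trans (cong (λ b → 1 + ⟦ b ∧ isT (part v) ⟧) new-v) (cong ⟦_⟧ (sym pick)))
      ... | no _ with new u in eq
      ...   | false = z≤n
      ...   | true  = ≤-reflexive (cong ⟦_⟧ (trans (sym (Bool.∧-identityʳ _))
                        (sym (cong₂ (λ a b → isT (part u) ∧ not (a ∨ b)) (new-I eq) (proj₂ (proj₂ (new-true eq)))))))

      count-new : count new ≤ d v
      count-new = ∑-mono-≤ λ u → entry (E v u ∧ not (isS (part u))) (not (W st u))
        where
        entry : ∀ a b → ⟦ a ∧ b ⟧ ≤ ⟦ a ⟧
        entry true  true  = ≤-refl
        entry true  false = z≤n
        entry false _     = z≤n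

      count-rest : count (rest next) < count (rest st)
      count-rest = +-cancelˡ-< (count (done st)) _ _ (begin-strict
        count (done st) + count (rest next)     <⟨ +-monoˡ-< _ more ⟩
        count (done next) + count (rest next)   ≡⟨ trans (rest+done next) (sym (rest+done st)) ⟩
        count (done st) + count (rest st)       ∎)
        where
        open ≤-Reasoning
        more : count (done st) < count (done next)
        more = subst (count (done st) <_) (sym count-done) (m<m+n _ (begin-strict
          0 <⟨ s≤s z≤n ⟩
          suc (count newT) ≡⟨ cong (_+ count newT) (∑-δ v) ⟨
          sum (δ v) + count newT ≡⟨ ∑-distrib-+ (δ v) (⟦_⟧ ∘ newT) ⟨
          sum added ∎))

    argmin : ∀ n (P : Fin N → Bool) v → P v ≡ true → d v < n →
             ∃[ v ] P v ≡ true × (∀ u → P u ≡ true → d v ≤ d u)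
    argmin (suc n) P v Pv (s≤s lt) with any? (λ u → (P u Bool.≟ true) ×-dec (d u <? d v))
    ... | yes (u , Pu , du<dv) = argmin n P u Pu (≤-trans du<dv lt)
    ... | no none = v , Pv , λ u Pu → ≮⇒≥ λ lt → none (u , Pu , lt)

    private
      -- Since r - dv is at least one, `c` may be replaced by (r - dv) c, which makes `k + c`, that
      -- is `m + 1`, appear. With `m ≤ dv` this is a polynomial inequality in `dv` and e = r - dv -
      -- 1, with slack (1 + e) e.
      pick-low : ∀ {r k c m dv} → k + c ≡ suc m → m ≤ dv → dv < r → r * k + c + r * m ≤ r * r + k * dv
      pick-low {r} {k} {c} {m} {dv} kc m≤ dv<r = subst (λ r → r * k + c + r * m ≤ r * r + k * dv) r≡ (begin
          r′ * k + c + r′ * m                 ≤⟨ +-monoˡ-≤ (r′ * m) (+-monoʳ-≤ (r′ * k) (m≤m+n c (e * c))) ⟩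
          r′ * k + (c + e * c) + r′ * m       ≡⟨ solve 5 (λ k c m dv e →
                (con 1 :+ dv :+ e) :* k :+ (c :+ e :* c) :+ (con 1 :+ dv :+ e) :* m :=
                k :* dv :+ (con 1 :+ e) :* (k :+ c) :+ (con 1 :+ dv :+ e) :* m) refl k c m dv e ⟩
          k * dv + (1 + e) * (k + c) + r′ * m ≡⟨ cong (λ z → k * dv + (1 + e) * z + r′ * m) kc ⟩
          k * dv + (1 + e) * suc m + r′ * m   ≤⟨ +-mono-≤ (+-monoʳ-≤ (k * dv) (*-monoʳ-≤ (1 + e) (s≤s m≤))) (*-monoʳ-≤ r′ m≤) ⟩
          k * dv + (1 + e) * suc dv + r′ * dv ≤⟨ m≤m+n _ ((1 + e) * e) ⟩
          k * dv + (1 + e) * suc dv + r′ * dv + (1 + e) * e ≡⟨ solve 3 (λ k dv e →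
                k :* dv :+ (con 1 :+ e) :* (con 1 :+ dv) :+ (con 1 :+ dv :+ e) :* dv :+ (con 1 :+ e) :* e :=
                (con 1 :+ dv :+ e) :* (con 1 :+ dv :+ e) :+ k :* dv) refl k dv e ⟩
          r′ * r′ + k * dv                    ∎)
        where
        open ≤-Reasoning
        e = r ∸ suc dv
        r′ = suc dv + e
        r≡ : r′ ≡ r
        r≡ = m+[n∸m]≡n dv<r

      -- For `m` below `r` the difference of `r * r` and `r * m` is at least `r`, hence at least
      -- two, which is enough. For `m` equal to `r` it vanishes, and the two units come from `c`.
      pick-tight : ∀ {r k c m} → k + c ≡ suc m → m ≤ r → 2 ≤ r → (m ≡ r → 2 ≤ c) →
                   suc (k + r * m) ≤ m + r * r
      pick-tight {r} {k} {c} {m} kc m≤r 2≤r full with m ℕ.≟ r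
      ... | yes refl = +-monoˡ-≤ (m * m) (≤-pred (begin
          2 + k  ≤⟨ +-monoˡ-≤ k (full refl) ⟩
          c + k  ≡⟨ trans (+-comm c k) kc ⟩
          suc m  ∎))
        where open ≤-Reasoning
      ... | no m≢r = begin
          suc (k + r * m)        ≤⟨ s≤s (+-monoˡ-≤ (r * m) (≤-trans (m≤m+n k c) (≤-reflexive kc))) ⟩
          2 + m + r * m          ≤⟨ +-monoˡ-≤ (r * m) (+-monoˡ-≤ m 2≤r) ⟩
          r + m + r * m          ≡⟨ trans (cong (_+ r * m) (+-comm r m)) (+-assoc m r _) ⟩
          m + (r + r * m)        ≡⟨ cong (λ z → m + z) (*-suc r m) ⟨
          m + r * suc m          ≤⟨ +-monoʳ-≤ m (*-monoʳ-≤ r (≤∧≢⇒< m≤r m≢r)) ⟩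
          m + r * r              ∎
        where open ≤-Reasoning

    weight : (Fin N → ℕ) → ℕ
    weight g = sum (λ v → g v * d v)

    -- Free of subtraction: the shortfalls r - d summed over `done`, plus the size of `WU`, plus `r`
    -- times that of `W`, amount to at most `r * r` per pick.
    LowBound : State → Set
    LowBound st = r * count (done st) + count (WU st) + r * count (W st) ≤
                  r * r * count (I st) + weight (⟦_⟧ ∘ done st)

    low-start : LowBound start
    low-start = ≤-trans (≤-reflexive (cong₂ _+_ (cong₂ _+_
        (trans (cong (r *_) (trans (sum-cong-≗ λ v → cong ⟦_⟧ (Bool.∧-zeroʳ (isT (part v)))) (∑-zero N))) (*-zeroʳ r))
        (∑-zero N)) (trans (cong (r *_) (∑-zero N)) (*-zeroʳ r)))) z≤n

    -- Minimality of `d v` enters through the weight: all vertices that become done come from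
    -- `rest`, so each has degree at least `d v`.
    low-next : ∀ st {v} (pick : rest st v ≡ true) → d v < r →
               (∀ u → rest st u ≡ true → d v ≤ d u) → LowBound st → LowBound (Pick.next st pick)
    low-next st {v} pick dv<r least bound = begin
        r * count (done next) + count (WU next) + r * count (W next)
          ≡⟨ cong₂ _+_ (cong₂ (λ a b → r * a + b) count-done count-WU) (cong (r *_) count-W) ⟩
        r * (cd + k) + (cu + c) + r * (cw + m)
          ≡⟨ solve 7 (λ r cd k cu c cw m → r :* (cd :+ k) :+ (cu :+ c) :+ r :* (cw :+ m) :=
                (r :* cd :+ cu :+ r :* cw) :+ (r :* k :+ c :+ r :* m)) refl r cd k cu c cw m ⟩
        (r * cd + cu + r * cw) + (r * k + c + r * m)
          ≤⟨ +-mono-≤ bound (pick-low {k = k} added+U count-new dv<r) ⟩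
        (r * r * i + weight (⟦_⟧ ∘ done st)) + (r * r + k * d v)
          ≤⟨ +-monoʳ-≤ (r * r * i + weight (⟦_⟧ ∘ done st)) (+-monoʳ-≤ (r * r) heavy) ⟩
        (r * r * i + weight (⟦_⟧ ∘ done st)) + (r * r + weight added)
          ≡⟨ solve 4 (λ s i a b → (s :* i :+ a) :+ (s :+ b) :=
                s :* (con 1 :+ i) :+ (a :+ b)) refl (r * r) i (weight (⟦_⟧ ∘ done st)) (weight added) ⟩
        r * r * suc i + (weight (⟦_⟧ ∘ done st) + weight added)
          ≡⟨ cong₂ (λ a b → r * r * a + b) (sym count-I) (sym weight-next) ⟩
        r * r * count (I next) + weight (⟦_⟧ ∘ done next) ∎
      where
      open ≤-Reasoning
      open Pick st pick
      cd = count (done st)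
      cu = count (WU st)
      cw = count (W st)
      i = count (I st)
      k = sum added
      c = count newU
      m = count new
      weight-next : weight (⟦_⟧ ∘ done next) ≡ weight (⟦_⟧ ∘ done st) + weight added
      weight-next = trans (sum-cong-≗ λ u → trans (cong (_* d u) (done-next u)) (*-distribʳ-+ (d u) ⟦ done st u ⟧ (added u)))
        (∑-distrib-+ (λ u → ⟦ done st u ⟧ * d u) (λ u → added u * d u))
      heavy : k * d v ≤ weight added
      heavy = begin
        k * d v                   ≡⟨ *-comm k (d v) ⟩
        d v * k                   ≡⟨ ∑-*ˡ (d v) added ⟨
        sum (λ u → d v * added u) ≤⟨ ∑-mono-≤ (λ u → by u (rest st u) refl) ⟩
        weight added              ∎
        where
        by : ∀ u b → rest st u ≡ b → d v * added u ≤ added u * d u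
        by u true e  = ≤-trans (≤-reflexive (*-comm (d v) (added u))) (*-monoʳ-≤ (added u) (least u e))
        by u false e = ≤-trans (≤-reflexive (trans (cong (d v *_) (n≤0⇒n≡0 (subst (λ b → added u ≤ ⟦ b ⟧) e (added-rest u)))) (*-zeroʳ (d v)))) z≤n

    phase₁ : ∀ n st → count (rest st) < n → LowBound st →
             ∃[ st ] LowBound st × (∀ v → rest st v ≡ true → r ≤ d v)
    phase₁ (suc n) st (s≤s lt) bound with any? (λ v → rest st v Bool.≟ true)
    ... | no none = st , bound , λ v h → contradiction (v , h) none
    ... | yes (v , h) = continue (argmin (suc (d v)) (rest st) v h ≤-refl)
      where
      continue : ∃[ v ] rest st v ≡ true × (∀ u → rest st u ≡ true → d v ≤ d u) →
                 ∃[ st ] LowBound st × (∀ v → rest st v ≡ true → r ≤ d v)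
      continue (v , h , least) with d v <? r
      ... | yes dv<r = phase₁ n (Pick.next st h) (≤-trans (Pick.count-rest st h) lt) (low-next st h dv<r least bound)
      ... | no dv≮r  = st , bound , λ u hu → ≤-trans (≮⇒≥ dv≮r) (least u hu)

    -- Progress made from st₁ by picking vertices with d v ≡ r only.
    record Phase₂ (st₁ st : State) : Set where
      field
        j k m  : ℕ
        I-≡    : count (I st) ≡ count (I st₁) + j
        done-≡ : count (done st) ≡ count (done st₁) + k
        W-≡    : count (W st) ≡ count (W st₁) + m
        -- With a = p / q, `bound₁` is later used with weight a and `bound₂` with weight 1 - a.
        bound₁ : j + k + r * m ≤ m + r * r * j
        bound₂ : r * m ≤ r * r * j
        mono   : ∀ v → ⟦ done st₁ v ⟧ ≤ ⟦ done st v ⟧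

    phase₂-start : ∀ st → Phase₂ st st
    phase₂-start st = record
      { j = 0 ; k = 0 ; m = 0 ; I-≡ = sym (+-identityʳ _) ; done-≡ = sym (+-identityʳ _)
      ; W-≡ = sym (+-identityʳ _) ; bound₁ = ≤-trans (≤-reflexive (*-zeroʳ r)) z≤n
      ; bound₂ = ≤-trans (≤-reflexive (*-zeroʳ r)) z≤n ; mono = λ _ → ≤-refl }

    -- The two neighbours in U give `2 ≤ r`. If all `r` neighbours of `v` off S are new, these two
    -- are new as well, which is what `pick-tight` asks for.
    phase₂-next : ∀ {st₁} st {v} (pick : rest st v ≡ true) → d v ≡ r → 2 ≤ degU E part v →
                  Phase₂ st₁ st → Phase₂ st₁ (Pick.next st pick)
    phase₂-next {st₁} st {v} pick dv≡r twoU p = record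
      { j = suc j ; k = k + sum added ; m = m + count new
      ; I-≡ = trans count-I (trans (cong suc I-≡) (sym (+-suc _ j)))
      ; done-≡ = trans count-done (trans (cong (_+ sum added) done-≡) (+-assoc (count (done st₁)) k (sum added)))
      ; W-≡ = trans count-W (trans (cong (_+ count new) W-≡) (+-assoc (count (W st₁)) m (count new)))
      ; bound₁ = begin
          suc j + (k + k′) + r * (m + m′)             ≡⟨ solve 6 (λ j k k′ m m′ r →
                con 1 :+ j :+ (k :+ k′) :+ r :* (m :+ m′) :=
                (j :+ k :+ r :* m) :+ (con 1 :+ (k′ :+ r :* m′))) refl j k k′ m m′ r ⟩
          (j + k + r * m) + suc (k′ + r * m′)         ≤⟨ +-mono-≤ bound₁ (pick-tight {k = k′} added+U m′≤r 2≤r full) ⟩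
          (m + r * r * j) + (m′ + r * r)              ≡⟨ solve 4 (λ j m m′ s →
                (m :+ s :* j) :+ (m′ :+ s) :=
                m :+ m′ :+ s :* (con 1 :+ j)) refl j m m′ (r * r) ⟩
          m + m′ + r * r * suc j                      ∎
      ; bound₂ = begin
          r * (m + m′)          ≡⟨ *-distribˡ-+ r m m′ ⟩
          r * m + r * m′        ≤⟨ +-mono-≤ bound₂ (*-monoʳ-≤ r m′≤r) ⟩
          r * r * j + r * r     ≡⟨ trans (+-comm _ (r * r)) (sym (*-suc (r * r) j)) ⟩
          r * r * suc j         ∎
      ; mono = λ u → ≤-trans (mono u) (≤-trans (m≤m+n _ (added u)) (≤-reflexive (sym (done-next u))))
      }
      where
      open ≤-Reasoning
      open Pick st pick
      open Phase₂ p
      k′ = sum added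
      m′ = count new
      m′≤r : m′ ≤ r
      m′≤r = subst (m′ ≤_) dv≡r count-new
      2≤r : 2 ≤ r
      2≤r = ≤-trans twoU (≤-trans (∑-mono-≤ λ u → entry (E v u) (part u)) (≤-reflexive dv≡r))
        where
        entry : ∀ a X → ⟦ a ∧ isU X ⟧ ≤ ⟦ a ∧ not (isS X) ⟧
        entry a U = ≤-refl
        entry a S = ≤-refl
        entry a T = ≤-trans (≤-reflexive (cong ⟦_⟧ (Bool.∧-zeroʳ a))) z≤n
        entry a O = ≤-trans (≤-reflexive (cong ⟦_⟧ (Bool.∧-zeroʳ a))) z≤n
      full : m′ ≡ r → 2 ≤ count newU
      full m′≡r = ≤-trans twoU (∑-mono-≤ λ u → entry u)
        where
        below : ∀ u → ⟦ new u ⟧ ≤ ⟦ E v u ∧ not (isS (part u)) ⟧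
        below u with E v u ∧ not (isS (part u)) | W st u
        ... | true  | true  = z≤n
        ... | true  | false = ≤-refl
        ... | false | _     = z≤n
        all-new : ∀ u → ⟦ E v u ∧ not (isS (part u)) ⟧ ≤ ⟦ new u ⟧
        all-new u = ≮⇒≥ λ lt → <⇒≢ (∑-mono-< below u lt) (trans m′≡r (sym dv≡r))
        entry : ∀ u → ⟦ E v u ∧ isU (part u) ⟧ ≤ ⟦ newU u ⟧
        entry u with all-new u
        ... | h with E v u | part u | W st u
        ...   | false | _ | _     = z≤n
        ...   | true  | U | false = ≤-refl
        ...   | true  | U | true  = h
        ...   | true  | S | _     = z≤n
        ...   | true  | T | _     = z≤n
        ...   | true  | O | _     = z≤n

    phase₂ : Loose G B → ∀ n st₁ st → count (rest st) < n → Phase₂ st₁ st →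
             ∃[ st ] Phase₂ st₁ st × (∀ v → rest st v ≡ true → d v ≢ r)
    phase₂ loose (suc n) st₁ st (s≤s lt) p with any? (λ v → (rest st v Bool.≟ true) ×-dec (d v ℕ.≟ r))
    ... | no none = st , p , λ v h e → none (v , h , e)
    ... | yes (v , h , e) = phase₂ loose n st₁ (Pick.next st h) (≤-trans (Pick.count-rest st h) lt)
          (phase₂-next st h e (loose v (isT-true (proj₁ (∧-true h))) e) p)

  -- With a = p / q: adding q² times the first inequality, q (r q - p) times the
  -- second, p q times the third and (q - p) q times the fourth.
  weigh : ∀ r′ p b {s i j M₁ M₂ k₂ k₃ w y} → let r = suc r′ ; q = p + b in
          2 + r * s + k₃ + r * M₁ + i ≤ w + r * r * i →
          y ≤ s + M₁ + M₂ →
          j + k₂ + r * M₂ ≤ M₂ + r * r * j →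
          r * M₂ ≤ r * r * j →
          (r * q + p) * (i + j) ≤ q * y →
          q * (p * (s + k₃ + k₂ + M₁) + 2 * q) ≤ q * (q * w)
  weigh r′ p b {s} {i} {j} {M₁} {M₂} {k₂} {k₃} {w} {y} h₁ hy h₃ h₄ hA =
    +-cancelʳ-≤ Z _ _ (begin
      q * (p * (s + k₃ + k₂ + M₁) + 2 * q) + Z
        -- The added terms are the exact slack of the weighted sum; each has the factor `b`, so they
        -- vanish at a = 1.
        ≤⟨ m≤m+n _ (b * (q + p) * i + q * b * k₃ + p * b * j) ⟩
      q * (p * (s + k₃ + k₂ + M₁) + 2 * q) + Z + (b * (q + p) * i + q * b * k₃ + p * b * j)
        ≡⟨ identity r′ p b s i j M₁ M₂ k₂ k₃ ⟩
      q * q * (2 + r * s + k₃ + r * M₁ + i) + (r′ * q + b) * ((r * q + p) * (i + j))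
        + q * p * (j + k₂ + r * M₂) + q * b * (r * M₂)
        ≤⟨ +-mono-≤ (+-mono-≤ (+-mono-≤ (*-monoʳ-≤ (q * q) h₁)
             (*-monoʳ-≤ (r′ * q + b) (≤-trans hA (*-monoʳ-≤ q hy)))) (*-monoʳ-≤ (q * p) h₃)) (*-monoʳ-≤ (q * b) h₄) ⟩
      q * q * (w + r * r * i) + (r′ * q + b) * (q * (s + M₁ + M₂))
        + q * p * (M₂ + r * r * j) + q * b * (r * r * j)
        ≡⟨ regroup q p b (r * r) w i j M₂ ((r′ * q + b) * (q * (s + M₁ + M₂))) ⟩
      q * (q * w) + Z ∎)
    where
    open ≤-Reasoning
    r = suc r′
    q = p + b
    Z = q * q * (r * r * i) + (r′ * q + b) * (q * (s + M₁ + M₂)) + q * p * (M₂ + r * r * j) + q * b * (r * r * j)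
    regroup : ∀ q p b rr w i j M₂ c →
      q * q * (w + rr * i) + c + q * p * (M₂ + rr * j) + q * b * (rr * j) ≡
      q * (q * w) + (q * q * (rr * i) + c + q * p * (M₂ + rr * j) + q * b * (rr * j))
    regroup = solve 9 (λ q p b rr w i j M₂ c →
      q :* q :* (w :+ rr :* i) :+ c :+ q :* p :* (M₂ :+ rr :* j) :+ q :* b :* (rr :* j) :=
      q :* (q :* w) :+ (q :* q :* (rr :* i) :+ c :+ q :* p :* (M₂ :+ rr :* j) :+ q :* b :* (rr :* j))) refl
    identity : ∀ r′ p b s i j M₁ M₂ k₂ k₃ → let r = 1 + r′ ; q = p + b in
      q * (p * (s + k₃ + k₂ + M₁) + 2 * q) +
        (q * q * (r * r * i) + (r′ * q + b) * (q * (s + M₁ + M₂)) + q * p * (M₂ + r * r * j) + q * b * (r * r * j)) +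
        (b * (q + p) * i + q * b * k₃ + p * b * j) ≡
      q * q * (2 + r * s + k₃ + r * M₁ + i) + (r′ * q + b) * ((r * q + p) * (i + j))
        + q * p * (j + k₂ + r * M₂) + q * b * (r * M₂)
    identity = solve 10 (λ r′ p b s i j M₁ M₂ k₂ k₃ → let r = con 1 :+ r′ ; q = p :+ b in
      q :* (p :* (s :+ k₃ :+ k₂ :+ M₁) :+ con 2 :* q) :+
        (q :* q :* (r :* r :* i) :+ (r′ :* q :+ b) :* (q :* (s :+ M₁ :+ M₂)) :+ q :* p :* (M₂ :+ r :* r :* j) :+ q :* b :* (r :* r :* j)) :+
        (b :* (q :+ p) :* i :+ q :* b :* k₃ :+ p :* b :* j) :=
      q :* q :* (con 2 :+ r :* s :+ k₃ :+ r :* M₁ :+ i) :+ (r′ :* q :+ b) :* ((r :* q :+ p) :* (i :+ j))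
        :+ q :* p :* (j :+ k₂ :+ r :* M₂) :+ q :* b :* (r :* M₂)) refl

  Outside : ∀ {N} → Rel N → (Fin N → Bool) → Fin N → Fin N → Set
  Outside E X u w = E u w ≡ true × X u ≡ false × X w ≡ false

  -- Deleting Y isolates I, and deleting X leaves the vertices in R in distinct
  -- components; together they refute the two hypotheses, for every a = p / q ≤ 1.
  record Certificate {N} (E : Rel N) (A : Fin N → Bool) (r : ℕ) : Set where
    field
      Y X I R   : Fin N → Bool
      I-alive   : ∀ v → I v ≡ true → A v ≡ true
      I-off     : ∀ v → I v ≡ true → Y v ≡ false
      I-closed  : ∀ v u → I v ≡ true → E v u ≡ true → Y u ≡ true
      R-alive   : ∀ v → R v ≡ true → A v ≡ true
      R-off     : ∀ v → R v ≡ true → X v ≡ false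
      R-apart   : ∀ u w → R u ≡ true → R w ≡ true → u ≢ w → ¬ Star (Outside E X) u w
      Y-alive   : ∀ v → Y v ≡ true → A v ≡ true
      X-alive   : ∀ v → X v ≡ true → A v ≡ true
      contradicts : ∀ p b → let q = p + b in .{{NonZero q}} →
                    (r * q + p) * count I ≤ q * count Y → p * count X + 2 * q ≤ q * count R

  module _ {N} {E : Rel N} (G : IsGraph E) {A : Fin N → Bool} (alive : Alive E A) {r′ : ℕ}
    (B : RBarrier E A (suc r′)) (loose : Loose G B) where

    private
      r = suc r′
    open IsGraph G
    open RBarrier B
    open Greedy G alive B

    module _ (st₁ st : State) (low : LowBound st₁) (high₁ : ∀ v → State.rest st₁ v ≡ true → r ≤ d v)
      (ph : Phase₂ st₁ st) (high₂ : ∀ v → State.rest st v ≡ true → d v ≢ r) where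

      open Phase₂ ph
      open State

      private
        Y X R′ : Fin N → Bool
        Y v = isS (part v) ∨ W st v
        -- The part of `W` in T goes with T, because `W` and `I` are disjoint; only its part in U
        -- has to be listed.
        X v = isS (part v) ∨ ((isT (part v) ∧ not (I st₁ v)) ∨ WU st₁ v)
        R′ v = (reps v ∧ not (W st₁ v)) ∨ I st₁ v

        alive-part : ∀ {v P} → part v ≡ P → P ≢ O → A v ≡ true
        alive-part {v} e h with A v in eq
        ... | true  = refl
        ... | false = contradiction (trans (sym e) (outside v eq)) h

        or : ∀ {a b} → a ∨ b ≡ true → a ≡ true ⊎ b ≡ true
        or {true}  _ = inj₁ refl
        or {false} h = inj₂ h

        not-true : ∀ {b} → not b ≡ true → b ≡ false
        not-true {false} _ = refl

        isS-true : ∀ {P} → isS P ≡ true → P ≡ S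
        isS-true {S} _ = refl

        W-alive : ∀ (st : State) v → W st v ≡ true → A v ≡ true
        W-alive st v h with W-out st v h
        ... | inj₁ t = alive-part t λ ()
        ... | inj₂ u = alive-part u λ ()

        R′-cases : ∀ v → R′ v ≡ true → (part v ≡ U × W st₁ v ≡ false × reps v ≡ true) ⊎ I st₁ v ≡ true
        R′-cases v h with or {reps v ∧ not (W st₁ v)} h
        ... | inj₂ i = inj₂ i
        ... | inj₁ e = let (a , b) = ∧-true {reps v} e in inj₁ (reps-U v a , not-true b , a)

        I-off-X : ∀ v → I st₁ v ≡ true → X v ≡ false
        I-off-X v h rewrite I-T st₁ v h | h = Bool.∧-zeroʳ (W st₁ v)

        I-nbr-X : ∀ v u → I st₁ v ≡ true → E v u ≡ true → X u ≡ true
        I-nbr-X v u h e with part u in eq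
        ... | S = refl
        ... | T = cong (λ b → not b ∨ (W st₁ u ∧ false)) notI
          where
          notI : I st₁ u ≡ false
          notI with I st₁ u in eqI
          ... | false = refl
          ... | true  = contradiction (disjoint st₁ u eqI) (true≢false (closed st₁ v u h e (cong isS eq)))
        ... | U = trans (Bool.∧-identityʳ (W st₁ u)) (closed st₁ v u h e (cong isS eq))
        ... | O = contradiction eq (inside u (alive u v (trans (symm u v) e)))

        -- Off `X` only vertices of U and the first-phase picks remain, and all neighbours of the
        -- picks are deleted.
        U-linked : ∀ {u w} → Outside E X u w → part u ≡ U
        U-linked {u} {w} (e , Xu , Xw) with part u in eq
        ... | U = refl
        ... | T = contradiction Xw (true≢false (I-nbr-X u w (isI (I st₁ u) Xu) e))
          where
          isI : ∀ i → not i ∨ (W st₁ u ∧ false) ≡ false → i ≡ true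
          isI true _ = refl
        ... | O = contradiction eq (inside u (alive u w e))

        Outside-sym : ∀ {u w} → Outside E X u w → Outside E X w u
        Outside-sym {u} {w} (e , Xu , Xw) = trans (symm w u) e , Xw , Xu

        linked : ∀ {u w} → Outside E X u w → Linked E part u w
        linked l = proj₁ l , U-linked l , U-linked (Outside-sym l)

        isolated : ∀ {u w} → I st₁ u ≡ true → Star (Outside E X) u w → u ≡ w
        isolated h ε = refl
        isolated {u} h (l ◅ _) = contradiction (trans (sym (I-T st₁ u h)) (U-linked l)) λ ()

        isolated′ : ∀ {u w} → I st₁ w ≡ true → Star (Outside E X) u w → u ≡ w
        isolated′ h p = sym (isolated h (Star.reverse Outside-sym p))

        apart : ∀ u w → R′ u ≡ true → R′ w ≡ true → u ≢ w → ¬ Star (Outside E X) u w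
        apart u w ru rw u≢w p with R′-cases u ru | R′-cases w rw
        ... | inj₂ i | _ = u≢w (isolated i p)
        ... | inj₁ _ | inj₂ i = u≢w (isolated′ i p)
        ... | inj₁ (_ , _ , ru′) | inj₁ (_ , _ , rw′) = separated u w ru′ rw′ u≢w (Star.map linked p)

        s = count (isS ∘ part)
        t = count (isT ∘ part)
        i = count (I st₁)
        t₁ = count (done st₁)
        C₁ = count (WU st₁)
        M₁ = count (W st₁)
        k₃ = count (rest st)

        size-Y : count Y ≤ s + M₁ + m
        size-Y = begin
          count Y          ≤⟨ ∑-mono-≤ (λ v → ⟦∨⟧≤ (isS (part v)) (W st v)) ⟩
          sum (λ v → ⟦ isS (part v) ⟧ + ⟦ W st v ⟧) ≡⟨ ∑-distrib-+ (⟦_⟧ ∘ isS ∘ part) (⟦_⟧ ∘ W st) ⟩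
          s + count (W st) ≡⟨ trans (cong (λ z → s + z) W-≡) (sym (+-assoc s M₁ m)) ⟩
          s + M₁ + m       ∎
          where
          open ≤-Reasoning
          ⟦∨⟧≤ : ∀ a b → ⟦ a ∨ b ⟧ ≤ ⟦ a ⟧ + ⟦ b ⟧
          ⟦∨⟧≤ true  b = s≤s z≤n
          ⟦∨⟧≤ false b = ≤-refl

        size-T : t ≡ t₁ + k + k₃
        size-T = trans (sym (rest+done st)) (cong (_+ k₃) done-≡)

        -- Adding `i` makes up for the picks that `X` leaves in T; `W-split` then trades `t₁ + C₁`
        -- for `M₁ + i`.
        size-X : count X ≤ s + k₃ + k + M₁
        size-X = +-cancelʳ-≤ i _ _ (begin
          count X + i ≡⟨ ∑-distrib-+ (⟦_⟧ ∘ X) (⟦_⟧ ∘ I st₁) ⟨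
          sum (λ v → ⟦ X v ⟧ + ⟦ I st₁ v ⟧) ≤⟨ ∑-mono-≤ (λ v → entry v (I st₁ v) refl) ⟩
          sum (λ v → ⟦ isS (part v) ⟧ + ⟦ isT (part v) ⟧ + ⟦ WU st₁ v ⟧)
            ≡⟨ trans (∑-distrib-+ (λ v → ⟦ isS (part v) ⟧ + ⟦ isT (part v) ⟧) (⟦_⟧ ∘ WU st₁))
                 (cong (_+ C₁) (∑-distrib-+ (⟦_⟧ ∘ isS ∘ part) (⟦_⟧ ∘ isT ∘ part))) ⟩
          s + t + C₁ ≡⟨ cong (λ z → s + z + C₁) size-T ⟩
          s + (t₁ + k + k₃) + C₁ ≡⟨ solve 5 (λ s t₁ k k₃ C₁ → s :+ (t₁ :+ k :+ k₃) :+ C₁ :=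
                s :+ k₃ :+ k :+ (t₁ :+ C₁)) refl s t₁ k k₃ C₁ ⟩
          s + k₃ + k + (t₁ + C₁) ≡⟨ cong (λ z → s + k₃ + k + z) (sym (W-split st₁)) ⟩
          s + k₃ + k + (M₁ + i) ≡⟨ +-assoc (s + k₃ + k) M₁ i ⟨
          s + k₃ + k + M₁ + i ∎)
          where
          open ≤-Reasoning
          entry : ∀ v b → I st₁ v ≡ b → ⟦ X v ⟧ + ⟦ b ⟧ ≤ ⟦ isS (part v) ⟧ + ⟦ isT (part v) ⟧ + ⟦ WU st₁ v ⟧
          entry v true e rewrite I-off-X v e | I-T st₁ v e = s≤s z≤n
          entry v false e rewrite e = ≤-trans (≤-reflexive (+-identityʳ _)) (by (part v) (WU st₁ v))
            where
            by : ∀ P b → ⟦ isS P ∨ ((isT P ∧ true) ∨ b) ⟧ ≤ ⟦ isS P ⟧ + ⟦ isT P ⟧ + ⟦ b ⟧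
            by S b = s≤s z≤n
            by T b = s≤s z≤n
            by U b = ≤-refl
            by O b = ≤-refl

        -- A representative lost to `W` lies in U and is counted by `C₁`.
        size-R : count reps + i ≤ count R′ + C₁
        size-R = subst₂ _≤_ (∑-distrib-+ (⟦_⟧ ∘ reps) (⟦_⟧ ∘ I st₁)) (∑-distrib-+ (⟦_⟧ ∘ R′) (⟦_⟧ ∘ WU st₁))
          (∑-mono-≤ λ v → entry v (reps v) refl (I st₁ v) refl)
          where
          entry : ∀ v a → reps v ≡ a → ∀ b → I st₁ v ≡ b → ⟦ a ⟧ + ⟦ b ⟧ ≤ ⟦ R′ v ⟧ + ⟦ WU st₁ v ⟧
          entry v true ea true eb = contradiction (trans (sym (I-T st₁ v eb)) (reps-U v ea)) λ ()
          entry v false ea false eb = z≤n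
          entry v false ea true eb rewrite ea | eb = s≤s z≤n
          entry v true ea false eb rewrite ea | eb | reps-U v ea with W st₁ v
          ... | true  = s≤s z≤n
          ... | false = s≤s z≤n

        D = sum (λ v → ⟦ isT (part v) ⟧ * d v)
        D₁ = weight (⟦_⟧ ∘ done st₁)

        -- Free of subtraction: beyond `D₁`, each vertex of T finished in the second phase has
        -- degree at least `r`, and each unfinished one at least `r` + 1, as both phases have run to
        -- the end.
        degrees : D₁ + r * (t₁ + k) + suc r * t ≤ D + r * t₁ + suc r * (t₁ + k)
        degrees = subst₂ _≤_
          (trans (three (λ v → ⟦ done st₁ v ⟧ * d v) (⟦_⟧ ∘ done st) (⟦_⟧ ∘ isT ∘ part)) (cong (λ z → D₁ + r * z + suc r * t) done-≡))
          (trans (three (λ v → ⟦ isT (part v) ⟧ * d v) (⟦_⟧ ∘ done st₁) (⟦_⟧ ∘ done st)) (cong (λ z → D + r * t₁ + suc r * z) done-≡))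
          (∑-mono-≤ λ v → entry v (isT (part v)) refl (I st₁ v ∨ W st₁ v) refl (I st v ∨ W st v) refl (mono v))
          where
          three : ∀ (f g h : Fin N → ℕ) → sum (λ v → f v + r * g v + suc r * h v) ≡ sum f + r * sum g + suc r * sum h
          three f g h = trans (∑-distrib-+ (λ v → f v + r * g v) (λ v → suc r * h v))
            (cong₂ _+_ (trans (∑-distrib-+ f (λ v → r * g v)) (cong (λ z → sum f + z) (∑-*ˡ r g))) (∑-*ˡ (suc r) h))
          entry : ∀ v t → isT (part v) ≡ t → ∀ a → I st₁ v ∨ W st₁ v ≡ a → ∀ b → I st v ∨ W st v ≡ b →
                  ⟦ done st₁ v ⟧ ≤ ⟦ done st v ⟧ →
                  ⟦ done st₁ v ⟧ * d v + r * ⟦ done st v ⟧ + suc r * ⟦ isT (part v) ⟧ ≤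
                  ⟦ isT (part v) ⟧ * d v + r * ⟦ done st₁ v ⟧ + suc r * ⟦ done st v ⟧
          entry v false et a ea b eb le rewrite et = ≤-refl
          entry v true et true ea true eb le rewrite et | ea | eb = ≤-refl
          entry v true et true ea false eb le rewrite et | ea | eb = contradiction le λ ()
          entry v true et false ea b eb le = later b eb (high₁ v (cong₂ (λ t a → t ∧ not a) et ea)) le
            where
            later : ∀ b → I st v ∨ W st v ≡ b → r ≤ d v → ⟦ done st₁ v ⟧ ≤ ⟦ done st v ⟧ →
                  ⟦ done st₁ v ⟧ * d v + r * ⟦ done st v ⟧ + suc r * ⟦ isT (part v) ⟧ ≤
                  ⟦ isT (part v) ⟧ * d v + r * ⟦ done st₁ v ⟧ + suc r * ⟦ done st v ⟧
            later true eb r≤d le rewrite et | ea | eb = +-monoˡ-≤ (suc r * 1) (begin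
              r * 1               ≡⟨ *-identityʳ r ⟩
              r                   ≤⟨ r≤d ⟩
              d v                 ≡⟨ trans (sym (*-identityˡ (d v))) (sym (+-identityʳ _)) ⟩
              1 * d v + 0         ≤⟨ +-monoʳ-≤ (1 * d v) z≤n ⟩
              1 * d v + r * 0     ∎)
              where open ≤-Reasoning
            later false eb r≤d le = finish (≤∧≢⇒< r≤d (λ e → high₂ v (cong₂ (λ t a → t ∧ not a) et eb) (sym e)))
              where
              finish : r < d v → 
                  ⟦ done st₁ v ⟧ * d v + r * ⟦ done st v ⟧ + suc r * ⟦ isT (part v) ⟧ ≤
                  ⟦ isT (part v) ⟧ * d v + r * ⟦ done st₁ v ⟧ + suc r * ⟦ done st v ⟧
              finish r<d rewrite et | ea | eb | *-zeroʳ r | *-identityʳ r | +-identityʳ (d v) | +-identityʳ (d v) | +-identityʳ (d v) = r<d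

        -- The sum of the barrier inequality, `size-R`, `degrees` and the first-phase bound; `Z`
        -- collects what cancels.
        main-bound : 2 + r * s + k₃ + r * M₁ + i ≤ count R′ + r * r * i
        main-bound = +-cancelʳ-≤ Z _ _ (begin
          2 + r * s + k₃ + r * M₁ + i + Z
            ≡⟨ solve 12 (λ r s k₃ M₁ i D t R C₁ D₁ t₁ k →
                  con 2 :+ r :* s :+ k₃ :+ r :* M₁ :+ i :+ (D :+ R :+ D₁ :+ C₁ :+ r :* (t₁ :+ k) :+ r :* (t₁ :+ k :+ k₃) :+ (t₁ :+ k) :+ r :* t₁) :=
                  (con 2 :+ r :* s :+ D) :+ (R :+ i) :+ (D₁ :+ r :* (t₁ :+ k) :+ (con 1 :+ r) :* (t₁ :+ k :+ k₃)) :+ (r :* t₁ :+ C₁ :+ r :* M₁)) refl r s k₃ M₁ i D t (count reps) C₁ D₁ t₁ k ⟩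
          (2 + r * s + D) + (count reps + i) + (D₁ + r * (t₁ + k) + suc r * (t₁ + k + k₃)) + (r * t₁ + C₁ + r * M₁)
            ≡⟨ cong (λ z → (2 + r * s + D) + (count reps + i) + (D₁ + r * (t₁ + k) + suc r * z) + (r * t₁ + C₁ + r * M₁)) size-T ⟨
          (2 + r * s + D) + (count reps + i) + (D₁ + r * (t₁ + k) + suc r * t) + (r * t₁ + C₁ + r * M₁)
            ≤⟨ +-mono-≤ (+-mono-≤ (+-mono-≤ value size-R) degrees) low ⟩
          (count reps + r * t) + (count R′ + C₁) + (D + r * t₁ + suc r * (t₁ + k)) + (r * r * i + D₁)
            ≡⟨ cong (λ z → (count reps + r * z) + (count R′ + C₁) + (D + r * t₁ + suc r * (t₁ + k)) + (r * r * i + D₁)) size-T ⟩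
          (count reps + r * (t₁ + k + k₃)) + (count R′ + C₁) + (D + r * t₁ + suc r * (t₁ + k)) + (r * r * i + D₁)
            ≡⟨ solve 10 (λ r rri k₃ w D R C₁ D₁ t₁ k →
                  (R :+ r :* (t₁ :+ k :+ k₃)) :+ (w :+ C₁) :+ (D :+ r :* t₁ :+ (con 1 :+ r) :* (t₁ :+ k)) :+ (rri :+ D₁) :=
                  w :+ rri :+ (D :+ R :+ D₁ :+ C₁ :+ r :* (t₁ :+ k) :+ r :* (t₁ :+ k :+ k₃) :+ (t₁ :+ k) :+ r :* t₁)) refl r (r * r * i) k₃ (count R′) D (count reps) C₁ D₁ t₁ k ⟩
          count R′ + r * r * i + Z ∎)
          where
          open ≤-Reasoning
          Z = D + count reps + D₁ + C₁ + r * (t₁ + k) + r * (t₁ + k + k₃) + (t₁ + k) + r * t₁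

      assemble : Certificate E A r
      assemble = record
        { Y = Y ; X = X ; I = I st ; R = R′
        ; I-alive = λ v h → alive-part (I-T st v h) λ ()
        ; I-off = λ v h → cong₂ (λ P w → isS P ∨ w) (I-T st v h) (disjoint st v h)
        ; I-closed = λ v u h e → closed-Y v u h e
        ; R-alive = λ v h → R-alive v (R′-cases v h)
        ; R-off = λ v h → R-off v (R′-cases v h)
        ; R-apart = apart
        ; Y-alive = λ v h → Y-alive v (or h)
        ; X-alive = λ v h → X-alive v h
        ; contradicts = contradicts
        }
        where
        closed-Y : ∀ v u → I st v ≡ true → E v u ≡ true → Y u ≡ true
        closed-Y v u h e with isS (part u) in eq
        ... | true  = refl
        ... | false = closed st v u h e eq
        R-alive : ∀ v → (part v ≡ U × W st₁ v ≡ false × reps v ≡ true) ⊎ I st₁ v ≡ true → A v ≡ true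
        R-alive v (inj₁ (u , _)) = alive-part u λ ()
        R-alive v (inj₂ h)       = alive-part (I-T st₁ v h) λ ()
        R-off : ∀ v → (part v ≡ U × W st₁ v ≡ false × reps v ≡ true) ⊎ I st₁ v ≡ true → X v ≡ false
        R-off v (inj₁ (u , w , _)) rewrite u | w = refl
        R-off v (inj₂ h)       = I-off-X v h
        Y-alive : ∀ v → isS (part v) ≡ true ⊎ W st v ≡ true → A v ≡ true
        Y-alive v (inj₁ h) = alive-part (isS-true h) λ ()
        Y-alive v (inj₂ h) = W-alive st v h
        X-alive : ∀ v → X v ≡ true → A v ≡ true
        X-alive v h with part v in eq
        ... | S = alive-part eq λ ()
        ... | T = alive-part eq λ ()
        ... | U = alive-part eq λ ()
        ... | O = contradiction (trans (sym (Bool.∧-zeroʳ (W st₁ v))) h) λ ()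
        contradicts : ∀ p b → let q = p + b in .{{NonZero q}} →
                      (r * q + p) * count (I st) ≤ q * count Y → p * count X + 2 * q ≤ q * count R′
        contradicts p b hA = *-cancelˡ-≤ (p + b) (begin
          q * (p * count X + 2 * q)               ≤⟨ *-monoʳ-≤ q (+-monoˡ-≤ (2 * q) (*-monoʳ-≤ p size-X)) ⟩
          q * (p * (s + k₃ + k + M₁) + 2 * q)     ≤⟨ weigh r′ p b {s} {i} {j} {M₁} {m} {k} {k₃} main-bound size-Y bound₁ bound₂
                                                      (subst (λ z → (r * q + p) * z ≤ q * count Y) I-≡ hA) ⟩
          q * (q * count R′)                      ∎)
          where
          open ≤-Reasoning
          q = p + b

    certificate : Certificate E A r
    certificate with phase₁ (suc (count (State.rest start))) start ≤-refl low-start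
    ... | st₁ , low , high₁ with phase₂ loose (suc (count (State.rest st₁))) st₁ st₁ ≤-refl (phase₂-start st₁)
    ... | st , ph , high₂ = assemble st₁ st low high₁ ph high₂

-- Translation between Boolean relations and multigraphs.

module Factors where

  open import Data.Bool.Base using (Bool; true; false; _∧_)
  import Data.Bool.Properties as Bool
  open import Data.Empty using (⊥; ⊥-elim)
  open import Data.Fin.Base using (Fin; zero; suc; combine; remQuot)
  open import Data.Fin.Properties using (_≟_; any?; remQuot-combine)
  open import Data.Fin.Subset as Subset using (Subset; _∈_; _⊆_)
  open import Data.Fin.Subset.Properties using (_∈?_; anySubset?; x∈p∧x∉q⇒x∈p─q)
  open import Data.Integer.Base as ℤ using (ℤ; -[1+_]; ∣_∣; -<+; +<+)
  import Data.Integer.Properties as ℤ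
  open import Data.List.Base as List using (List; _∷_; length; filter; deduplicate)
  import Data.List.Membership.Propositional as List∈
  open import Data.List.Membership.Propositional.Properties using (∈-filter⁺; ∈-allFin)
  open import Data.List.Relation.Unary.Any as Any using (here; there)
  open import Data.List.Relation.Unary.Any.Properties using (lookup-index)
  open import Data.Nat.Base
  open import Data.Nat.DivMod using (m≡m%n+[m/n]*n; [m+kn]%n≡m%n; m≥n⇒m/n>0)
  import Data.Nat.Properties as ℕ
  open import Data.Nat.Properties hiding (_≟_; suc-injective)
  open import Data.Nat.Solver using (module +-*-Solver)
  open import Data.Product.Base using (∃-syntax; _×_; _,_; proj₁; proj₂; uncurry)
  open import Data.Sum.Base using (_⊎_; inj₁; inj₂)
  open import Data.Vec.Base as Vec using (Vec; _∷_; tabulate)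
  open import Data.Vec.Properties using (lookup∘tabulate; lookup⇒[]=; []=⇒lookup)
  open import Defs
    using (Graph; V; mult; mult-sym; loopless; incident; degree; vertices; Adjacent; Connected;
      _∖_; iso; ω; connected?; NearFactor)
  open import Function.Base using (_∘_)
  open import Relation.Binary.Construct.Closure.ReflexiveTransitive as Star using (Star; ε; _◅◅_)
  open import Relation.Binary.PropositionalEquality
  open import Relation.Nullary using (¬_; yes; no; contradiction; Dec; does; ¬?)
  open import Relation.Nullary.Decidable using (dec-true; map′)
  open Sums
  open Integers
  open JumpSystems
  open Barriers
  open Certificates
  open +-*-Solver using (solve; con; _:+_; _:*_; _:=_)

  handshake : ∀ {N} (F : Rel N) → (∀ u v → F u v ≡ F v u) → (∀ v → F v v ≡ false) →
              ∃[ e ] sum (deg F) ≡ e + e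
  handshake {zero}  F sy ir = 0 , refl
  handshake {suc N} F sy ir =
    let (e , eq) = handshake (λ u v → F (suc u) (suc v)) (λ u v → sy (suc u) (suc v)) (λ v → ir (suc v)) in
    row + e , (begin
      ⟦ F zero zero ⟧ + row + sum (λ u → ⟦ F (suc u) zero ⟧ + deg F′ u)
        ≡⟨ cong₂ _+_ (cong (λ b → ⟦ b ⟧ + row) (ir zero)) (∑-distrib-+ (λ u → ⟦ F (suc u) zero ⟧) (deg F′)) ⟩
      row + (sum (λ u → ⟦ F (suc u) zero ⟧) + sum (deg F′))
        ≡⟨ cong₂ (λ a b → row + (a + b)) (sum-cong-≗ λ u → cong ⟦_⟧ (sy (suc u) zero)) eq ⟩
      row + (row + (e + e))
        ≡⟨ solve 2 (λ r e → r :+ (r :+ (e :+ e)) := r :+ e :+ (r :+ e)) refl row e ⟩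
      row + e + (row + e) ∎)
    where
    open ≡-Reasoning
    row = sum (λ v → ⟦ F zero (suc v) ⟧)
    F′ = λ u v → F (suc u) (suc v)

  double : ∀ a → a * 2 ≡ a + a
  double a = trans (*-comm a 2) (cong (λ z → a + z) (+-identityʳ a))

  abs-diff : ∀ a b → ∣ ℤ.+ a ℤ.- ℤ.+ b ∣ + ((a ⊓ b) + (a ⊓ b)) ≡ a + b
  abs-diff a b with ≤-total a b
  ... | inj₁ a≤b rewrite m≤n⇒m⊓n≡m a≤b | ℤ.m-n≡m⊖n a b | ℤ.∣⊖∣-≤ a≤b =
    trans (sym (+-assoc (b ∸ a) a a)) (trans (cong (_+ a) (m∸n+n≡m a≤b)) (+-comm b a))
  ... | inj₂ b≤a rewrite m≥n⇒m⊓n≡n b≤a | ℤ.m-n≡m⊖n a b | ℤ.∣m⊖n∣≡∣n⊖m∣ a b | ℤ.∣⊖∣-≤ b≤a =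
    trans (sym (+-assoc (a ∸ b) b b)) (cong (_+ b) (m∸n+n≡m b≤a))

  module _ {N} {E : Rel N} (G : IsGraph E) (f : Fin N → ℕ) where

    -- By `abs-diff` each deviation has the parity of degree plus target, and the degrees add up to
    -- an even number.
    dev-parity : ∀ (F : Sub E) → ∃[ m ] ∃[ e ] dev (excess G f F) + m * 2 ≡ sum f + e * 2
    dev-parity F = let (e , eq) = handshake (rel F) (rel-sym F) irr in sum m , e , (begin
        dev x + sum m * 2                          ≡⟨ cong (λ z → dev x + z) (trans (double (sum m)) (sym (∑-distrib-+ m m))) ⟩
        dev x + sum (λ v → m v + m v)              ≡⟨ ∑-distrib-+ (λ v → ∣ x v ∣) (λ v → m v + m v) ⟨
        sum (λ v → ∣ x v ∣ + (m v + m v))          ≡⟨ sum-cong-≗ (λ v → abs-diff (deg (rel F) v) (f v)) ⟩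
        sum (λ v → deg (rel F) v + f v)            ≡⟨ ∑-distrib-+ (deg (rel F)) f ⟩
        sum (deg (rel F)) + sum f                  ≡⟨ +-comm _ (sum f) ⟩
        sum f + sum (deg (rel F))                  ≡⟨ cong (λ z → sum f + z) (trans eq (sym (double e))) ⟩
        sum f + e * 2                              ∎)
      where
      open ≡-Reasoning
      x = excess G f F
      m : Fin N → ℕ
      m v = deg (rel F) v ⊓ f v
      irr : ∀ v → rel F v v ≡ false
      irr v = Bool.¬-not λ h → true≢false (rel-⊆ F v v h) (IsGraph.irrfl G v)

    -- The bound is 2 or 3, whichever has the common parity of all deviations.
    large-dev : (∀ F → 2 ≤ dev (excess G f F)) → ∃[ D ] 2 ≤ D × Parity G f D
    large-dev big = 2 + sum f % 2 , m≤m+n 2 _ , λ F →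
      let x = dev (excess G f F) ; (m , e , eq) = dev-parity F ; k = pred (x / 2) in k , (begin
        x                                ≡⟨ m≡m%n+[m/n]*n x 2 ⟩
        x % 2 + x / 2 * 2                ≡⟨ cong₂ (λ a b → a + b * 2) (trans (sym ([m+kn]%n≡m%n x m 2))
                                              (trans (cong (_% 2) eq) ([m+kn]%n≡m%n (sum f) e 2)))
                                              (sym (suc-pred (x / 2) {{>-nonZero (m≥n⇒m/n>0 (big F))}})) ⟩
        sum f % 2 + (2 + k * 2)          ≡⟨ +-comm (sum f % 2) _ ⟩
        2 + k * 2 + sum f % 2            ≡⟨ cong (2 +_) (trans (+-comm _ (sum f % 2)) (cong (λ z → sum f % 2 + z) (double k))) ⟩
        2 + sum f % 2 + (k + k)          ∎)
      where open ≡-Reasoning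

    -- Subgraphs are coded by subsets of a finite set of pairs, so that they can all be tried.
    -- Intersecting with `E` and both orientations makes every subset a valid code.
    decode : Subset (N * N) → Sub E
    decode s = record
      { rel = λ u v → E u v ∧ (at u v ∧ at v u)
      ; rel-sym = λ u v → cong₂ _∧_ (IsGraph.symm G u v) (Bool.∧-comm (at u v) (at v u))
      ; rel-⊆ = λ u v h → proj₁ (∧-true h) }
      where
      at : Rel N
      at u v = Vec.lookup s (combine u v)

    encode : Sub E → Subset (N * N)
    encode F = tabulate (λ i → uncurry (rel F) (remQuot {N} N i))

    decode-encode : ∀ F u v → rel (decode (encode F)) u v ≡ rel F u v
    decode-encode F u v = trans (cong₂ (λ a b → E u v ∧ (a ∧ b)) (at u v) (trans (at v u) (sym (rel-sym F u v))))
        (absorb (E u v) (rel F u v) (rel-⊆ F u v))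
      where
      at : ∀ u v → Vec.lookup (encode F) (combine u v) ≡ rel F u v
      at u v = trans (lookup∘tabulate _ (combine u v)) (cong (uncurry (rel F)) (remQuot-combine u v))
      absorb : ∀ a b → (b ≡ true → a ≡ true) → a ∧ (b ∧ b) ≡ b
      absorb a true h = trans (Bool.∧-identityʳ a) (h refl)
      absorb a false h = Bool.∧-zeroʳ a

    small-dev? : Dec (∃[ F ] dev (excess G f F) ≤ 1)
    small-dev? = map′ (λ { (s , h) → decode s , h })
      (λ { (F , h) → encode F , subst (_≤ 1) (sym (sum-cong-≗ λ v →
        cong (λ d → ∣ ℤ.+ d ℤ.- ℤ.+ f v ∣) (sum-cong-≗ λ u → cong ⟦_⟧ (decode-encode F v u)))) h })
      (anySubset? λ s → dev (excess G f (decode s)) ≤? 1)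

  does-true : ∀ {P : Set} (d : Dec P) → does d ≡ true → P
  does-true (yes p) _ = p

  subset : ∀ {N} → (Fin N → Bool) → Subset N
  subset = tabulate

  ∣subset∣ : ∀ {N} (P : Fin N → Bool) → Subset.∣ subset P ∣ ≡ count P
  ∣subset∣ {zero}  P = refl
  ∣subset∣ {suc N} P with P zero
  ... | true  = cong suc (∣subset∣ (P ∘ suc))
  ... | false = ∣subset∣ (P ∘ suc)

  ∈-subset⁺ : ∀ {N} (P : Fin N → Bool) {v} → P v ≡ true → v ∈ subset P
  ∈-subset⁺ P {v} h = lookup⇒[]= v (subset P) (trans (lookup∘tabulate P v) h)

  ∈-subset⁻ : ∀ {N} (P : Fin N → Bool) {v} → v ∈ subset P → P v ≡ true
  ∈-subset⁻ P {v} h = trans (sym (lookup∘tabulate P v)) ([]=⇒lookup h)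

  -- Double counting of pairs of a member of `R` and a list position that covers it: every member
  -- has a position, and no position has two members.
  count≤length : ∀ {N} {B : Set} (ys : List B) (cover : B → Fin N → Bool) (R : Fin N → Bool) →
    (∀ v → R v ≡ true → ∃[ y ] y List∈.∈ ys × cover y v ≡ true) →
    (∀ y u w → R u ≡ true → R w ≡ true → cover y u ≡ true → cover y w ≡ true → u ≡ w) →
    count R ≤ length ys
  count≤length {N} ys cover R onto inj = begin
    count R                                                ≤⟨ ∑-mono-≤ (λ v → covered v (R v) refl) ⟩
    sum (λ v → sum (λ k → ⟦ hit v k ⟧))                    ≡⟨ ∑-comm (λ v k → ⟦ hit v k ⟧) ⟩
    sum {length ys} (λ k → sum (λ v → ⟦ hit v k ⟧))        ≤⟨ ∑-mono-≤ (λ k → one (λ v → hit v k) λ u w hu hw →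
                                                                let (ru , cu) = ∧-true {R u} hu ; (rw , cw) = ∧-true {R w} hw in
                                                                inj (List.lookup ys k) u w ru rw cu cw) ⟩
    sum {length ys} (λ _ → 1)                              ≡⟨ trans (∑-const (length ys) 1) (*-identityʳ _) ⟩
    length ys                                              ∎
    where
    open ≤-Reasoning
    hit : Fin N → Fin (length ys) → Bool
    hit v k = R v ∧ cover (List.lookup ys k) v
    covered : ∀ v b → R v ≡ b → ⟦ b ⟧ ≤ sum (λ k → ⟦ hit v k ⟧)
    covered v false e = z≤n
    covered v true e with onto v e
    ... | y , y∈ys , c = ≤-trans (≤-reflexive (sym (∑-δ i))) (∑-mono-≤ entry)
      where
      i = Any.index y∈ys
      entry : ∀ k → δ i k ≤ ⟦ hit v k ⟧
      entry k with i ≟ k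
      ... | no _ = z≤n
      ... | yes refl = ≤-reflexive (cong ⟦_⟧ (sym (cong₂ _∧_ e (trans (cong (λ y → cover y v) (sym (lookup-index y∈ys))) c))))
    one : ∀ P → (∀ u w → P u ≡ true → P w ≡ true → u ≡ w) → count P ≤ 1
    one P h with any? (λ u → P u Bool.≟ true)
    ... | yes (u , Pu) = ≤-trans (∑-mono-≤ entry) (≤-reflexive (∑-δ u))
      where
      entry : ∀ w → ⟦ P w ⟧ ≤ δ u w
      entry w with P w in eq
      ... | false = z≤n
      ... | true rewrite h u w Pu eq = ≤-reflexive (sym (δ-≡ w))
    ... | no none = ≤-trans (≤-reflexive (trans (sum-cong-≗ zero-at) (∑-zero N))) z≤n
      where
      zero-at : ∀ w → ⟦ P w ⟧ ≡ 0
      zero-at w with P w in eq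
      ... | false = refl
      ... | true  = contradiction (w , eq) none

  module _ {N} (G : Graph N) where

    adjacent : Rel N
    adjacent u v = positive (mult G u v)
      where
      positive : ℕ → Bool
      positive zero    = false
      positive (suc _) = true

    alive : Fin N → Bool
    alive v = does (v ∈? V G)

    adjacent⁺ : ∀ {u v} → 0 < mult G u v → adjacent u v ≡ true
    adjacent⁺ {u} {v} h with mult G u v
    ... | suc _ = refl

    adjacent⁻ : ∀ {u v} → adjacent u v ≡ true → 0 < mult G u v
    adjacent⁻ {u} {v} h with mult G u v
    ... | suc _ = s≤s z≤n

    alive⁺ : ∀ {v} → v ∈ V G → alive v ≡ true
    alive⁺ {v} = dec-true (v ∈? V G)

    alive⁻ : ∀ {v} → alive v ≡ true → v ∈ V G
    alive⁻ {v} = does-true (v ∈? V G)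

    isGraph : IsGraph adjacent
    isGraph = record
      { symm  = λ u v → symmetric u v
      ; irrfl = irreflexive }
      where
      symmetric : ∀ u v → adjacent u v ≡ adjacent v u
      symmetric u v rewrite mult-sym G u v = refl
      irreflexive : ∀ v → adjacent v v ≡ false
      irreflexive v rewrite loopless G v = refl

    adjacent-alive : Alive adjacent alive
    adjacent-alive u v h = alive⁺ (incident G u v (adjacent⁻ h))

    subset-⊆ : ∀ P → (∀ v → P v ≡ true → alive v ≡ true) → subset P ⊆ V G
    subset-⊆ P h v∈ = alive⁻ (h _ (∈-subset⁻ P v∈))

    ∈-vertices : ∀ P {v} → alive v ≡ true → P v ≡ false → v List∈.∈ vertices (G ∖ subset P)
    ∈-vertices P {v} a h = ∈-filter⁺ (_∈? V (G ∖ subset P)) (∈-allFin v)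
      (x∈p∧x∉q⇒x∈p─q (alive⁻ a) λ v∈ → true≢false (∈-subset⁻ P v∈) h)

    count≤iso : ∀ (Y I : Fin N → Bool) → (∀ v → I v ≡ true → alive v ≡ true) → (∀ v → I v ≡ true → Y v ≡ false) →
                (∀ v u → I v ≡ true → adjacent v u ≡ true → Y u ≡ true) → count I ≤ iso (G ∖ subset Y)
    count≤iso Y I I-alive I-off closed = count≤length
      (filter (λ v → degree (G ∖ subset Y) v ℕ.≟ 0) (vertices (G ∖ subset Y)))
      (λ y v → does (y ≟ v)) I
      (λ v h → v , ∈-filter⁺ (λ v → degree (G ∖ subset Y) v ℕ.≟ 0) (∈-vertices Y (I-alive v h) (I-off v h)) (isolated v h) ,
               dec-true (v ≟ v) refl)
      (λ y u w _ _ yu yw → trans (sym (does-true (y ≟ u) yu)) (does-true (y ≟ w) yw))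
      where
      isolated : ∀ v → I v ≡ true → degree (G ∖ subset Y) v ≡ 0
      isolated v h = trans (sum-cong-≗ entry) (∑-zero N)
        where
        entry : ∀ u → mult (G ∖ subset Y) v u ≡ 0
        entry u with does (v ∈? subset Y) | u ∈? subset Y
        ... | true  | _     = refl
        ... | false | yes _ = refl
        ... | false | no u∉ with mult G v u in eq
        ...   | zero  = refl
        ...   | suc _ = contradiction (∈-subset⁺ Y (closed v u h (adjacent⁺ (subst (0 <_) (sym eq) (s≤s z≤n))))) u∉

    -- `deduplicate` drops a vertex only in favour of an earlier one connected to it.
    representative : ∀ H (xs : List (Fin N)) {v} → v List∈.∈ xs →
                     ∃[ y ] y List∈.∈ deduplicate (connected? H) xs × Connected H y v
    representative H (x ∷ xs) (here refl) = x , here refl , ε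
    representative H (x ∷ xs) (there v∈) with representative H xs v∈
    ... | y , y∈ , yv with connected? H x y
    ...   | yes xy = x , here refl , xy ◅◅ yv
    ...   | no ¬xy = y , there (∈-filter⁺ (λ z → ¬? (connected? H x z)) y∈ ¬xy) , yv

    outside-path : ∀ X {u w} → Adjacent (G ∖ subset X) u w → Outside adjacent X u w
    outside-path X {u} {w} h with u ∈? subset X | w ∈? subset X
    ... | no u∉ | no w∉ = adjacent⁺ h , off u∉ , off w∉
      where
      off : ∀ {u} → ¬ (u ∈ subset X) → X u ≡ false
      off {u} u∉ with X u in eq
      ... | false = refl
      ... | true  = contradiction (∈-subset⁺ X eq) u∉

    -- Two members of `R` under one component representative would be joined by a walk through it.
    count≤ω : ∀ (X R : Fin N → Bool) → (∀ v → R v ≡ true → alive v ≡ true) → (∀ v → R v ≡ true → X v ≡ false) →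
              (∀ u w → R u ≡ true → R w ≡ true → u ≢ w → ¬ Star (Outside adjacent X) u w) →
              count R ≤ ω (G ∖ subset X)
    count≤ω X R R-alive R-off apart = count≤length (deduplicate (connected? H) (vertices H))
      (λ y v → does (connected? H y v)) R onto inj
      where
      H = G ∖ subset X
      onto : ∀ v → R v ≡ true → ∃[ y ] y List∈.∈ deduplicate (connected? H) (vertices H) × does (connected? H y v) ≡ true
      onto v h = let (y , y∈ , yv) = representative H (vertices H) (∈-vertices X (R-alive v h) (R-off v h)) in
        y , y∈ , dec-true (connected? H y v) yv
      conn : ∀ y u → does (connected? H y u) ≡ true → Connected H y u
      conn y u = does-true (connected? H y u)
      inj : ∀ y u w → R u ≡ true → R w ≡ true → does (connected? H y u) ≡ true → does (connected? H y w) ≡ true → u ≡ w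
      inj y u w ru rw yu yw with u ≟ w
      ... | yes e = e
      ... | no u≢w = contradiction
        (Star.map (outside-path X) (Star.reverse (λ {a} {b} h → subst (0 <_) (mult-sym H a b) h) (conn y u yu) ◅◅ conn y w yw))
        (apart u w ru rw u≢w)

    module _ (r : ℕ) (F : Sub adjacent)
      (degs : ∀ v → alive v ≡ true → deg (rel F) v ≡ r ⊎ deg (rel F) v ≡ suc r)
      (once : ∀ u v → deg (rel F) u ≡ suc r → deg (rel F) v ≡ suc r → u ≡ v) where

      nearFactor : NearFactor r G
      nearFactor = record
        { F = record
          { V = V G
          ; mult = λ u v → ⟦ rel F u v ⟧
          ; mult-sym = λ u v → cong ⟦_⟧ (rel-sym F u v)
          ; loopless = λ v → loop v
          ; incident = λ u v h → incident G u v (adjacent⁻ (rel-⊆ F u v (pos h)))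
          }
        ; spanning = record { same-vertices = refl ; mult-≤ = λ u v → below u v }
        ; degrees = λ v v∈ → degs v (alive⁺ v∈)
        ; at-most-one-suc = λ u v _ _ → once u v
        }
        where
        pos : ∀ {b} → 0 < ⟦ b ⟧ → b ≡ true
        pos {true} _ = refl
        loop : ∀ v → ⟦ rel F v v ⟧ ≡ 0
        loop v with rel F v v in eq
        ... | false = refl
        ... | true  = contradiction (IsGraph.irrfl isGraph v) (true≢false (rel-⊆ F v v eq))
        below : ∀ u v → ⟦ rel F u v ⟧ ≤ mult G u v
        below u v with rel F u v in eq
        ... | false = z≤n
        ... | true  = adjacent⁻ (rel-⊆ F u v eq)

  excess-cases : ∀ d f → (∃[ k ] f ≡ d + suc k × ℤ.+ d ℤ.- ℤ.+ f ≡ -[1+ k ]) ⊎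
                         (∃[ k ] d ≡ f + k × ℤ.+ d ℤ.- ℤ.+ f ≡ ℤ.+ k)
  excess-cases d f with f ≤? d
  ... | yes f≤d = inj₂ (d ∸ f , sym (m+[n∸m]≡n f≤d) , trans (ℤ.m-n≡m⊖n d f) (ℤ.⊖-≥ f≤d))
  ... | no f≰d  = inj₁ (f ∸ suc d , f≡ ,
        trans (cong (λ z → ℤ.+ d ℤ.- ℤ.+ z) f≡) (trans (ℤ.m-n≡m⊖n d (d + suc k))
          (trans (cong (ℤ._⊖ (d + suc k)) (sym (+-identityʳ d))) (ℤ.+-cancelˡ-⊖ d 0 (suc k)))))
    where
    k = f ∸ suc d
    f≡ : f ≡ d + suc k
    f≡ = trans (sym (m+[n∸m]≡n (≰⇒> f≰d))) (sym (+-suc d k))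

  term≤∑ : ∀ {N} (g : Fin N → ℕ) v → g v ≤ sum g
  term≤∑ g zero    = m≤m+n (g zero) _
  term≤∑ g (suc v) = ≤-trans (term≤∑ (g ∘ suc) v) (m≤n+m _ (g zero))

  module _ {N} (G : Graph N) (r : ℕ) where

    private
      f : Fin N → ℕ
      f = constantly (alive G) r

      f-alive : ∀ v → alive G v ≡ true → f v ≡ r
      f-alive v h = trans (cong (λ b → ⟦ b ⟧ * r) h) (*-identityˡ r)

      x : Sub (adjacent G) → Fin N → ℤ
      x = excess (isGraph G) f

      f≤r : ∀ v → f v ≤ r
      f≤r v with alive G v
      ... | true  = ≤-reflexive (*-identityˡ r)
      ... | false = z≤n

    -- An unused edge is added at a vertex of degree r - 1, if there is one.
    smallDev⇒nearFactor : (∀ P → (∀ v → P v ≡ true → alive G v ≡ true) → r * iso (G ∖ subset P) ≤ count P) →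
                          ∃[ F ] dev (excess (isGraph G) f F) ≤ 1 → NearFactor r G
    smallDev⇒nearFactor iso-bound (F , small) with any? (λ v → x F v ℤ.<? ℤ.+ 0)
    ... | no none = nearFactor G r F degs once
      where
      degs : ∀ v → alive G v ≡ true → deg (rel F) v ≡ r ⊎ deg (rel F) v ≡ suc r
      degs v h with excess-cases (deg (rel F) v) (f v)
      ... | inj₁ (k , _ , e) = contradiction (v , subst (ℤ._< ℤ.+ 0) (sym e) -<+) none
      ... | inj₂ (zero , d , _) = inj₁ (trans d (trans (+-identityʳ _) (f-alive v h)))
      ... | inj₂ (suc zero , d , _) = inj₂ (trans d (trans (+-comm _ 1) (cong suc (f-alive v h))))
      ... | inj₂ (suc (suc k) , _ , e) = contradiction
            (≤-trans (subst (_≤ dev (x F)) (cong ∣_∣ e) (term≤∑ (λ v → ∣ x F v ∣) v)) small)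
            λ { (s≤s ()) }
      once : ∀ u v → deg (rel F) u ≡ suc r → deg (rel F) v ≡ suc r → u ≡ v
      once u v du dv = only-one (λ v → ∣ x F v ∣) small u v (large u du) (large v dv)
        where
        large : ∀ v → deg (rel F) v ≡ suc r → 1 ≤ ∣ x F v ∣
        large v d with excess-cases (deg (rel F) v) (f v)
        ... | inj₁ (_ , _ , e) = subst (1 ≤_) (sym (cong ∣_∣ e)) (s≤s z≤n)
        ... | inj₂ (suc _ , _ , e) = subst (1 ≤_) (sym (cong ∣_∣ e)) (s≤s z≤n)
        ... | inj₂ (zero , e , _) = contradiction (trans (sym d) (trans e (+-identityʳ _))) (<⇒≢ (s≤s (f≤r v)) ∘ sym)
    ... | yes (v , neg) with excess-cases (deg (rel F) v) (f v)
    ...   | inj₂ (k , _ , e) = contradiction (subst (ℤ._< ℤ.+ 0) e neg) λ { (+<+ ()) }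
    ...   | inj₁ (suc k , _ , e) = contradiction
            (≤-trans (subst (_≤ dev (x F)) (cong ∣_∣ e) (term≤∑ (λ v → ∣ x F v ∣) v)) small)
            λ { (s≤s ()) }
    ...   | inj₁ (zero , fv , e) = add (missing (isGraph G) (rel F) (adjacent G) v unused)
      where
      alive-v : alive G v ≡ true
      alive-v = Bool.¬-not λ dead → contradiction
        (trans (sym (cong (λ b → ⟦ b ⟧ * r) dead)) (trans fv (+-comm _ 1))) λ ()
      deg-v : suc (deg (rel F) v) ≡ r
      deg-v = trans (+-comm 1 _) (trans (sym fv) (f-alive v alive-v))
      just-v : Fin N → Bool
      just-v u = does (v ≟ u)
      -- Deleting the neighbourhood of `v` isolates `v`, so the isolation bound gives `v` at least
      -- `r` distinct neighbours, one more than `F` uses.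
      unused : deg (rel F) v < deg (adjacent G) v
      unused = begin
        suc (deg (rel F) v)                     ≡⟨ trans deg-v (sym (*-identityʳ r)) ⟩
        r * 1                                   ≤⟨ *-monoʳ-≤ r (≤-trans (≤-reflexive (trans (sym (∑-δ v)) (sum-cong-≗ same))) (count≤iso G (adjacent G v) just-v
                                                     (λ u h → subst (λ u → alive G u ≡ true) (does-true (v ≟ u) h) alive-v)
                                                     (λ u h → subst (λ u → adjacent G v u ≡ false) (does-true (v ≟ u) h) (IsGraph.irrfl (isGraph G) v))
                                                     (λ u w h e → subst (λ u → adjacent G u w ≡ true) (sym (does-true (v ≟ u) h)) e))) ⟩
        r * iso (G ∖ subset (adjacent G v))     ≤⟨ iso-bound (adjacent G v) (λ u h → adjacent-alive G u v (trans (IsGraph.symm (isGraph G) u v) h)) ⟩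
        deg (adjacent G) v                      ∎
        where
        open ≤-Reasoning
        same : ∀ u → δ v u ≡ ⟦ just-v u ⟧
        same u with v ≟ u
        ... | yes _ = refl
        ... | no _  = refl
      -- The single unit of deviation is spent at `v`.
      balanced : ∀ u → u ≢ v → deg (rel F) u ≡ f u
      balanced u u≢v with excess-cases (deg (rel F) u) (f u)
      ... | inj₂ (zero , d , _) = trans d (+-identityʳ _)
      ... | inj₂ (suc k , _ , e′) = contradiction (only-one (λ v → ∣ x F v ∣) small u v
              (subst (1 ≤_) (sym (cong ∣_∣ e′)) (s≤s z≤n)) (subst (1 ≤_) (sym (cong ∣_∣ e)) (s≤s z≤n))) u≢v
      ... | inj₁ (k , _ , e′) = contradiction (only-one (λ v → ∣ x F v ∣) small u v
              (subst (1 ≤_) (sym (cong ∣_∣ e′)) (s≤s z≤n)) (subst (1 ≤_) (sym (cong ∣_∣ e)) (s≤s z≤n))) u≢v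
      add : ∃[ w ] rel F v w ≡ false × adjacent G v w ≡ true → NearFactor r G
      add (w , Fvw , vw) = nearFactor G r F′ degs (λ u t du dt → trans (to-w u du) (sym (to-w t dt)))
        where
        v≢w = adjacent⇒≢ (isGraph G) vw
        F′ = toggleSub (isGraph G) v w vw F
        F′v : deg (rel F′) v ≡ r
        F′v = trans (ℤ.+-injective (proj₁ (toggle-add (isGraph G) vw F Fvw))) (trans (+-comm _ 1) deg-v)
        F′w : deg (rel F′) w ≡ suc (f w)
        F′w = trans (ℤ.+-injective (proj₂ (toggle-add (isGraph G) vw F Fvw)))
          (trans (+-comm _ 1) (cong suc (balanced w (v≢w ∘ sym))))
        F′u : ∀ u → u ≢ v → u ≢ w → deg (rel F′) u ≡ f u
        F′u u u≢v u≢w = trans (toggle-deg-other (isGraph G) v w (rel F) u u≢v u≢w) (balanced u u≢v)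
        degs : ∀ u → alive G u ≡ true → deg (rel F′) u ≡ r ⊎ deg (rel F′) u ≡ suc r
        degs u h = cases (u ≟ v) (u ≟ w)
          where
          cases : Dec (u ≡ v) → Dec (u ≡ w) → deg (rel F′) u ≡ r ⊎ deg (rel F′) u ≡ suc r
          cases (yes refl) _         = inj₁ F′v
          cases (no _) (yes refl)    = inj₂ (trans F′w (cong suc (f-alive u h)))
          cases (no u≢v) (no u≢w)    = inj₁ (trans (F′u u u≢v u≢w) (f-alive u h))
        to-w : ∀ u → deg (rel F′) u ≡ suc r → u ≡ w
        to-w u du = cases (u ≟ v) (u ≟ w)
          where
          cases : Dec (u ≡ v) → Dec (u ≡ w) → u ≡ w
          cases _ (yes e) = e
          cases (yes refl) (no _) = contradiction (trans (sym du) F′v) 1+n≢n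
          cases (no u≢v) (no u≢w) = contradiction (trans (sym du) (F′u u u≢v u≢w)) (<⇒≢ (s≤s (f≤r u)) ∘ sym)

  -- All that the real hypotheses have to deliver, in natural numbers. `Y` and `X` are fixed before
  -- the ratio p / (p + b), so the ratio may be fitted to them.
  combinatorial : ∀ {N} (G : Graph N) r .{{_ : NonZero r}} →
    (∀ S → S ⊆ V G → r * iso (G ∖ S) ≤ Subset.∣ S ∣) →
    (∀ Y X → Y ⊆ V G → X ⊆ V G →
      (∀ p b → let q = p + b in .{{NonZero q}} → (r * q + p) * iso (G ∖ Y) ≤ q * Subset.∣ Y ∣ →
        p * Subset.∣ X ∣ + 2 * q ≤ q * ω (G ∖ X)) → ⊥) →
    NearFactor r G
  combinatorial {N} G r@(suc r′) iso-bound no-certificate = by (small-dev? (isGraph G) f)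
    where
    f = constantly (alive G) r
    iso-bound′ : ∀ P → (∀ v → P v ≡ true → alive G v ≡ true) → r * iso (G ∖ subset P) ≤ count P
    iso-bound′ P h = subst (r * iso (G ∖ subset P) ≤_) (∣subset∣ P) (iso-bound (subset P) (subset-⊆ G P h))
    refute : Certificate (adjacent G) (alive G) r → ⊥
    refute C = no-certificate (subset Y) (subset X) (subset-⊆ G Y Y-alive) (subset-⊆ G X X-alive)
        λ p b h → ≤-trans
          (subst (λ z → p * z + 2 * (p + b) ≤ (p + b) * count R) (sym (∣subset∣ X))
            (contradicts p b (≤-trans (*-monoʳ-≤ (r * (p + b) + p) (count≤iso G Y I I-alive I-off I-closed))
              (subst (λ z → (r * (p + b) + p) * iso (G ∖ subset Y) ≤ (p + b) * z) (∣subset∣ Y) h))))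
          (*-monoʳ-≤ (p + b) (count≤ω G X R R-alive R-off R-apart))
      where open Certificate C
    deficiency-2 : ∀ {D} → 2 ≤ D → Barrier (adjacent G) (alive G) f D → Barrier (adjacent G) (alive G) f 2
    deficiency-2 2≤D B = record
      { part = part ; outside = outside ; inside = inside ; reps = reps
      ; reps-U = reps-U ; separated = separated ; value = ≤-trans (+-monoˡ-≤ _ 2≤D) value }
      where open Barrier B
    dead : ∀ p → alive G p ≡ false → f p ≡ 0
    dead p h = cong (λ b → ⟦ b ⟧ * r) h
    by : Dec (∃[ F ] dev (excess (isGraph G) f F) ≤ 1) → NearFactor r G
    by (yes small) = smallDev⇒nearFactor G r iso-bound′ small
    by (no large) with large-dev (isGraph G) f (λ F → ≰⇒> λ h → large (F , h))
    ... | D , 2≤D , P = ⊥-elim (barrier (suc (count (alive G))) (suc (N * N)) (isGraph G) (adjacent-alive G) dead P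
          ≤-refl (m≤n+m _ D) λ B → let (B′ , loose) = loosen (isGraph G) _ (rBarrier (deficiency-2 2≤D B)) ≤-refl in
            refute (certificate (isGraph G) (adjacent-alive G) B′ loose))

-- Rational estimates with uniform margins.

module Rationals where

  import Data.Integer.Base as ℤ
  import Data.Integer.Properties as ℤ
  open import Data.Nat.Base as ℕ using (ℕ; suc)
  import Data.Nat.Coprimality as C
  import Data.Nat.Properties as ℕ
  open import Data.Rational.Base as ℚ using (ℚ; 0ℚ; 1ℚ; mkℚ; _+_; _*_; _≤_; _<_; *≤*)
  open import Data.Rational.Properties
  open import Data.Rational.Solver using (module +-*-Solver)
  open import Defs using (inv; inv-inverse; 0<inv)
  open import Relation.Binary.PropositionalEquality

  ι : ℕ → ℚ
  ι n = ℤ.+ n ℚ./ 1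

  private
    ι-mk : ∀ n → ι n ≡ mkℚ (ℤ.+ n) 0 (C.sym (C.1-coprimeTo n))
    ι-mk n = normalize-coprime (C.sym (C.1-coprimeTo n))

  ι-+ : ∀ m n → ι (m ℕ.+ n) ≡ ι m + ι n
  ι-+ m n rewrite ι-mk m | ι-mk n = cong (ℚ._/ 1)
    (cong₂ ℤ._+_ (sym (ℤ.*-identityʳ (ℤ.+ m))) (sym (ℤ.*-identityʳ (ℤ.+ n))))

  ι-* : ∀ m n → ι (m ℕ.* n) ≡ ι m * ι n
  ι-* m n rewrite ι-mk m | ι-mk n = cong (ℚ._/ 1) (ℤ.pos-* m n)

  ι-≤ : ∀ {m n} → m ℕ.≤ n → ι m ≤ ι n
  ι-≤ {m} {n} h rewrite ι-mk m | ι-mk n =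
    *≤* (subst₂ ℤ._≤_ (sym (ℤ.*-identityʳ _)) (sym (ℤ.*-identityʳ _)) (ℤ.+≤+ h))

  0≤ι : ∀ n → 0ℚ ≤ ι n
  0≤ι n = nonNegative⁻¹ (ι n) {{normalize-nonNeg n 1}}

  ι-0< : ∀ n → 0ℚ < ι (suc n)
  ι-0< n = positive⁻¹ (ι (suc n)) {{normalize-pos (suc n) 1}}

  *-mono-≤-right : ∀ {p q} r → 0ℚ ≤ r → p ≤ q → p * r ≤ q * r
  *-mono-≤-right r 0≤r = *-monoʳ-≤-nonNeg r {{ℚ.nonNegative 0≤r}}

  0<*0< : ∀ {p q} → 0ℚ < p → 0ℚ < q → 0ℚ < p * q
  0<*0< {p} {q} 0<p 0<q = positive⁻¹ (p * q) {{pos*pos⇒pos p {{ℚ.positive 0<p}} q {{ℚ.positive 0<q}}}}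

  -- From y ≥ (Q + η) / P the quotient Q / y is at most P Q / (Q + η), which is `P` minus the
  -- margin. The margin does not mention `y`: a strict inequality of reals needs one margin for all
  -- late terms.
  reciprocal-gap : ∀ P Q y η → 0ℚ ≤ Q → 0ℚ < η → 0ℚ < y → Q + η ≤ y * P →
                   Q * inv y + (P * η) * inv (Q + η) ≤ P
  reciprocal-gap P Q y η 0≤Q 0<η 0<y le = begin
    Q * inv y + (P * η) * k        ≤⟨ +-monoˡ-≤ ((P * η) * k) Qy ⟩
    (P * k) * Q + (P * η) * k      ≡⟨ solve 4 (λ P k Q η → (P :* k) :* Q :+ (P :* η) :* k :=
          ((Q :+ η) :* k) :* P) refl P k Q η ⟩
    (c * k) * P                    ≡⟨ trans (cong (_* P) ck) (*-identityˡ P) ⟩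
    P                              ∎
    where
    open ≤-Reasoning
    open +-*-Solver
    c = Q + η
    k = inv c
    0<c : 0ℚ < c
    0<c = +-mono-≤-< 0≤Q 0<η
    ck : c * k ≡ 1ℚ
    ck = inv-inverse 0<c
    inv≤ : inv y ≤ P * k
    inv≤ = begin
      inv y                    ≡⟨ *-identityˡ (inv y) ⟨
      1ℚ * inv y               ≡⟨ cong (_* inv y) ck ⟨
      (c * k) * inv y          ≡⟨ solve 3 (λ c k i → (c :* k) :* i := c :* (i :* k)) refl c k (inv y) ⟩
      c * (inv y * k)          ≤⟨ *-mono-≤-right (inv y * k) (<⇒≤ (0<*0< (0<inv 0<y) (0<inv 0<c))) le ⟩
      (y * P) * (inv y * k)    ≡⟨ solve 4 (λ y P i k → (y :* P) :* (i :* k) :=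
            (y :* i) :* (P :* k)) refl y P (inv y) k ⟩
      (y * inv y) * (P * k)    ≡⟨ trans (cong (_* (P * k)) (inv-inverse 0<y)) (*-identityˡ _) ⟩
      P * k                    ∎
    Qy : Q * inv y ≤ (P * k) * Q
    Qy = subst (_≤ (P * k) * Q) (*-comm (inv y) Q) (*-mono-≤-right Q 0≤Q inv≤)

  -- The premise gives n ≤ x / (x + e), which is one minus the margin.
  below-one : ∀ x e n → 0ℚ ≤ x → 0ℚ < e → 0ℚ < n → x + e ≤ inv n * x → n + e * inv (x + e) ≤ 1ℚ
  below-one x e n 0≤x 0<e 0<n le = begin
    n + e * k          ≤⟨ +-monoˡ-≤ (e * k) n≤ ⟩
    x * k + e * k      ≡⟨ *-distribʳ-+ k x e ⟨
    c * k              ≡⟨ ck ⟩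
    1ℚ                 ∎
    where
    open ≤-Reasoning
    open +-*-Solver
    c = x + e
    k = inv c
    0<c : 0ℚ < c
    0<c = +-mono-≤-< 0≤x 0<e
    ck : c * k ≡ 1ℚ
    ck = inv-inverse 0<c
    n≤ : n ≤ x * k
    n≤ = begin
      n                      ≡⟨ *-identityˡ n ⟨
      1ℚ * n                 ≡⟨ cong (_* n) ck ⟨
      (c * k) * n            ≡⟨ solve 3 (λ c k n → (c :* k) :* n := c :* (n :* k)) refl c k n ⟩
      c * (n * k)            ≤⟨ *-mono-≤-right (n * k) (<⇒≤ (0<*0< 0<n (0<inv 0<c))) le ⟩
      (inv n * x) * (n * k)  ≡⟨ solve 4 (λ i x n k → (i :* x) :* (n :* k) :=
            (n :* i) :* (x :* k)) refl (inv n) x n k ⟩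
      (n * inv n) * (x * k)  ≡⟨ trans (cong (_* (x * k)) (inv-inverse 0<n)) (*-identityˡ _) ⟩
      x * k                  ∎

  -- Eliminating `w` cancels 2 P and leaves p x + P e ≤ a P x; the margin appears on division by
  -- `x`.
  ratio-gap : ∀ P p x e w a → 0ℚ < x → 0ℚ ≤ P → p * x + ι 2 * P ≤ P * w → w + e ≤ a * x + ι 2 →
              p + (P * e) * inv x ≤ a * P
  ratio-gap P p x e w a 0<x 0≤P h b = begin
    p + (P * e) * k                  ≡⟨ cong (_+ (P * e) * k) (trans (sym (*-identityʳ p)) (cong (p *_) (sym (inv-inverse 0<x)))) ⟩
    p * (x * k) + (P * e) * k        ≡⟨ solve 5 (λ p x k P e → p :* (x :* k) :+ (P :* e) :* k :=
          (p :* x :+ P :* e) :* k) refl p x k P e ⟩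
    (p * x + P * e) * k              ≤⟨ *-mono-≤-right k (<⇒≤ (0<inv 0<x)) mid ⟩
    ((a * P) * x) * k                ≡⟨ solve 4 (λ a P x k → ((a :* P) :* x) :* k :=
          (a :* P) :* (x :* k)) refl a P x k ⟩
    (a * P) * (x * k)                ≡⟨ trans (cong ((a * P) *_) (inv-inverse 0<x)) (*-identityʳ _) ⟩
    a * P                            ∎
    where
    open ≤-Reasoning
    open +-*-Solver
    k = inv x
    mid : p * x + P * e ≤ (a * P) * x
    mid = begin
      p * x + P * e                                  ≡⟨ solve 5 (λ p x P e t → p :* x :+ P :* e :=
            ((p :* x :+ t :* P) :+ P :* e) :- t :* P) refl p x P e (ι 2) ⟩
      ((p * x + ι 2 * P) + P * e) ℚ.- ι 2 * P        ≤⟨ +-monoˡ-≤ (ℚ.- (ι 2 * P)) (+-monoˡ-≤ (P * e) h) ⟩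
      (P * w + P * e) ℚ.- ι 2 * P                    ≡⟨ solve 4 (λ P w e t →
            (P :* w :+ P :* e) :- t :* P :=
            (w :+ e) :* P :- t :* P) refl P w e (ι 2) ⟩
      (w + e) * P ℚ.- ι 2 * P                        ≤⟨ +-monoˡ-≤ (ℚ.- (ι 2 * P)) (*-mono-≤-right P 0≤P b) ⟩
      (a * x + ι 2) * P ℚ.- ι 2 * P                  ≡⟨ solve 4 (λ a x t P →
            (a :* x :+ t) :* P :- t :* P :=
            (a :* P) :* x) refl a x (ι 2) P ⟩
      (a * P) * x                                    ∎

-- From the real hypotheses to natural numbers.

open import Defs
open import Data.Fin.Subset using (_⊆_; ∣_∣)
open import Data.Nat.Base as ℕ using (ℕ; NonZero; suc; zero)
open import Data.Product.Base using (_×_; ∃-syntax; _,_)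
import Data.Nat.Properties as ℕ
open import Data.Rational.Base as ℚ using (ℚ; 0ℚ; 1ℚ)
import Data.Rational.Properties as ℚ
open import Data.Rational.Solver using (module +-*-Solver)
open import Data.Empty using (⊥; ⊥-elim)
open import Relation.Binary.PropositionalEquality
open import Relation.Nullary using (¬_; yes; no; contradiction)
open Rationals
open Factors using (combinatorial)

Eventually : (ℕ → Set) → Set
Eventually P = ∃[ N ] (∀ i → N ℕ.≤ i → P i)

both : ∀ {P Q : ℕ → Set} → Eventually P → Eventually Q → Eventually (λ i → P i × Q i)
both (M , f) (N , g) = M ℕ.⊔ N , λ i h → f i (ℕ.m⊔n≤o⇒m≤o M N h) , g i (ℕ.m⊔n≤o⇒n≤o M N h)

eventually-map : ∀ {P Q : ℕ → Set} → (∀ i → P i → Q i) → Eventually P → Eventually Q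
eventually-map f (N , g) = N , λ i h → f i (g i h)

-- Yields the data of a strict inequality of reals, to be fed to a `_≤_`, which is its negation. The
-- successor on the right makes the margin positive.
quotient-gap : ∀ P Q (s : ℕ → ℚ) η → 0ℚ ℚ.< η →
  Eventually (λ i → 0ℚ ℚ.< s i × ι Q ℚ.+ η ℚ.≤ s i ℚ.* ι (suc P)) →
  ∃[ e ] (0ℚ ℚ.< e × Eventually (λ i → ι Q ℚ.* inv (s i) ℚ.+ e ℚ.≤ ι (suc P)))
quotient-gap P Q s η 0<η large =
  (ι (suc P) ℚ.* η) ℚ.* inv (ι Q ℚ.+ η) ,
  0<*0< (0<*0< (ι-0< P) 0<η) (0<inv (ℚ.+-mono-≤-< (0≤ι Q) 0<η)) ,
  eventually-map (λ i (pos , le) → reciprocal-gap (ι (suc P)) (ι Q) (s i) η (0≤ι Q) 0<η pos le) large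

succ-* : ∀ {r P Q} → Q ℕ.< r ℕ.* P → ι Q ℚ.+ ι 1 ℚ.≤ ι r ℚ.* ι P
succ-* {r} {P} {Q} lt = ℚ.≤-trans (ℚ.≤-reflexive (sym (ι-+ Q 1)))
  (ℚ.≤-trans (ι-≤ (subst (ℕ._≤ r ℕ.* P) (ℕ.+-comm 1 Q) lt)) (ℚ.≤-reflexive (ι-* r P)))

module _ (r : ℕ) .{{_ : NonZero r}} (n : ℝ) (1≤n : 1ℝ ≤ n) where

  private
    instance
      n-positive : Positive n
      n-positive = 1≤⇒positive 1≤n

    -- The terms of 1 / n and r + 1 / n, in the form in which they compute.
    a y : ℕ → ℚ
    a i = ι 1 ℚ.* inv (seq n i)
    y i = ι r ℚ.+ a i

    n>0 : Eventually (λ i → 0ℚ ℚ.< seq n i)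
    n>0 = from (1≤⇒positive 1≤n)
      where
      from : Positive n → Eventually (λ i → 0ℚ ℚ.< seq n i)
      from (positive (b , 0<b , N , h)) = N , λ i N≤i →
        ℚ.<-≤-trans 0<b (subst (ℚ._≤ seq n i) (ℚ.+-identityˡ b) (h i N≤i))

    0≤a : ∀ i → 0ℚ ℚ.< seq n i → 0ℚ ℚ.≤ a i
    0≤a i h = ℚ.<⇒≤ (0<*0< (ι-0< 0) (0<inv h))

    y>0 : ∀ i → 0ℚ ℚ.< seq n i → 0ℚ ℚ.< y i
    y>0 i h = ℚ.+-mono-<-≤ (r>0 r) (0≤a i h)
      where
      r>0 : ∀ r .{{_ : NonZero r}} → 0ℚ ℚ.< ι r
      r>0 (suc r) = ι-0< r

  -- The terms of 1 / n are eventually nonnegative, and r P, if above Q, is so by a whole unit; that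
  -- unit is the margin.
  iso-bound : ∀ P Q → fromℕ P ≤ fromℕ Q / (fromℕ r + 1ℝ / n) → r ℕ.* P ℕ.≤ Q
  iso-bound P Q A with r ℕ.* P ℕ.≤? Q
  ... | yes h = h
  iso-bound zero Q A | no h = contradiction (ℕ.≤-trans (ℕ.≤-reflexive (ℕ.*-zeroʳ r)) ℕ.z≤n) h
  iso-bound (suc P) Q A | no h = ⊥-elim (A (quotient-gap P Q y (ι 1) (ι-0< 0) (eventually-map large n>0)))
    where
    large : ∀ i → 0ℚ ℚ.< seq n i → 0ℚ ℚ.< y i × ι Q ℚ.+ ι 1 ℚ.≤ y i ℚ.* ι (suc P)
    large i pos = y>0 i pos , ℚ.≤-trans (succ-* {r} (ℕ.≰⇒> h))
      (*-mono-≤-right (ι (suc P)) (0≤ι (suc P))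
        (ℚ.≤-trans (ℚ.≤-reflexive (sym (ℚ.+-identityʳ (ι r)))) (ℚ.+-monoʳ-≤ (ι r) (0≤a i pos))))

  -- The certificate is refuted at a = min (1, (Q - r P) / P), the largest value
  -- in [0 , 1] for which (r + a) P ≤ Q: there x a + 2 ≤ w, so 1 / n exceeds a by
  -- a fixed margin, against 1 ≤ n or against the first hypothesis.
  no-ratio : ∀ P Q x w → fromℕ P ≤ fromℕ Q / (fromℕ r + 1ℝ / n) →
             fromℕ w < 1ℝ / n * fromℕ x + fromℕ 2 →
             (∀ p b → let q = p ℕ.+ b in .{{NonZero q}} → (r ℕ.* q ℕ.+ p) ℕ.* P ℕ.≤ q ℕ.* Q →
               p ℕ.* x ℕ.+ 2 ℕ.* q ℕ.≤ q ℕ.* w) → ⊥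
  no-ratio P Q x w A (e , 0<e , N , B) H with (r ℕ.* 1 ℕ.+ 1) ℕ.* P ℕ.≤? 1 ℕ.* Q
  -- At ratio 1 the certificate gives x + 2 ≤ w, so x / n exceeds x by `e` and `n` is below one by a
  -- fixed margin.
  ... | yes h = 1≤n (e ℚ.* inv (ι x ℚ.+ e) , 0<*0< 0<e (0<inv (ℚ.+-mono-≤-< (0≤ι x) 0<e)) ,
          eventually-map small (both n>0 (N , B)))
    where
    x+2≤w : x ℕ.+ 2 ℕ.≤ w
    x+2≤w = subst₂ ℕ._≤_ (cong (ℕ._+ 2) (ℕ.*-identityˡ x)) (ℕ.*-identityˡ w) (H 1 0 h)
    small : ∀ i → 0ℚ ℚ.< seq n i × ι w ℚ.+ e ℚ.≤ a i ℚ.* ι x ℚ.+ ι 2 →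
            seq n i ℚ.+ e ℚ.* inv (ι x ℚ.+ e) ℚ.≤ 1ℚ
    small i (pos , b) = below-one (ι x) e (seq n i) (0≤ι x) 0<e pos (begin
      ι x ℚ.+ e                              ≡⟨ solve 3 (λ x e t → x :+ e := ((x :+ t) :+ e) :- t) refl (ι x) e (ι 2) ⟩
      (ι x ℚ.+ ι 2 ℚ.+ e) ℚ.- ι 2            ≤⟨ ℚ.+-monoˡ-≤ (ℚ.- ι 2) (ℚ.+-monoˡ-≤ e (ℚ.≤-trans (ℚ.≤-reflexive (sym (ι-+ x 2))) (ι-≤ x+2≤w))) ⟩
      (ι w ℚ.+ e) ℚ.- ι 2                    ≤⟨ ℚ.+-monoˡ-≤ (ℚ.- ι 2) b ⟩
      (a i ℚ.* ι x ℚ.+ ι 2) ℚ.- ι 2          ≡⟨ solve 2 (λ u t → (u :+ t) :- t := u) refl (a i ℚ.* ι x) (ι 2) ⟩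
      a i ℚ.* ι x                            ≡⟨ cong (ℚ._* ι x) (ℚ.*-identityˡ (inv (seq n i))) ⟩
      inv (seq n i) ℚ.* ι x                  ∎)
      where
      open ℚ.≤-Reasoning
      open +-*-Solver
  no-ratio zero Q x w A (e , 0<e , N , B) H | no h =
    contradiction (ℕ.≤-trans (ℕ.≤-reflexive (ℕ.*-zeroʳ (r ℕ.* 1 ℕ.+ 1))) ℕ.z≤n) h
  no-ratio P@(suc P′) Q x w A (e , 0<e , N , B) H | no h = by x Hx B
    where
    rP≤Q : r ℕ.* P ℕ.≤ Q
    rP≤Q = iso-bound P Q A
    p = Q ℕ.∸ r ℕ.* P
    Q≡ : r ℕ.* P ℕ.+ p ≡ Q
    Q≡ = ℕ.m+[n∸m]≡n rP≤Q
    p≤P : p ℕ.≤ P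
    p≤P = ℕ.+-cancelˡ-≤ (r ℕ.* P) p P (begin
      r ℕ.* P ℕ.+ p             ≡⟨ trans Q≡ (sym (ℕ.*-identityˡ Q)) ⟩
      1 ℕ.* Q                   ≤⟨ ℕ.<⇒≤ (ℕ.≰⇒> h) ⟩
      (r ℕ.* 1 ℕ.+ 1) ℕ.* P     ≡⟨ trans (cong (λ z → (z ℕ.+ 1) ℕ.* P) (ℕ.*-identityʳ r)) (trans (ℕ.*-distribʳ-+ P r 1) (cong (r ℕ.* P ℕ.+_) (ℕ.*-identityˡ P))) ⟩
      r ℕ.* P ℕ.+ P             ∎)
      where open ℕ.≤-Reasoning
    q≡P : p ℕ.+ (P ℕ.∸ p) ≡ P
    q≡P = ℕ.m+[n∸m]≡n p≤P
    -- At this ratio the premise of `H` holds with equality.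
    Hx : p ℕ.* x ℕ.+ 2 ℕ.* P ℕ.≤ P ℕ.* w
    Hx = subst (λ q → p ℕ.* x ℕ.+ 2 ℕ.* q ℕ.≤ q ℕ.* w) q≡P
      (H p (P ℕ.∸ p) {{subst NonZero (sym q≡P) _}} (subst (λ q → (r ℕ.* q ℕ.+ p) ℕ.* P ℕ.≤ q ℕ.* Q) (sym q≡P)
        (ℕ.≤-reflexive (trans (cong (ℕ._* P) Q≡) (ℕ.*-comm Q P)))))
    by : ∀ x → p ℕ.* x ℕ.+ 2 ℕ.* P ℕ.≤ P ℕ.* w →
         (∀ i → N ℕ.≤ i → ι w ℚ.+ e ℚ.≤ a i ℚ.* ι x ℚ.+ ι 2) → ⊥
    -- Nothing is deleted, so there is no division by `x`; instead 2 ≤ w contradicts w < 2.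
    by zero Hx B = ℚ.<-irrefl refl (ℚ.<-≤-trans 0<e (begin
      e                                     ≡⟨ solve 2 (λ e t → e := (t :+ e) :- t) refl e (ι 2) ⟩
      (ι 2 ℚ.+ e) ℚ.- ι 2                   ≤⟨ ℚ.+-monoˡ-≤ (ℚ.- ι 2) (ℚ.+-monoˡ-≤ e (ι-≤ 2≤w)) ⟩
      (ι w ℚ.+ e) ℚ.- ι 2                   ≤⟨ ℚ.+-monoˡ-≤ (ℚ.- ι 2) (B N ℕ.≤-refl) ⟩
      (a N ℚ.* 0ℚ ℚ.+ ι 2) ℚ.- ι 2          ≡⟨ solve 2 (λ a t → (a :* con 0ℚ :+ t) :- t := con 0ℚ) refl (a N) (ι 2) ⟩
      0ℚ                                    ∎))
      where
      open ℚ.≤-Reasoning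
      open +-*-Solver
      2≤w : 2 ℕ.≤ w
      2≤w = ℕ.*-cancelˡ-≤ P (ℕ.≤-trans (ℕ.≤-reflexive (trans (ℕ.*-comm P 2) (cong (ℕ._+ 2 ℕ.* P) (sym (ℕ.*-zeroʳ p))))) Hx)
    by (suc x) Hx B = A (quotient-gap P′ Q y η 0<η (eventually-map large (both n>0 (N , B))))
      where
      η = (ι P ℚ.* e) ℚ.* inv (ι (suc x))
      0<η : 0ℚ ℚ.< η
      0<η = 0<*0< (0<*0< (ι-0< P′) 0<e) (0<inv (ι-0< x))
      Hι : ι p ℚ.* ι (suc x) ℚ.+ ι 2 ℚ.* ι P ℚ.≤ ι P ℚ.* ι w
      Hι = subst₂ ℚ._≤_ (trans (ι-+ (p ℕ.* suc x) (2 ℕ.* P)) (cong₂ ℚ._+_ (ι-* p (suc x)) (ι-* 2 P))) (ι-* P w) (ι-≤ Hx)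
      large : ∀ i → 0ℚ ℚ.< seq n i × ι w ℚ.+ e ℚ.≤ a i ℚ.* ι (suc x) ℚ.+ ι 2 →
              0ℚ ℚ.< y i × ι Q ℚ.+ η ℚ.≤ y i ℚ.* ι P
      large i (pos , b) = y>0 i pos , (begin
        ι Q ℚ.+ η                              ≡⟨ cong (λ z → ι z ℚ.+ η) Q≡ ⟨
        ι (r ℕ.* P ℕ.+ p) ℚ.+ η                ≡⟨ cong (ℚ._+ η) (trans (ι-+ (r ℕ.* P) p) (cong (ℚ._+ ι p) (ι-* r P))) ⟩
        ι r ℚ.* ι P ℚ.+ ι p ℚ.+ η              ≡⟨ ℚ.+-assoc (ι r ℚ.* ι P) (ι p) η ⟩
        ι r ℚ.* ι P ℚ.+ (ι p ℚ.+ η)            ≤⟨ ℚ.+-monoʳ-≤ (ι r ℚ.* ι P)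
                                                   (ratio-gap (ι P) (ι p) (ι (suc x)) e (ι w) (a i) (ι-0< x) (0≤ι P) Hι b) ⟩
        ι r ℚ.* ι P ℚ.+ a i ℚ.* ι P            ≡⟨ ℚ.*-distribʳ-+ (ι P) (ι r) (a i) ⟨
        y i ℚ.* ι P                            ∎)
        where open ℚ.≤-Reasoning

module _ (r : ℕ) .{{_ : NonZero r}} where

  iso-bound-suc : ∀ P Q → fromℕ P ≤ fromℕ Q / (fromℕ r + 1ℝ) → suc r ℕ.* P ℕ.≤ Q
  iso-bound-suc P Q A with suc r ℕ.* P ℕ.≤? Q
  ... | yes h = h
  iso-bound-suc zero Q A | no h = contradiction (ℕ.≤-trans (ℕ.≤-reflexive (ℕ.*-zeroʳ (suc r))) ℕ.z≤n) h
  iso-bound-suc (suc P) Q A | no h = ⊥-elim (A (quotient-gap P Q (λ _ → ι r ℚ.+ ι 1) (ι 1) (ι-0< 0)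
    (0 , λ _ _ → subst (0ℚ ℚ.<_) r+1 (ι-0< r) ,
      subst (λ z → ι Q ℚ.+ ι 1 ℚ.≤ z ℚ.* ι (suc P)) r+1 (succ-* {suc r} (ℕ.≰⇒> h)))))
    where
    r+1 : ι (suc r) ≡ ι r ℚ.+ ι 1
    r+1 = trans (cong ι (ℕ.+-comm 1 r)) (ι-+ r 1)

-- Both terms of the maximum are at most x + 1, so `w` exceeds it with margin one.
not-tough : ∀ w x → x ℕ.+ 2 ℕ.≤ w → ¬ (fromℕ w ≤ 1ℝ ⊔ fromℕ x / 1ℝ)
not-tough w x h tough = tough (ι 1 , ι-0< 0 , 0 , λ i _ → begin
    (ι 1 ℚ.⊔ (ι x ℚ.* inv (ι 1))) ℚ.+ ι 1 ≤⟨ ℚ.+-monoˡ-≤ (ι 1) (ℚ.⊔-lub (ι-≤ (ℕ.m≤n+m 1 x))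
                                            (ℚ.≤-trans (ℚ.≤-reflexive (ℚ.*-identityʳ (ι x))) (ι-≤ (ℕ.m≤m+n x 1)))) ⟩
    ι (x ℕ.+ 1) ℚ.+ ι 1                  ≡⟨ trans (sym (ι-+ (x ℕ.+ 1) 1)) (cong ι (ℕ.+-assoc x 1 1)) ⟩
    ι (x ℕ.+ 2)                          ≤⟨ ι-≤ h ⟩
    ι w                                  ∎)
  where open ℚ.≤-Reasoning

mainTheorem8 :
    (r : ℕ) .{{_ : NonZero r}} (N : ℕ) (G : Graph N) →
      ((n : ℝ) (1≤n : 1ℝ ≤ n) →
        let instance
              n-positive : Positive n
              n-positive = 1≤⇒positive 1≤n
        in
        (∀ S → S ⊆ V G → fromℕ (iso (G ∖ S)) ≤ fromℕ ∣ S ∣ / (fromℕ r + 1ℝ / n)) →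
        (∀ S → S ⊆ V G → fromℕ (ω (G ∖ S)) < 1ℝ / n * fromℕ ∣ S ∣ + fromℕ 2) →
        NearFactor r G)
      ×
      (Tough 1ℝ G →
       (∀ S → S ⊆ V G → fromℕ (iso (G ∖ S)) ≤ fromℕ ∣ S ∣ / (fromℕ r + 1ℝ)) →
       NearFactor r G)
mainTheorem8 r N G = general , tough
  where
  general : (n : ℝ) (1≤n : 1ℝ ≤ n) → _
  general n 1≤n A B = combinatorial G r
    (λ S S⊆V → iso-bound r n 1≤n (iso (G ∖ S)) ∣ S ∣ (A S S⊆V))
    (λ Y X Y⊆V X⊆V → no-ratio r n 1≤n (iso (G ∖ Y)) ∣ Y ∣ ∣ X ∣ (ω (G ∖ X)) (A Y Y⊆V) (B X X⊆V))
  tough : _ → _ → NearFactor r G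
  tough T A = combinatorial G r
    (λ S S⊆V → ℕ.≤-trans (ℕ.m≤n+m (r ℕ.* iso (G ∖ S)) (iso (G ∖ S))) (iso-bound-suc r (iso (G ∖ S)) ∣ S ∣ (A S S⊆V)))
    -- Toughness one corresponds to the ratio a = 1, that is p = 1 and b = 0.
    (λ Y X Y⊆V X⊆V H → not-tough (ω (G ∖ X)) ∣ X ∣
      (subst₂ ℕ._≤_ (cong (ℕ._+ 2) (ℕ.*-identityˡ ∣ X ∣)) (ℕ.*-identityˡ (ω (G ∖ X)))
        (H 1 0 (ℕ.≤-trans (ℕ.≤-reflexive (cong (ℕ._* iso (G ∖ Y)) (trans (cong (ℕ._+ 1) (ℕ.*-identityʳ r)) (ℕ.+-comm r 1))))
          (ℕ.≤-trans (iso-bound-suc r (iso (G ∖ Y)) ∣ Y ∣ (A Y Y⊆V)) (ℕ.≤-reflexive (sym (ℕ.*-identityˡ ∣ Y ∣)))))))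
      (T X X⊆V))
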